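{- Let $k\ge 2$ and let $H$ be the 3-graph on vertices $0,1,1',2,2',\dots,k,k'$ whose triples are $\{0,i,i'\}$ for $i=1,\dots,k$ and $\{i-2,i-1,i'\}$ for $i=1,\dots,k$, where unprimed indices $i-2,i-1$ are read modulo $k$ in $\{1,\dots,k\}$ (so these triples are $\{k-1,k,1'\},\{k,1,2'\},\{1,2,3'\},\dots,\{k-2,k-1,k'\}$). Then $H$ has $L_k$ spanning trees, where $L_k$ is the $k$-th Lucas number. For odd $k$ the 3-graph $H$ is 3-Pfaffian, and for even $k\ge 4$ it is non-3-Pfaffian. Furthermore, for even $k\ge4$, $H$ is minimal non-3-Pfaffian with respect to deletion and contraction of triples.
   Context: Lucas numbers: $L_1=1$, $L_2=3$, $L_k=L_{k-1}+L_{k-2}$ for $k\ge3$. A 3-graph is $H=(V,\Delta)$ with $\Delta\subseteq\binom V3$ (triples). A cycle is a sequence $a_0,t_1,a_1,\dots,t_\ell,a_\ell=a_0$, $\ell\ge2$, of distinct vertices $a_0,\dots,a_{\ell-1}$ and distinct triples with $a_{i-1},a_i\in t_i$. A spanning tree is a set of triples with no cycle, covering $V$, connected via paths of triples. Identify $V$ with $[N]$ by a linear order; a triple orientation $\omega$ assigns each triple $t=\{i,j,k\}$ a 3-cycle $\sigma(t,\omega)\in\{(i\,j\,k),(j\,i\,k)\}$; for a spanning tree $T$, $\prod_{t\in T}\sigma(t,\omega)$ is an $N$-cycle $(s(1)\cdots s(N))$ and $\mathrm{sgn}(T,\omega)$ is the sign of $s$ (well defined). A 3-graph is 3-Pfaffian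 if some $\omega$ makes $\mathrm{sgn}(T,\omega)$ constant over all spanning trees (vacuously if no spanning tree). Deleting a triple $abc$ gives $H\setminus abc=(V,\Delta\setminus\{abc\})$. Contracting $abc$ gives $H/abc$ on $V\setminus\{b,c\}$ whose triples are the triples of $H$ disjoint from $\{a,b,c\}$ together with the triples of $H$ meeting $\{a,b,c\}$ in exactly one vertex, with that vertex relabelled $a$ (repeated triples identified; triples meeting $\{a,b,c\}$ in two or more vertices are discarded). $H$ is minimal non-3-Pfaffian (w.r.t. deletion and contraction) if $H$ is not 3-Pfaffian but $H\setminus t$ and $H/t$ are 3-Pfaffian for every triple $t$. -}

module Defs where

open import Data.Bool.Base using (Bool; true; false; if_then_else_; _∧_; _∨_; not)
open import Data.Nat.Base using (ℕ; zero; suc; _+_; _∸_; _≤_; _<ᵇ_; _≡ᵇ_)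
open import Data.Fin.Base using (Fin; zero; suc; fromℕ; inject₁)
open import Data.Fin.Subset using (Subset; _∈_)
open import Data.List.Base using (List; []; _∷_; length; lookup; removeAt; allFin; map; filter; concat; upTo; deduplicateᵇ; foldr; filterᵇ)
import Data.List.Membership.Propositional as LM
open import Data.List.Relation.Unary.Unique.Propositional using (Unique)
open import Data.Vec.Base as Vec using ()
open import Data.Product.Base using (Σ; _×_; _,_; ∃)
open import Data.Sum.Base using (_⊎_)
open import Data.Sign.Base using (Sign) renaming (+ to plus; - to minus)
open import Function.Base using (id; _∘_)
open import Function.Bundles using (_⇔_)
open import Relation.Binary.PropositionalEquality using (_≡_)
open import Relation.Nullary using (¬_)

L : ℕ → ℕ
L zero = 2
L (suc zero) = 1
L (suc (suc n)) = L (suc n) + L n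

-- 3-graphs.  Vertices are natural-number labels; the vertex set is a
-- list V of distinct labels, and the linear order on V used to identify
-- V with [N] is the order of the list.  A triple {x,y,z} is stored as an
-- ordered tuple (x , y , z) of distinct vertices.

Triple : Set
Triple = ℕ × ℕ × ℕ

record Graph3 : Set where
  constructor graph3
  field
    V : List ℕ
    E : List Triple

open Graph3 public

#E : Graph3 → ℕ
#E H = length (E H)

tri : (H : Graph3) → Fin (#E H) → Triple
tri H e = lookup (E H) e

_∈ₜ_ : ℕ → Triple → Set
v ∈ₜ (x , y , z) = v ≡ x ⊎ v ≡ y ⊎ v ≡ z

-- A cycle a₀,t₁,a₁,…,t_ℓ,a_ℓ = a₀ (ℓ ≥ 2) inside the triple set T:
-- here a : Fin (suc ℓ) → ℕ gives a₀ … a_ℓ and t : Fin ℓ → Fin (#E H)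
-- gives t₁ … t_ℓ (t i is t_{i+1}, containing a_i and a_{i+1}).
HasCycle : (H : Graph3) → Subset (#E H) → Set
HasCycle H T =
  Σ ℕ λ ℓ → 2 ≤ ℓ ×
  Σ (Fin (suc ℓ) → ℕ) λ a →
  Σ (Fin ℓ → Fin (#E H)) λ t →
    a (fromℕ ℓ) ≡ a zero ×
    (∀ i j → a (inject₁ i) ≡ a (inject₁ j) → i ≡ j) ×
    (∀ i j → t i ≡ t j → i ≡ j) ×
    (∀ i → t i ∈ T) ×
    (∀ i → a (inject₁ i) ∈ₜ tri H (t i) × a (suc i) ∈ₜ tri H (t i))

data Joined (H : Graph3) (T : Subset (#E H)) : ℕ → ℕ → Set where
  here : ∀ {u} → Joined H T u u
  step : ∀ {u w v} (e : Fin (#E H)) → e ∈ T → u ∈ₜ tri H e → w ∈ₜ tri H e →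
         Joined H T w v → Joined H T u v

record IsSpanningTree (H : Graph3) (T : Subset (#E H)) : Set where
  field
    acyclic   : ¬ HasCycle H T
    covering  : ∀ v → v LM.∈ V H → ∃ λ e → e ∈ T × v ∈ₜ tri H e
    connected : ∀ u v → u LM.∈ V H → v LM.∈ V H → Joined H T u v

NumSpanningTrees : Graph3 → ℕ → Set
NumSpanningTrees H n =
  Σ (List (Subset (#E H))) λ Ts →
    Unique Ts × (∀ T → (T LM.∈ Ts) ⇔ IsSpanningTree H T) × length Ts ≡ n

cyc3 : ℕ → ℕ → ℕ → ℕ → ℕ
cyc3 x y z v =
  if v ≡ᵇ x then y else if v ≡ᵇ y then z else if v ≡ᵇ z then x else v

-- a triple orientation: for each triple (x,y,z) choose (x y z) (true)
-- or (y x z) (false); these are the two 3-cycles on {x,y,z}.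
Orientation : Graph3 → Set
Orientation H = Fin (#E H) → Bool

σ : Triple → Bool → ℕ → ℕ
σ (x , y , z) true  = cyc3 x y z
σ (x , y , z) false = cyc3 y x z

prodPerm : (H : Graph3) → Subset (#E H) → Orientation H → ℕ → ℕ
prodPerm H T ω =
  foldr (λ e f → if Vec.lookup T e then σ (tri H e) (ω e) ∘ f else f) id (allFin (#E H))

-- position of a vertex in the vertex list (identification V ≅ [N])
pos : ℕ → List ℕ → ℕ
pos v [] = zero
pos v (x ∷ xs) = if v ≡ᵇ x then zero else suc (pos v xs)

orbit : (ℕ → ℕ) → ℕ → ℕ → List ℕ
orbit p x zero = []
orbit p x (suc n) = x ∷ orbit p (p x) n

-- the sequence s(1),…,s(N) of the N-cycle, with s(1) the first vertex
cycleSeq : (ℕ → ℕ) → List ℕ → List ℕ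
cycleSeq p [] = []
cycleSeq p (v ∷ vs) = orbit p v (suc (length vs))

inversions : List ℕ → ℕ
inversions [] = zero
inversions (x ∷ xs) = length (filterᵇ (_<ᵇ x) xs) + inversions xs

parity : ℕ → Sign
parity zero = plus
parity (suc zero) = minus
parity (suc (suc n)) = parity n

sgnList : List ℕ → Sign
sgnList xs = parity (inversions xs)

sgn : (H : Graph3) → Subset (#E H) → Orientation H → Sign
sgn H T ω = sgnList (map (λ v → pos v (V H)) (cycleSeq (prodPerm H T ω) (V H)))

Is3Pfaffian : Graph3 → Set
Is3Pfaffian H =
  Σ (Orientation H) λ ω → ∀ T T' →
    IsSpanningTree H T → IsSpanningTree H T' → sgn H T ω ≡ sgn H T' ω

delete : (H : Graph3) → Fin (#E H) → Graph3
delete H e = graph3 (V H) (removeAt (E H) e)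

_∈ᵇ_ : ℕ → Triple → Bool
v ∈ᵇ (x , y , z) = (v ≡ᵇ x) ∨ (v ≡ᵇ y) ∨ (v ≡ᵇ z)

sameTriple : Triple → Triple → Bool
sameTriple t@(x , y , z) t' = (x ∈ᵇ t') ∧ (y ∈ᵇ t') ∧ (z ∈ᵇ t') ∧ subset t'
  where
  subset : Triple → Bool
  subset (x' , y' , z') = (x' ∈ᵇ t) ∧ (y' ∈ᵇ t) ∧ (z' ∈ᵇ t)

b2n : Bool → ℕ
b2n true = 1
b2n false = 0

meetsAtMostOne : ℕ → ℕ → ℕ → Triple → Bool
meetsAtMostOne a b c (x , y , z) =
  (n x + n y + n z) <ᵇ 2
  where
  n : ℕ → ℕ
  n v = b2n ((v ≡ᵇ a) ∨ (v ≡ᵇ b) ∨ (v ≡ᵇ c))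

contract3 : ℕ → ℕ → ℕ → Graph3 → Graph3
contract3 a b c H =
  graph3 (filterᵇ (λ v → not ((v ≡ᵇ b) ∨ (v ≡ᵇ c))) (V H))
         (deduplicateᵇ sameTriple
            (map relabel (filterᵇ (meetsAtMostOne a b c) (E H))))
  where
  rl : ℕ → ℕ
  rl v = if (v ≡ᵇ b) ∨ (v ≡ᵇ c) then a else v
  relabel : Triple → Triple
  relabel (x , y , z) = (rl x , rl y , rl z)

-- contraction of the triple with index e, keeping the vertex selected by
-- r ∈ {0,1,2} (the 3 choices give isomorphic 3-graphs)
contract : (H : Graph3) → Fin (#E H) → Fin 3 → Graph3
contract H e r with tri H e
... | (x , y , z) with r
...   | zero = contract3 x y z H
...   | suc zero = contract3 y x z H
...   | suc (suc zero) = contract3 z x y H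

MinimalNon3Pfaffian : Graph3 → Set
MinimalNon3Pfaffian H =
  ¬ Is3Pfaffian H ×
  (∀ e → Is3Pfaffian (delete H e)) ×
  (∀ e r → Is3Pfaffian (contract H e r))

-- The 3-graph H_k.  Labels: 0 ↦ 0, i ↦ i, i' ↦ k + i  (1 ≤ i ≤ k).
-- Vertex order 0,1,1',2,2',…,k,k'.

prev1 : ℕ → ℕ → ℕ
prev1 k (suc zero) = k
prev1 k i = i ∸ 1

prev2 : ℕ → ℕ → ℕ
prev2 k (suc zero) = k ∸ 1
prev2 k (suc (suc zero)) = k
prev2 k i = i ∸ 2

Hk : ℕ → Graph3
Hk k =
  graph3 (0 ∷ concat (map (λ j → suc j ∷ k + suc j ∷ []) (upTo k)))
         (map (λ j → (0 , suc j , k + suc j)) (upTo k) Data.List.Base.++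
          map (λ j → (prev2 k (suc j) , prev1 k (suc j) , k + suc j)) (upTo k))

{-# OPTIONS --safe #-}
module Submission where

-- Write A i = {0, i, i′} and B i = {i − 2, i − 1, i′}.  Since i′ lies in no other triple and a
-- spanning tree has k triples, it consists of the A i with i ∈ C and the B i with i ∉ C for
-- some C ⊆ ℤ/k.  This is a tree iff C = ℤ/k or C is nonempty without adjacent elements (if x, y
-- are adjacent in C and the next index is not, then A x, B z, A y is a cycle), which gives L k
-- choices.  If a tree is grown from a root by adding triples (u v w) with u old and v, w new,
-- then moving a pair v w past any vertex does not change the sign, so sgn(T, ω) is the sign of
-- the list of these pairs.  With all triples oriented as stored, it is 1 for C = ℤ/k and
-- (−1)^(k−1) for the other C.  For odd k it is constant.  For even k ≥ 4 four trees that
-- together use every triple an even number of times have sign product −1.  Spanning trees of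
-- H ∖ t and H / t are those of H without and with t, with all signs changed by a common factor;
-- they have i ∉ C, or i ∈ C, for some i, and in the latter case flipping A (i + 1) changes only
-- the sign of C = ℤ/k.

open import Defs
open import Data.Bool.Base using (Bool; true; false; if_then_else_; T; not; _∨_; _∧_)
open import Data.Bool.Properties using (T?; T-≡; T-not-≡; ¬-not; not-injective; ∧-zeroʳ; ∧-inverseʳ) renaming (_≟_ to _≟ᵇ_)
open import Data.Empty using (⊥; ⊥-elim)
open import Data.Fin.Base using (Fin; zero; suc; fromℕ; inject₁)
open import Data.Fin.Properties as Fin using (any?)
open import Data.Fin.Relation.Unary.Top using (view; ‵fromℕ; ‵inject₁)
open import Data.Fin.Subset using (Subset) renaming (_∈_ to _∈ₛ_; _∉_ to _∉ₛ_)
open import Data.Fin.Subset.Properties using (⊆-antisym) renaming (_∈?_ to _∈ₛ?_)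
open import Data.List.Base using (List; []; _∷_; _++_; length; lookup; map; concat; filterᵇ; foldr; allFin; removeAt; replicate; upTo; applyUpTo)
open import Data.List.Properties using (++-assoc; ++-identityʳ; map-∘; map-cong; map-upTo; length-map; length-upTo; length-++; length-replicate; ∷-injective; ∷-injectiveˡ; ∷-injectiveʳ)
open import Data.List.Membership.Propositional using (_∈_; _∉_; find)
open import Data.List.Membership.Propositional.Properties
open import Data.List.Membership.Propositional.Properties.WithK using (unique∧set⇒bag)
open import Data.List.Relation.Binary.BagAndSetEquality using (∼bag⇒↭)
open import Data.List.Relation.Binary.Permutation.Propositional as Perm using (_↭_; prep; ↭-sym; ↭-trans; ↭-refl; ↭-reflexive)
open import Data.List.Relation.Binary.Permutation.Propositional.Properties as Perm using (filter-↭; ↭-length; shift; ∈-resp-↭; ++-comm; ++⁺ʳ; ++⁺ˡ; drop-mid)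
open import Data.List.Relation.Unary.All as All using ([]; _∷_; All)
import Data.List.Relation.Unary.All.Properties as All
open import Data.List.Relation.Unary.AllPairs using ([]; _∷_)
import Data.List.Relation.Unary.AllPairs.Properties as AllPairs
open import Data.List.Relation.Unary.Any using (here; there; index)
open import Data.List.Relation.Unary.Any.Properties using (lookup-index)
open import Data.List.Relation.Unary.Unique.Propositional using (Unique)
import Data.List.Relation.Unary.Unique.Propositional.Properties as Unique
open import Data.Nat.Base using (ℕ; zero; suc; _+_; _*_; _∸_; _≤_; _<_; _<ᵇ_; _≡ᵇ_; z≤n; s≤s)
open import Data.Nat.Divisibility using (_∣_; divides; ∣m∣n⇒∣m+n; ∣-refl; _∣0)
open import Data.Nat.Properties as ℕ using (_≟_; <-cmp)
open import Data.Nat.Solver using (module +-*-Solver)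
open import Data.List.Membership.DecPropositional _≟_ using (_∈?_)
open import Data.Product.Base using (Σ; ∃; ∃₂; _×_; _,_; proj₁; proj₂)
open import Data.Product.Properties using (≡-dec)
open import Data.Sign.Base using (Sign; opposite) renaming (+ to plus; - to minus; _*_ to _·_)
open import Data.Sign.Properties using (*-assoc; *-comm; *-cancelˡ-≡; s*s≡+; opposite-involutive)
open import Data.Sum.Base using (_⊎_; inj₁; inj₂; [_,_]′)
open import Data.Unit.Base using (⊤; tt)
open import Data.Vec.Base as Vec using (tabulate)
open import Data.Vec.Properties using ([]=⇒lookup; lookup⇒[]=; lookup∘tabulate)
open import Function.Base using (id; _∘_; _∘₂_)
open import Function.Bundles using (mk⇔; Equivalence)
open import Relation.Binary.Definitions using (DecidableEquality; tri<; tri≈; tri>)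
open import Relation.Binary.PropositionalEquality
open import Relation.Nullary using (¬_; Dec; yes; no; contradiction; does)
open import Relation.Nullary.Decidable using (_×-dec_; _⊎-dec_; dec-true; dec-false)

-- The sign of a non-full `C` depends only on k. Add the `B j` with j ∉ C in cyclic order. If j - 1
-- ∈ C, then `B j` is attached at j - 1 and adds j′, j - 2 in an order that fits the pairs i, i′;
-- otherwise it is attached at j - 2 and adds j - 1, j′ in the wrong order. With c = |C| the first
-- case occurs c times and the second k - 2c times, and closing the cycle of indices costs one more
-- exchange. This gives (-1)^(k - 2c + 1) = (-1)^(k - 1). The four trees come from a partition of
-- ℤ/k into m nonempty sets without adjacent elements. Among the full tree and the m trees of the
-- parts, `A i` occurs twice and `B i` occurs m - 1 times. So m has to be odd, and for even k the
-- sign product is then (-1)^m = -1 for every orientation. For even k ≥ 4 there is such a partition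
-- with m = 3; for k = 2 there is none with m odd. The definition of the sign multiplies the
-- 3-cycles in the order of the stored triples, while trees grow in an order that depends on C. The
-- sign of a grown tree is therefore computed for products taken in any order.

unique-⊆⇒length≤ : {A : Set} {xs ys : List A} → Unique xs → (∀ {x} → x ∈ xs → x ∈ ys) →
  length xs ≤ length ys
unique-⊆⇒length≤ [] _ = z≤n
unique-⊆⇒length≤ {xs = x ∷ xs} (x∉ ∷ uxs) sub with ∈-∃++ (sub (here refl))
... | as , bs , refl =
  subst (suc (length xs) ≤_) (sym (↭-length (shift x as bs))) (s≤s (unique-⊆⇒length≤ uxs sub′))
  where
  sub′ : ∀ {y} → y ∈ xs → y ∈ as ++ bs
  sub′ y∈ with ∈-resp-↭ (shift x as bs) (sub (there y∈))
  ... | here refl = contradiction refl (All.lookup x∉ y∈)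
  ... | there y∈′ = y∈′

All≢ : {A : Set} {x : A} {xs : List A} → x ∉ xs → All (x ≢_) xs
All≢ x∉ = All.tabulate λ { y∈ refl → x∉ y∈ }

unique-set⇒↭ : {A : Set} {xs ys : List A} → Unique xs → Unique ys →
  (∀ {x} → x ∈ xs → x ∈ ys) → (∀ {x} → x ∈ ys → x ∈ xs) → xs ↭ ys
unique-set⇒↭ ux uy f g = ∼bag⇒↭ (unique∧set⇒bag ux uy (mk⇔ f g))

Unique-resp-↭ : {A : Set} {xs ys : List A} → xs ↭ ys → Unique xs → Unique ys
Unique-resp-↭ Perm.refl u = u
Unique-resp-↭ (prep x p) (x∉ ∷ u) =
  All≢ (λ x∈ → All.lookup x∉ (∈-resp-↭ (↭-sym p) x∈) refl) ∷ Unique-resp-↭ p u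
Unique-resp-↭ (Perm.swap x y p) ((x≢y ∷ x∉) ∷ y∉ ∷ u) =
  ((λ e → x≢y (sym e)) ∷ All≢ (λ y∈ → All.lookup y∉ (∈-resp-↭ (↭-sym p) y∈) refl)) ∷
  All≢ (λ x∈ → All.lookup x∉ (∈-resp-↭ (↭-sym p) x∈) refl) ∷ Unique-resp-↭ p u
Unique-resp-↭ (Perm.trans p q) u = Unique-resp-↭ q (Unique-resp-↭ p u)

-- Signs of sequences

parity-suc : ∀ n → parity (suc n) ≡ opposite (parity n)
parity-suc zero = refl
parity-suc (suc zero) = refl
parity-suc (suc (suc n)) = parity-suc n

parity-+ : ∀ m n → parity (m + n) ≡ parity m · parity n
parity-+ zero n = refl
parity-+ (suc zero) n = parity-suc n
parity-+ (suc (suc m)) n = parity-+ m n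

opposite-·ˡ : ∀ s t → opposite (s · t) ≡ opposite s · t
opposite-·ˡ plus t = refl
opposite-·ˡ minus t = opposite-involutive t

∧≡false⇒ʳ : ∀ {a b} → a ∧ b ≡ false → a ≡ true → b ≡ false
∧≡false⇒ʳ h refl = h

∧≡false⇒ˡ : ∀ {a b} → a ∧ b ≡ false → b ≡ true → a ≡ false
∧≡false⇒ˡ {false} _ _ = refl
∧≡false⇒ˡ {true} refl ()

·-left-comm : ∀ s t u → s · (t · u) ≡ t · (s · u)
·-left-comm plus t u = refl
·-left-comm minus plus u = refl
·-left-comm minus minus u = refl

below : ℕ → List ℕ → ℕ
below x l = length (filterᵇ (_<ᵇ x) l)

below-↭ : ∀ x {l l′} → l ↭ l′ → below x l ≡ below x l′
below-↭ x p = ↭-length (filter-↭ (T? ∘ (_<ᵇ x)) p)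

sgnList-∷ : ∀ x l → sgnList (x ∷ l) ≡ parity (below x l) · sgnList l
sgnList-∷ x l = parity-+ (below x l) (inversions l)

<⇒<ᵇ≡true : ∀ {m n} → m < n → (m <ᵇ n) ≡ true
<⇒<ᵇ≡true p = Equivalence.to T-≡ (ℕ.<⇒<ᵇ p)

≮⇒<ᵇ≡false : ∀ {m n} → ¬ m < n → (m <ᵇ n) ≡ false
≮⇒<ᵇ≡false {m} {n} p with m <ᵇ n in eq
... | false = refl
... | true = contradiction (ℕ.<ᵇ⇒< m n (Equivalence.from T-≡ eq)) p

below-∷-< : ∀ {x y} l → y < x → below x (y ∷ l) ≡ suc (below x l)
below-∷-< l y<x rewrite <⇒<ᵇ≡true y<x = refl

below-∷-≮ : ∀ {x y} l → ¬ y < x → below x (y ∷ l) ≡ below x l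
below-∷-≮ l y≮x rewrite ≮⇒<ᵇ≡false y≮x = refl

-- Inversions with later entries are the same on both sides; only the pair `x`, `y` itself is
-- counted once more on the right.
sgnList-swap-< : ∀ {x y} l → x < y → sgnList (x ∷ y ∷ l) ≡ opposite (sgnList (y ∷ x ∷ l))
sgnList-swap-< {x} {y} l x<y = begin
  sgnList (x ∷ y ∷ l)
    ≡⟨ sgnList-∷ x (y ∷ l) ⟩
  parity (below x (y ∷ l)) · sgnList (y ∷ l)
    ≡⟨ cong₂ (λ n s → parity n · s) (below-∷-≮ l (ℕ.<-asym x<y)) (sgnList-∷ y l) ⟩
  parity (below x l) · (parity (below y l) · sgnList l)
    ≡⟨ ·-left-comm (parity (below x l)) (parity (below y l)) (sgnList l) ⟩
  parity (below y l) · (parity (below x l) · sgnList l)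
    ≡⟨ opposite-involutive _ ⟨
  opposite (opposite (parity (below y l) · (parity (below x l) · sgnList l)))
    ≡⟨ cong opposite (opposite-·ˡ (parity (below y l)) _) ⟩
  opposite (opposite (parity (below y l)) · (parity (below x l) · sgnList l))
    ≡⟨ cong opposite (cong₂ _·_ (trans (cong parity (below-∷-< l x<y)) (parity-suc (below y l))) (sgnList-∷ x l)) ⟨
  opposite (parity (below y (x ∷ l)) · sgnList (x ∷ l))
    ≡⟨ cong opposite (sgnList-∷ y (x ∷ l)) ⟨
  opposite (sgnList (y ∷ x ∷ l)) ∎
  where open ≡-Reasoning

sgnList-swap : ∀ {x y} l → x ≢ y → sgnList (x ∷ y ∷ l) ≡ opposite (sgnList (y ∷ x ∷ l))
sgnList-swap {x} {y} l x≢y with <-cmp x y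
... | tri< x<y _ _ = sgnList-swap-< l x<y
... | tri≈ _ x≡y _ = contradiction x≡y x≢y
... | tri> _ _ y<x = sym (trans (cong opposite (sgnList-swap-< l y<x)) (opposite-involutive _))

module Signs (f : ℕ → ℕ) where

  sg : List ℕ → Sign
  sg l = sgnList (map f l)

  weight : ℕ → List ℕ → Sign
  weight x l = parity (below (f x) (map f l))

  sg-∷ : ∀ x l → sg (x ∷ l) ≡ weight x l · sg l
  sg-∷ x l = sgnList-∷ (f x) (map f l)

  weight-↭ : ∀ x {l l′} → l ↭ l′ → weight x l ≡ weight x l′
  weight-↭ x p = cong parity (below-↭ (f x) (Perm.map⁺ f p))

  -- An entry of `ps` contributes the number of smaller entries after it, which depends on the later
  -- entries only up to order.
  sg-suffix : ∀ ps {l l′} s → l ↭ l′ → sg l ≡ s · sg l′ → sg (ps ++ l) ≡ s · sg (ps ++ l′)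
  sg-suffix [] s p eq = eq
  sg-suffix (x ∷ ps) {l} {l′} s p eq = begin
    sg (x ∷ ps ++ l)                         ≡⟨ sg-∷ x (ps ++ l) ⟩
    weight x (ps ++ l) · sg (ps ++ l)        ≡⟨ cong₂ _·_ (weight-↭ x (pre ps)) (sg-suffix ps s p eq) ⟩
    weight x (ps ++ l′) · (s · sg (ps ++ l′)) ≡⟨ ·-left-comm (weight x (ps ++ l′)) s _ ⟩
    s · (weight x (ps ++ l′) · sg (ps ++ l′)) ≡⟨ cong (s ·_) (sg-∷ x (ps ++ l′)) ⟨
    s · sg (x ∷ ps ++ l′)                    ∎
    where
    open ≡-Reasoning
    pre : ∀ ps → ps ++ l ↭ ps ++ l′
    pre [] = p
    pre (y ∷ ps) = prep y (pre ps)

  sg-prefix : ∀ ps {l l′} → l ↭ l′ → sg l ≡ sg l′ → sg (ps ++ l) ≡ sg (ps ++ l′)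
  sg-prefix ps p eq = sg-suffix ps plus p eq

  sg-swap : ∀ {x y} l → f x ≢ f y → sg (x ∷ y ∷ l) ≡ opposite (sg (y ∷ x ∷ l))
  sg-swap l ne = sgnList-swap (map f l) ne

  sg-shift : ∀ x l m → (∀ {y} → y ∈ l → f x ≢ f y) →
    sg (x ∷ l ++ m) ≡ parity (length l) · sg (l ++ x ∷ m)
  sg-shift x [] m ne = refl
  sg-shift x (y ∷ l) m ne = begin
    sg (x ∷ y ∷ l ++ m)
      ≡⟨ sg-swap (l ++ m) (ne (here refl)) ⟩
    opposite (sg (y ∷ x ∷ l ++ m))
      ≡⟨ cong opposite (sg-suffix (y ∷ []) (parity (length l)) (↭-sym (shift x l m)) (sg-shift x l m (ne ∘ there))) ⟩
    opposite (parity (length l) · sg (y ∷ l ++ x ∷ m))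
      ≡⟨ opposite-·ˡ (parity (length l)) _ ⟩
    opposite (parity (length l)) · sg (y ∷ l ++ x ∷ m)
      ≡⟨ cong (_· sg (y ∷ l ++ x ∷ m)) (parity-suc (length l)) ⟨
    parity (suc (length l)) · sg (y ∷ l ++ x ∷ m) ∎
    where open ≡-Reasoning

  sg-pair-shift : ∀ x y l m → (∀ {z} → z ∈ l → f x ≢ f z) → (∀ {z} → z ∈ l → f y ≢ f z) →
    sg (x ∷ y ∷ l ++ m) ≡ sg (l ++ x ∷ y ∷ m)
  sg-pair-shift x y l m nx ny = begin
    sg (x ∷ y ∷ l ++ m)
      ≡⟨ sg-suffix (x ∷ []) (parity (length l)) (↭-sym (shift y l m)) (sg-shift y l m ny) ⟩
    parity (length l) · sg (x ∷ l ++ y ∷ m)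
      ≡⟨ cong (parity (length l) ·_) (sg-shift x l (y ∷ m) nx) ⟩
    parity (length l) · (parity (length l) · sg (l ++ x ∷ y ∷ m))
      ≡⟨ *-assoc (parity (length l)) _ _ ⟨
    (parity (length l) · parity (length l)) · sg (l ++ x ∷ y ∷ m)
      ≡⟨ cong (_· sg (l ++ x ∷ y ∷ m)) (s*s≡+ (parity (length l))) ⟩
    sg (l ++ x ∷ y ∷ m) ∎
    where open ≡-Reasoning

-- Only the relative order of positions matters. This compares the vertex list of a contraction with
-- the longer original one.
sg-cong : ∀ f g l → (∀ {x y} → x ∈ l → y ∈ l → (f x <ᵇ f y) ≡ (g x <ᵇ g y)) →
  Signs.sg f l ≡ Signs.sg g l
sg-cong f g l h = cong parity (go l h)
  where
  belows : ∀ x l → (∀ {y} → y ∈ l → (f y <ᵇ f x) ≡ (g y <ᵇ g x)) →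
    below (f x) (map f l) ≡ below (g x) (map g l)
  belows x [] h = refl
  belows x (y ∷ l) h rewrite h (here refl) with g y <ᵇ g x
  ... | true = cong suc (belows x l (h ∘ there))
  ... | false = belows x l (h ∘ there)
  go : ∀ l → (∀ {x y} → x ∈ l → y ∈ l → (f x <ᵇ f y) ≡ (g x <ᵇ g y)) →
    inversions (map f l) ≡ inversions (map g l)
  go [] h = refl
  go (x ∷ l) h = cong₂ _+_ (belows x l λ y∈ → h (there y∈) (here refl)) (go l λ p q → h (there p) (there q))

-- The cyclic sequence x ∷ l is encoded as a chain from x to x.
data Chain {A : Set} (R : A → A → Set) : A → List A → A → Set where
  [_] : ∀ {x y} → R x y → Chain R x [] y
  _∷_ : ∀ {x z y l} → R x z → Chain R z l y → Chain R x (z ∷ l) y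

module _ {A : Set} {R : A → A → Set} where

  rotate-step : ∀ {x y l z} → Chain R x l y → R y z → Chain R x (l ++ y ∷ []) z
  rotate-step [ r ] r′ = r ∷ [ r′ ]
  rotate-step (r ∷ c) r′ = r ∷ rotate-step c r′

-- `P` is what has to survive a change of the starting point: the vertex set and the sign for the
-- cycle of a product, nothing for the cycle of indices.
module Rotation {A : Set} {R : A → A → Set} (P : A → List A → Set)
  (P-rotate : ∀ x y l → P x (y ∷ l) → P y (l ++ x ∷ [])) where

  rotate : ∀ {x} l₁ y l₂ → Chain R x (l₁ ++ y ∷ l₂) x → P x (l₁ ++ y ∷ l₂) →
    Σ (List A) λ l → Chain R y l y × P y l × x ∷ l₁ ++ y ∷ l₂ ↭ y ∷ l
  rotate {x} [] y l₂ (r ∷ c) p = l₂ ++ x ∷ [] , rotate-step c r , P-rotate x y l₂ p , ↭-sym (++-comm (y ∷ l₂) (x ∷ []))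
  rotate {x} (z ∷ l₁) y l₂ (r ∷ c) p =
    let (l , c′ , p′ , q) = rotate l₁ y (l₂ ++ x ∷ []) (subst (λ l → Chain R z l z) eq (rotate-step c r)) (subst (P z) eq (P-rotate x z _ p))
    in l , c′ , p′ , ↭-trans (↭-sym (++-comm (z ∷ l₁ ++ y ∷ l₂) (x ∷ []))) (subst (λ m → z ∷ m ↭ y ∷ l) (sym eq) q)
    where
    eq : (l₁ ++ y ∷ l₂) ++ x ∷ [] ≡ l₁ ++ y ∷ (l₂ ++ x ∷ [])
    eq = ++-assoc l₁ (y ∷ l₂) (x ∷ [])

  rotate-to : ∀ {x y l} → y ∈ x ∷ l → Chain R x l x → P x l →
    Σ (List A) λ l′ → Chain R y l′ y × P y l′ × x ∷ l ↭ y ∷ l′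
  rotate-to {l = l} (here refl) c p = l , c , p , ↭-refl
  rotate-to (there y∈) c p with ∈-∃++ y∈
  ... | l₁ , l₂ , refl = rotate l₁ _ l₂ c p

-- Growing trees and their signs

≡ᵇ-refl : ∀ n → (n ≡ᵇ n) ≡ true
≡ᵇ-refl n = Equivalence.to T-≡ (ℕ.≡⇒≡ᵇ n n refl)

≢⇒≡ᵇ≡false : ∀ {m n} → m ≢ n → (m ≡ᵇ n) ≡ false
≢⇒≡ᵇ≡false {m} {n} m≢n with m ≡ᵇ n in eq
... | false = refl
... | true = contradiction (ℕ.≡ᵇ⇒≡ m n (Equivalence.from T-≡ eq)) m≢n

cyc3-fst : ∀ x y z → cyc3 x y z x ≡ y
cyc3-fst x y z rewrite ≡ᵇ-refl x = refl

cyc3-snd : ∀ {x y} z → x ≢ y → cyc3 x y z y ≡ z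
cyc3-snd {x} {y} z x≢y rewrite ≢⇒≡ᵇ≡false (x≢y ∘ sym) | ≡ᵇ-refl y = refl

cyc3-trd : ∀ {x y z} → x ≢ z → y ≢ z → cyc3 x y z z ≡ x
cyc3-trd {x} {y} {z} x≢z y≢z
  rewrite ≢⇒≡ᵇ≡false (x≢z ∘ sym) | ≢⇒≡ᵇ≡false (y≢z ∘ sym) | ≡ᵇ-refl z = refl

cyc3-fix : ∀ {x y z v} → v ≢ x → v ≢ y → v ≢ z → cyc3 x y z v ≡ v
cyc3-fix v≢x v≢y v≢z
  rewrite ≢⇒≡ᵇ≡false v≢x | ≢⇒≡ᵇ≡false v≢y | ≢⇒≡ᵇ≡false v≢z = refl

-- The 3-cycle assigned to the triple t by the choice b is (u v w).
data Cyc : Triple → Bool → ℕ → ℕ → ℕ → Set where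
  +₀ : ∀ {x y z} → Cyc (x , y , z) true x y z
  +₁ : ∀ {x y z} → Cyc (x , y , z) true y z x
  +₂ : ∀ {x y z} → Cyc (x , y , z) true z x y
  -₀ : ∀ {x y z} → Cyc (x , y , z) false y x z
  -₁ : ∀ {x y z} → Cyc (x , y , z) false x z y
  -₂ : ∀ {x y z} → Cyc (x , y , z) false z y x

Distinct : Triple → Set
Distinct (x , y , z) = x ≢ y × x ≢ z × y ≢ z

module _ {t : Triple} {b : Bool} where

  Cyc-rotate : ∀ {u v w} → Cyc t b u v w → Cyc t b v w u
  Cyc-rotate +₀ = +₁
  Cyc-rotate +₁ = +₂
  Cyc-rotate +₂ = +₀
  Cyc-rotate -₀ = -₁
  Cyc-rotate -₁ = -₂
  Cyc-rotate -₂ = -₀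

  Cyc-flip : ∀ {u v w} → Cyc t b u v w → Cyc t (not b) u w v
  Cyc-flip +₀ = -₁
  Cyc-flip +₁ = -₀
  Cyc-flip +₂ = -₂
  Cyc-flip -₀ = +₁
  Cyc-flip -₁ = +₀
  Cyc-flip -₂ = +₂

  Cyc-fst : ∀ {u v w} → Cyc t b u v w → u ∈ₜ t
  Cyc-fst +₀ = inj₁ refl
  Cyc-fst +₁ = inj₂ (inj₁ refl)
  Cyc-fst +₂ = inj₂ (inj₂ refl)
  Cyc-fst -₀ = inj₂ (inj₁ refl)
  Cyc-fst -₁ = inj₁ refl
  Cyc-fst -₂ = inj₂ (inj₂ refl)

  Cyc-snd : ∀ {u v w} → Cyc t b u v w → v ∈ₜ t
  Cyc-snd = Cyc-fst ∘ Cyc-rotate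

  Cyc-trd : ∀ {u v w} → Cyc t b u v w → w ∈ₜ t
  Cyc-trd = Cyc-snd ∘ Cyc-rotate

  Cyc-distinct⁻ : ∀ {u v w} → Cyc t b u v w → Distinct t → Distinct (u , v , w)
  Cyc-distinct⁻ +₀ (p , q , r) = p , q , r
  Cyc-distinct⁻ +₁ (p , q , r) = r , p ∘ sym , q ∘ sym
  Cyc-distinct⁻ +₂ (p , q , r) = q ∘ sym , r ∘ sym , p
  Cyc-distinct⁻ -₀ (p , q , r) = p ∘ sym , r , q
  Cyc-distinct⁻ -₁ (p , q , r) = q , p , r ∘ sym
  Cyc-distinct⁻ -₂ (p , q , r) = r ∘ sym , q ∘ sym , p ∘ sym

  Cyc-distinct : ∀ {u v w} → Cyc t b u v w → Distinct (u , v , w) → Distinct t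
  Cyc-distinct +₀ (p , q , r) = p , q , r
  Cyc-distinct +₁ (p , q , r) = q ∘ sym , r ∘ sym , p
  Cyc-distinct +₂ (p , q , r) = r , p ∘ sym , q ∘ sym
  Cyc-distinct -₀ (p , q , r) = p ∘ sym , r , q
  Cyc-distinct -₁ (p , q , r) = q , p , r ∘ sym
  Cyc-distinct -₂ (p , q , r) = r ∘ sym , q ∘ sym , p ∘ sym

  Cyc-σ : ∀ {u v w} → Cyc t b u v w → Distinct t → σ t b u ≡ v
  Cyc-σ (+₀ {x} {y} {z}) d = cyc3-fst x y z
  Cyc-σ (+₁ {z = z}) (p , q , r) = cyc3-snd z p
  Cyc-σ +₂ (p , q , r) = cyc3-trd q r
  Cyc-σ (-₀ {x} {y} {z}) d = cyc3-fst y x z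
  Cyc-σ (-₁ {z = z}) (p , q , r) = cyc3-snd z (p ∘ sym)
  Cyc-σ -₂ (p , q , r) = cyc3-trd r q

  Cyc-∈ : ∀ {u v w x} → Cyc t b u v w → x ∈ₜ t → x ≡ u ⊎ x ≡ v ⊎ x ≡ w
  Cyc-∈ +₀ x∈ = x∈
  Cyc-∈ +₁ (inj₁ e) = inj₂ (inj₂ e)
  Cyc-∈ +₁ (inj₂ (inj₁ e)) = inj₁ e
  Cyc-∈ +₁ (inj₂ (inj₂ e)) = inj₂ (inj₁ e)
  Cyc-∈ +₂ (inj₁ e) = inj₂ (inj₁ e)
  Cyc-∈ +₂ (inj₂ (inj₁ e)) = inj₂ (inj₂ e)
  Cyc-∈ +₂ (inj₂ (inj₂ e)) = inj₁ e
  Cyc-∈ -₀ (inj₁ e) = inj₂ (inj₁ e)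
  Cyc-∈ -₀ (inj₂ (inj₁ e)) = inj₁ e
  Cyc-∈ -₀ (inj₂ (inj₂ e)) = inj₂ (inj₂ e)
  Cyc-∈ -₁ (inj₁ e) = inj₁ e
  Cyc-∈ -₁ (inj₂ (inj₁ e)) = inj₂ (inj₂ e)
  Cyc-∈ -₁ (inj₂ (inj₂ e)) = inj₂ (inj₁ e)
  Cyc-∈ -₂ (inj₁ e) = inj₂ (inj₂ e)
  Cyc-∈ -₂ (inj₂ (inj₁ e)) = inj₂ (inj₁ e)
  Cyc-∈ -₂ (inj₂ (inj₂ e)) = inj₁ e

σ-fix : ∀ t b {x} → ¬ x ∈ₜ t → σ t b x ≡ x
σ-fix t true x∉ = cyc3-fix (x∉ ∘ inj₁) (x∉ ∘ inj₂ ∘ inj₁) (x∉ ∘ inj₂ ∘ inj₂)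
σ-fix t false x∉ = cyc3-fix (x∉ ∘ inj₂ ∘ inj₁) (x∉ ∘ inj₁) (x∉ ∘ inj₂ ∘ inj₂)

Cyc-at : ∀ {t} b {u} → u ∈ₜ t → ∃₂ (Cyc t b u)
Cyc-at true (inj₁ refl) = _ , _ , +₀
Cyc-at true (inj₂ (inj₁ refl)) = _ , _ , +₁
Cyc-at true (inj₂ (inj₂ refl)) = _ , _ , +₂
Cyc-at false (inj₁ refl) = _ , _ , -₁
Cyc-at false (inj₂ (inj₁ refl)) = _ , _ , -₀
Cyc-at false (inj₂ (inj₂ refl)) = _ , _ , -₂

_∈ₜ?_ : ∀ x t → Dec (x ∈ₜ t)
x ∈ₜ? (a , b , c) = (x ≟ a) ⊎-dec (x ≟ b) ⊎-dec (x ≟ c)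

module _ (t : Triple) (b : Bool) (d : Distinct t) where

  σ-∈ : ∀ {x l} → x ∈ l → (∀ {y} → y ∈ₜ t → y ∈ l) → σ t b x ∈ l
  σ-∈ {x} {l} x∈ sub with x ∈ₜ? t
  ... | no x∉ = subst (_∈ l) (sym (σ-fix t b x∉)) x∈
  ... | yes x∈t = let _ , _ , c = Cyc-at b x∈t in subst (_∈ l) (sym (Cyc-σ c d)) (sub (Cyc-snd c))

  -- Order three supplies the inverse from which injectivity follows.
  σ-cube : ∀ x → σ t b (σ t b (σ t b x)) ≡ x
  σ-cube x with x ∈ₜ? t
  ... | no x∉ rewrite σ-fix t b x∉ | σ-fix t b x∉ = σ-fix t b x∉
  ... | yes x∈t with Cyc-at b x∈t
  ... | _ , _ , c rewrite Cyc-σ c d | Cyc-σ (Cyc-rotate c) d = Cyc-σ (Cyc-rotate (Cyc-rotate c)) d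

  σ-injective : ∀ {x y} → σ t b x ≡ σ t b y → x ≡ y
  σ-injective {x} {y} eq = trans (sym (σ-cube x)) (trans (cong (σ t b ∘ σ t b) eq) (σ-cube y))

pos-injective : ∀ V {x y} → x ∈ V → y ∈ V → pos x V ≡ pos y V → x ≡ y
pos-injective (v ∷ V) {x} {y} x∈ y∈ eq with x ≟ v | y ≟ v
... | yes refl | yes refl = refl
... | yes refl | no y≢v rewrite ≡ᵇ-refl x | ≢⇒≡ᵇ≡false y≢v = contradiction eq λ ()
... | no x≢v | yes refl rewrite ≡ᵇ-refl y | ≢⇒≡ᵇ≡false x≢v = contradiction eq λ ()
... | no x≢v | no y≢v rewrite ≢⇒≡ᵇ≡false y≢v | ≢⇒≡ᵇ≡false x≢v with x∈ | y∈
... | here x≡v | _ = contradiction x≡v x≢v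
... | there _ | here y≡v = contradiction y≡v y≢v
... | there x∈V | there y∈V = pos-injective V x∈V y∈V (ℕ.suc-injective eq)

prod : (H : Graph3) → Orientation H → List (Fin (#E H)) → ℕ → ℕ
prod H ω = foldr (λ e p → σ (tri H e) (ω e) ∘ p) id

module Growth (H : Graph3) (ω : Orientation H) (r : ℕ) where

  -- A set es of triples grown from the root r by adding triples that contain exactly one
  -- vertex reached before; vs lists the vertices, the two new ones in the order given by
  -- the 3-cycle of the triple.
  data Grown : List (Fin (#E H)) → List ℕ → Set where
    root : Grown [] (r ∷ [])
    grow : ∀ {e es vs u v w} → Grown es vs → Cyc (tri H e) (ω e) u v w →
           u ∈ vs → v ∉ vs → w ∉ vs → v ≢ w → Grown (e ∷ es) (v ∷ w ∷ vs)

  root-∈ : ∀ {es vs} → Grown es vs → r ∈ vs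
  root-∈ root = here refl
  root-∈ (grow g _ _ _ _ _) = there (there (root-∈ g))

  grown-unique : ∀ {es vs} → Grown es vs → Unique vs
  grown-unique root = [] ∷ []
  grown-unique (grow g _ _ v∉ w∉ v≢w) = (v≢w ∷ All≢ v∉) ∷ All≢ w∉ ∷ grown-unique g

  grown-length : ∀ {es vs} → Grown es vs → length vs ≡ suc (length es + length es)
  grown-length root = refl
  grown-length {e ∷ es} (grow g _ _ _ _ _) =
    cong (λ n → suc (suc n)) (trans (grown-length g) (sym (ℕ.+-suc (length es) (length es))))

  grown-⊆ : ∀ {es vs e x} → Grown es vs → e ∈ es → x ∈ₜ tri H e → x ∈ vs
  grown-⊆ (grow g c u∈ _ _ _) (here refl) x∈ with Cyc-∈ c x∈
  ... | inj₁ refl = there (there u∈)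
  ... | inj₂ (inj₁ refl) = here refl
  ... | inj₂ (inj₂ refl) = there (here refl)
  grown-⊆ (grow g _ _ _ _ _) (there e∈) x∈ = there (there (grown-⊆ g e∈ x∈))

  step-distinct : ∀ {vs : List ℕ} {u v w e} → Cyc (tri H e) (ω e) u v w →
    u ∈ vs → v ∉ vs → w ∉ vs → v ≢ w → Distinct (tri H e)
  step-distinct c u∈ v∉ w∉ v≢w =
    Cyc-distinct c ((λ { refl → v∉ u∈ }) , (λ { refl → w∉ u∈ }) , v≢w)

  grown-distinct : ∀ {es vs e} → Grown es vs → e ∈ es → Distinct (tri H e)
  grown-distinct (grow _ c u∈ v∉ w∉ v≢w) (here refl) = step-distinct c u∈ v∉ w∉ v≢w
  grown-distinct (grow g _ _ _ _ _) (there e∈) = grown-distinct g e∈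

  grown-unique-edges : ∀ {es vs} → Grown es vs → Unique es
  grown-unique-edges root = []
  grown-unique-edges (grow g c _ v∉ _ _) =
    All≢ (λ e∈ → v∉ (grown-⊆ g e∈ (Cyc-snd c))) ∷ grown-unique-edges g

  private
    π : List (Fin (#E H)) → ℕ → ℕ
    π = prod H ω

  prod-++ : ∀ L₁ L₂ x → π (L₁ ++ L₂) x ≡ π L₁ (π L₂ x)
  prod-++ [] L₂ x = refl
  prod-++ (e ∷ L₁) L₂ x = cong (σ (tri H e) (ω e)) (prod-++ L₁ L₂ x)

  prod-fix : ∀ L {x} → (∀ {e} → e ∈ L → ¬ x ∈ₜ tri H e) → π L x ≡ x
  prod-fix [] h = refl
  prod-fix (e ∷ L) h = trans (cong (σ (tri H e) (ω e)) (prod-fix L (h ∘ there))) (σ-fix (tri H e) (ω e) (h (here refl)))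

  prod-∈ : ∀ L {x} {l : List ℕ} → (∀ {e} → e ∈ L → Distinct (tri H e)) →
    (∀ {e y} → e ∈ L → y ∈ₜ tri H e → y ∈ l) → x ∈ l → π L x ∈ l
  prod-∈ [] d h x∈ = x∈
  prod-∈ (e ∷ L) d h x∈ = σ-∈ (tri H e) (ω e) (d (here refl)) (prod-∈ L (d ∘ there) (h ∘ there) x∈) (h (here refl))

  prod-injective : ∀ L {x y} → (∀ {e} → e ∈ L → Distinct (tri H e)) → π L x ≡ π L y → x ≡ y
  prod-injective [] d eq = eq
  prod-injective (e ∷ L) d eq = prod-injective L (d ∘ there) (σ-injective (tri H e) (ω e) (d (here refl)) eq)

  -- Inserting a leaf triple (u v w) between products α and β turns the cycle of α ∘ β into
  -- the one in which v, w are inserted just before α u.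
  module _ (f : ℕ → ℕ) where
    open Signs f

    grown-cycle : ∀ {es vs} → Grown es vs → (∀ {x y} → x ∈ vs → y ∈ vs → f x ≡ f y → x ≡ y) →
      ∀ {L} → L ↭ es → Σ ℕ λ y → Σ (List ℕ) λ l →
        Chain (λ a b → π L a ≡ b) y l y × (y ∷ l ↭ vs × sg (y ∷ l) ≡ sg vs)
    rotate-cycle : ∀ {es vs} → Grown es vs → (∀ {x y} → x ∈ vs → y ∈ vs → f x ≡ f y → x ≡ y) →
      ∀ {L} → L ↭ es → ∀ {y} → y ∈ vs → Σ (List ℕ) λ l →
        Chain (λ a b → π L a ≡ b) y l y × (y ∷ l ↭ vs × sg (y ∷ l) ≡ sg vs)

    rotate-cycle {es} {vs} g inj {L} p {y} y∈ =
      let (_ , l , c , q , eq) = grown-cycle g inj p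
          (l′ , c′ , qeq , _) = rotate-to (∈-resp-↭ (↭-sym q) y∈) c (q , eq)
      in l′ , c′ , qeq
      where
      rotated : ∀ x y l → x ∷ y ∷ l ↭ vs × sg (x ∷ y ∷ l) ≡ sg vs →
        y ∷ l ++ x ∷ [] ↭ vs × sg (y ∷ l ++ x ∷ []) ≡ sg vs
      -- Rotation moves one entry past all the others. Their number is even, because a grown list
      -- has one root and two vertices for each triple.
      rotated x y l (q , eq) = ↭-trans (++-comm (y ∷ l) (x ∷ [])) q , (begin
        sg (y ∷ l ++ x ∷ [])
          ≡⟨ cong (_· sg (y ∷ l ++ x ∷ [])) even ⟨
        parity (length (y ∷ l)) · sg (y ∷ l ++ x ∷ [])
          ≡⟨ sg-shift x (y ∷ l) [] ne ⟨
        sg (x ∷ (y ∷ l) ++ [])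
          ≡⟨ cong (sg ∘ (x ∷_)) (++-identityʳ (y ∷ l)) ⟩
        sg (x ∷ y ∷ l)
          ≡⟨ eq ⟩
        sg vs ∎)
        where
        open ≡-Reasoning
        double : ∀ n → parity (n + n) ≡ plus
        double zero = refl
        double (suc n) = trans (cong (parity ∘ suc) (ℕ.+-suc n n)) (double n)
        even : parity (length (y ∷ l)) ≡ plus
        even = trans (cong parity (ℕ.suc-injective (trans (↭-length q) (grown-length g)))) (double (length es))
        ne : ∀ {z} → z ∈ y ∷ l → f x ≢ f z
        ne z∈ e with refl ← inj (∈-resp-↭ q (here refl)) (∈-resp-↭ q (there z∈)) e
          with x∉ ∷ _ ← Unique-resp-↭ (↭-sym q) (grown-unique g) = All.lookup x∉ z∈ refl
      open Rotation (λ x l → x ∷ l ↭ vs × sg (x ∷ l) ≡ sg vs) rotated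

    grown-cycle root inj p with refl ← Perm.↭-empty-inv p = r , [] , [ refl ] , ↭-refl , refl
    grown-cycle (grow {e} {es} {vs} {u} {v} {w} g c u∈ v∉ w∉ v≢w) inj p
      with ∈-∃++ (∈-resp-↭ (↭-sym p) (here refl))
    ... | L₁ , L₂ , refl =
      -- The smaller cycle is started at `y`, so that the arc to be cut, the one entering `y`, comes
      -- last and `v`, `w` can be put in front.
      let (l , ch , q , eq) = rotate-cycle g (λ x∈ y∈ → inj (there (there x∈)) (there (there y∈))) p′ y∈
      in v , w ∷ y ∷ l ,
         Pv ∷ Pw ∷ redirect ch (y∉ q) (∈-resp-↭ q) ,
         prep v (prep w q) , sg-prefix (v ∷ w ∷ []) q eq
      where
      p′ : L₁ ++ L₂ ↭ es
      p′ = drop-mid L₁ [] p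
      in₁ : ∀ {e} → e ∈ L₁ → e ∈ es
      in₁ = ∈-resp-↭ p′ ∘ ∈-++⁺ˡ
      in₂ : ∀ {e} → e ∈ L₂ → e ∈ es
      in₂ = ∈-resp-↭ p′ ∘ ∈-++⁺ʳ L₁
      y : ℕ
      y = π L₁ u
      y∈ : y ∈ vs
      y∈ = prod-∈ L₁ (grown-distinct g ∘ in₁) (grown-⊆ g ∘ in₁) u∈
      y∉ : ∀ {l} → y ∷ l ↭ vs → y ∉ l
      y∉ q = Unique.Unique[x∷xs]⇒x∉xs (Unique-resp-↭ (↭-sym q) (grown-unique g))
      d : Distinct (tri H e)
      d = step-distinct c u∈ v∉ w∉ v≢w
      fix₁ : ∀ {x} → x ∉ vs → π L₁ x ≡ x
      fix₁ x∉ = prod-fix L₁ λ e∈ x∈ → x∉ (grown-⊆ g (in₁ e∈) x∈)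
      fix₂ : ∀ {x} → x ∉ vs → π L₂ x ≡ x
      fix₂ x∉ = prod-fix L₂ λ e∈ x∈ → x∉ (grown-⊆ g (in₂ e∈) x∈)
      P Q s : ℕ → ℕ
      P = π (L₁ ++ e ∷ L₂)
      Q = π (L₁ ++ L₂)
      s = σ (tri H e) (ω e)
      P-split : ∀ x → P x ≡ π L₁ (s (π L₂ x))
      P-split = prod-++ L₁ (e ∷ L₂)
      Pv : P v ≡ w
      Pv = trans (P-split v) (trans (cong (π L₁ ∘ s) (fix₂ v∉)) (trans (cong (π L₁) (Cyc-σ (Cyc-rotate c) d)) (fix₁ w∉)))
      Pw : P w ≡ y
      Pw = trans (P-split w) (trans (cong (π L₁ ∘ s) (fix₂ w∉)) (cong (π L₁) (Cyc-σ (Cyc-rotate (Cyc-rotate c)) d)))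
      -- The triple moves `π L₂ z` only if this is `u`, its only vertex reached before, and then
      -- `Q z` is `y`.
      P-same : ∀ {z} → z ∈ vs → Q z ≢ y → P z ≡ Q z
      P-same {z} z∈ Qz≢y = trans (P-split z) (trans (cong (π L₁) (σ-fix (tri H e) (ω e) ∉t)) (sym (prod-++ L₁ L₂ z)))
        where
        β∈ : π L₂ z ∈ vs
        β∈ = prod-∈ L₂ (grown-distinct g ∘ in₂) (grown-⊆ g ∘ in₂) z∈
        ∉t : ¬ π L₂ z ∈ₜ tri H e
        ∉t β∈t with Cyc-∈ c β∈t
        ... | inj₁ βz≡u = Qz≢y (trans (prod-++ L₁ L₂ z) (cong (π L₁) βz≡u))
        ... | inj₂ (inj₁ βz≡v) = v∉ (subst (_∈ vs) βz≡v β∈)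
        ... | inj₂ (inj₂ βz≡w) = w∉ (subst (_∈ vs) βz≡w β∈)
      P-last : ∀ {z} → Q z ≡ y → P z ≡ v
      P-last {z} Qz≡y = trans (P-split z) (trans (cong (π L₁ ∘ s) βz≡u) (trans (cong (π L₁) (Cyc-σ c d)) (fix₁ v∉)))
        where
        βz≡u : π L₂ z ≡ u
        βz≡u = prod-injective L₁ (grown-distinct g ∘ in₁) (trans (sym (prod-++ L₁ L₂ z)) Qz≡y)
      redirect : ∀ {x l} → Chain (λ a b → Q a ≡ b) x l y → y ∉ l → (∀ {z} → z ∈ x ∷ l → z ∈ vs) →
        Chain (λ a b → P a ≡ b) x l v
      redirect [ eq ] _ _ = [ P-last eq ]
      redirect (refl ∷ ch) y∉ sub =
        P-same (sub (here refl)) (λ eq → y∉ (here (sym eq))) ∷ redirect ch (y∉ ∘ there) (sub ∘ there)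

  prodPerm-filter : ∀ T → prodPerm H T ω ≡ π (filterᵇ (Vec.lookup T) (allFin (#E H)))
  prodPerm-filter T = go (allFin (#E H))
    where
    go : ∀ L → foldr (λ e f → if Vec.lookup T e then σ (tri H e) (ω e) ∘ f else f) id L ≡ π (filterᵇ (Vec.lookup T) L)
    go [] = refl
    go (e ∷ L) with Vec.lookup T e
    ... | true = cong (σ (tri H e) (ω e) ∘_) (go L)
    ... | false = go L

  Chain⇒orbit : ∀ {p : ℕ → ℕ} {x l y} → Chain (λ a b → p a ≡ b) x l y → orbit p x (suc (length l)) ≡ x ∷ l
  Chain⇒orbit [ _ ] = refl
  Chain⇒orbit {x = x} (refl ∷ c) = cong (x ∷_) (Chain⇒orbit c)

  -- `cycleSeq` starts at the first vertex of the graph, so the cycle is rotated there. It passes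
  -- through all vertices, hence its length is the number of steps that `orbit` takes.
  sgn-grown : ∀ {es vs T} → Unique (V H) → Grown es vs →
    (∀ {x} → x ∈ vs → x ∈ V H) → (∀ {x} → x ∈ V H → x ∈ vs) →
    (∀ {e} → e ∈ es → e ∈ₛ T) → (∀ {e} → e ∈ₛ T → e ∈ es) →
    sgn H T ω ≡ Signs.sg (λ v → pos v (V H)) vs
  sgn-grown {es} {vs} {T} uV g vs⊆ ⊆vs es⊆ ⊆es = go (V H) refl
    where
    f : ℕ → ℕ
    f v = pos v (V H)
    tree : List (Fin (#E H))
    tree = filterᵇ (Vec.lookup T) (allFin (#E H))
    tree↭ : tree ↭ es
    tree↭ = unique-set⇒↭ (Unique.filter⁺ (T? ∘ Vec.lookup T) (Unique.allFin⁺ (#E H))) (grown-unique-edges g)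
      (λ {e} e∈ → ⊆es (lookup⇒[]= e T (Equivalence.to T-≡ (proj₂ (∈-filter⁻ (T? ∘ Vec.lookup T) {xs = allFin (#E H)} e∈)))))
      (λ {e} e∈ → ∈-filter⁺ (T? ∘ Vec.lookup T) (∈-allFin e) (Equivalence.from T-≡ ([]=⇒lookup (es⊆ e∈))))
    go : ∀ Vs → Vs ≡ V H → sgnList (map f (cycleSeq (prodPerm H T ω) Vs)) ≡ Signs.sg f vs
    go [] eq with () ← subst (r ∈_) (sym eq) (vs⊆ (root-∈ g))
    go (v₀ ∷ Vs) eq =
      let (l , c , q , sgeq) = rotate-cycle f g (λ x∈ y∈ → pos-injective (V H) (vs⊆ x∈) (vs⊆ y∈)) tree↭
                                 (⊆vs (subst (v₀ ∈_) eq (here refl)))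
          len : length Vs ≡ length l
          len = ℕ.suc-injective (trans (cong length eq) (↭-length (↭-trans (unique-set⇒↭ uV (grown-unique g) ⊆vs vs⊆) (↭-sym q))))
          orb : cycleSeq (prodPerm H T ω) (v₀ ∷ Vs) ≡ v₀ ∷ l
          orb = trans (cong₂ (λ p n → orbit p v₀ (suc n)) (prodPerm-filter T) len) (Chain⇒orbit c)
      in trans (cong (sgnList ∘ map f) orb) sgeq

-- Spanning trees are the grown sets of triples

Unique-∷ʳ : {A : Set} {xs : List A} {x : A} → Unique xs → x ∉ xs → Unique (xs ++ x ∷ [])
Unique-∷ʳ u x∉ = Unique.++⁺ u ([] ∷ []) λ { (y∈ , here refl) → x∉ y∈ }

lookup-injective : ∀ {A : Set} {xs : List A} → Unique xs → ∀ i j → lookup xs i ≡ lookup xs j → i ≡ j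
lookup-injective {xs = x ∷ xs} _ zero zero eq = refl
lookup-injective {xs = x ∷ xs} (x∉ ∷ _) zero (suc j) eq = contradiction eq (All.lookup x∉ (∈-lookup j))
lookup-injective {xs = x ∷ xs} (x∉ ∷ _) (suc i) zero eq = contradiction (sym eq) (All.lookup x∉ (∈-lookup i))
lookup-injective {xs = x ∷ xs} (_ ∷ u) (suc i) (suc j) eq = cong suc (lookup-injective u i j eq)

module Cycles (H : Graph3) where

  -- A walk from x to y; the second list omits the final vertex y.
  data Walk : ℕ → List ℕ → List (Fin (#E H)) → ℕ → Set where
    done : ∀ {x} → Walk x [] [] x
    via : ∀ {u w y vs es e} → u ∈ₜ tri H e → w ∈ₜ tri H e → Walk w vs es y → Walk u (u ∷ vs) (e ∷ es) y

  walk-∷ʳ : ∀ {x vs es y z e} → Walk x vs es y → y ∈ₜ tri H e → z ∈ₜ tri H e →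
    Walk x (vs ++ y ∷ []) (es ++ e ∷ []) z
  walk-∷ʳ done y∈ z∈ = via y∈ z∈ done
  walk-∷ʳ (via p q w) y∈ z∈ = via p q (walk-∷ʳ w y∈ z∈)

  walk-joined : ∀ {T x vs es y} → Walk x vs es y → (∀ {e} → e ∈ es → e ∈ₛ T) → Joined H T x y
  walk-joined done h = here
  walk-joined (via p q w) h = step _ (h (here refl)) p q (walk-joined w (h ∘ there))

  vertex : ∀ {x vs es y} → Walk x vs es y → Fin (suc (length es)) → ℕ
  vertex {x} w zero = x
  vertex (via _ _ w) (suc i) = vertex w i

  vertex-last : ∀ {x vs es y} (w : Walk x vs es y) → vertex w (fromℕ (length es)) ≡ y
  vertex-last done = refl
  vertex-last (via _ _ w) = vertex-last w

  vertex-∈ : ∀ {x vs es y} (w : Walk x vs es y) i → vertex w (inject₁ i) ∈ vs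
  vertex-∈ (via _ _ w) zero = here refl
  vertex-∈ (via _ _ w) (suc i) = there (vertex-∈ w i)

  vertex-injective : ∀ {x vs es y} (w : Walk x vs es y) → Unique vs →
    ∀ i j → vertex w (inject₁ i) ≡ vertex w (inject₁ j) → i ≡ j
  vertex-injective (via _ _ w) _ zero zero eq = refl
  vertex-injective (via _ _ w) u zero (suc j) refl =
    contradiction (vertex-∈ w j) (Unique.Unique[x∷xs]⇒x∉xs u)
  vertex-injective (via _ _ w) u (suc i) zero refl =
    contradiction (vertex-∈ w i) (Unique.Unique[x∷xs]⇒x∉xs u)
  vertex-injective (via _ _ w) (_ ∷ u) (suc i) (suc j) eq = cong suc (vertex-injective w u i j eq)

  vertex-incident : ∀ {x vs es y} (w : Walk x vs es y) i →
    vertex w (inject₁ i) ∈ₜ tri H (lookup es i) × vertex w (suc i) ∈ₜ tri H (lookup es i)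
  vertex-incident (via p q done) zero = p , q
  vertex-incident (via p q (via _ _ _)) zero = p , q
  vertex-incident (via _ _ w) (suc i) = vertex-incident w i

  closedWalk⇒cycle : ∀ {T x vs es} → Walk x vs es x → Unique vs → Unique es → 2 ≤ length es →
    (∀ {e} → e ∈ es → e ∈ₛ T) → HasCycle H T
  closedWalk⇒cycle {es = es} w uv ue 2≤ h =
    length es , 2≤ , vertex w , lookup es , vertex-last w , vertex-injective w uv ,
    lookup-injective ue , (λ i → h (∈-lookup i)) , vertex-incident w

  module _ (ω : Orientation H) (r : ℕ) where
    open Growth H ω r

    SimplePath : List (Fin (#E H)) → List ℕ → ℕ → ℕ → Set
    SimplePath es vs x y = Σ (List ℕ) λ ps → Σ (List (Fin (#E H))) λ qs →
      Walk x ps qs y × Unique (ps ++ y ∷ []) × Unique qs ×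
      (∀ {z} → z ∈ ps → z ∈ vs) × (∀ {e} → e ∈ qs → e ∈ es)

    -- The last triple meets the earlier ones only in `u`. A path between a new and an old vertex is
    -- thus a path from or to `u`, extended by this triple; two new vertices are joined by it
    -- directly.
    grown-path : ∀ {es vs x y} → Grown es vs → x ∈ vs → y ∈ vs → SimplePath es vs x y
    grown-path root (here refl) (here refl) = [] , [] , done , ([] ∷ []) , [] , (λ ()) , (λ ())
    grown-path {x = x} {y} (grow {e} {es} {vs} {u} {v} {w} g c u∈ v∉ w∉ v≢w) x∈ y∈
      with old-or-new x∈ | old-or-new y∈
      where
      old-or-new : ∀ {z} → z ∈ v ∷ w ∷ vs → z ∈ vs ⊎ (z ∉ vs × z ∈ₜ tri H e)
      old-or-new (here refl) = inj₂ (v∉ , Cyc-snd c)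
      old-or-new (there (here refl)) = inj₂ (w∉ , Cyc-trd c)
      old-or-new (there (there z∈)) = inj₁ z∈
    ... | inj₁ x∈vs | inj₁ y∈vs =
      let ps , qs , wk , up , uq , p⊆ , q⊆ = grown-path g x∈vs y∈vs
      in ps , qs , wk , up , uq , there ∘ there ∘ p⊆ , there ∘ q⊆
    ... | inj₂ (x∉ , x∈e) | inj₁ y∈vs =
      let ps , qs , wk , up , uq , p⊆ , q⊆ = grown-path g u∈ y∈vs
      in x ∷ ps , e ∷ qs , via x∈e (Cyc-fst c) wk ,
         All≢ (λ m → x∉ (⊆∷ʳ p⊆ y∈vs m)) ∷ up ,
         All≢ (λ e∈ → x∉ (grown-⊆ g (q⊆ e∈) x∈e)) ∷ uq ,
         (λ { (here refl) → x∈ ; (there z∈) → there (there (p⊆ z∈)) }) ,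
         (λ { (here refl) → here refl ; (there e∈) → there (q⊆ e∈) })
      where
      ⊆∷ʳ : ∀ {ps} → (∀ {z} → z ∈ ps → z ∈ vs) → y ∈ vs → ∀ {z} → z ∈ ps ++ y ∷ [] → z ∈ vs
      ⊆∷ʳ {ps} h y∈ z∈ with ∈-++⁻ ps z∈
      ... | inj₁ z∈ps = h z∈ps
      ... | inj₂ (here refl) = y∈
    ... | inj₁ x∈vs | inj₂ (y∉ , y∈e) =
      let ps , qs , wk , up , uq , p⊆ , q⊆ = grown-path g x∈vs u∈
      in ps ++ u ∷ [] , qs ++ e ∷ [] , walk-∷ʳ wk (Cyc-fst c) y∈e ,
         Unique-∷ʳ up (λ m → y∉ (⊆∷ʳ p⊆ m)) ,
         Unique-∷ʳ uq (λ e∈ → y∉ (grown-⊆ g (q⊆ e∈) y∈e)) ,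
         (λ m → there (there (⊆∷ʳ p⊆ m))) ,
         (λ m → edges q⊆ m)
      where
      ⊆∷ʳ : ∀ {ps} → (∀ {z} → z ∈ ps → z ∈ vs) → ∀ {z} → z ∈ ps ++ u ∷ [] → z ∈ vs
      ⊆∷ʳ {ps} h z∈ with ∈-++⁻ ps z∈
      ... | inj₁ z∈ps = h z∈ps
      ... | inj₂ (here refl) = u∈
      edges : ∀ {qs} → (∀ {e′} → e′ ∈ qs → e′ ∈ es) → ∀ {e′} → e′ ∈ qs ++ e ∷ [] → e′ ∈ e ∷ es
      edges {qs} h m with ∈-++⁻ qs m
      ... | inj₁ e∈ = there (h e∈)
      ... | inj₂ (here refl) = here refl
    ... | inj₂ (x∉ , x∈e) | inj₂ (y∉ , y∈e) with x ≟ y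
    ... | yes refl = [] , [] , done , ([] ∷ []) , [] , (λ ()) , (λ ())
    ... | no x≢y = x ∷ [] , e ∷ [] , via x∈e y∈e done , ((x≢y ∷ []) ∷ [] ∷ []) , ([] ∷ []) ,
                   (λ { (here refl) → x∈ }) , (λ { (here refl) → here refl })

    -- The simple path from `x` to `y` inside `es` is closed up by `e`, which it does not use.
    chord⇒cycle : ∀ {T es vs x y e} → Grown es vs → (∀ {e} → e ∈ es → e ∈ₛ T) → e ∈ₛ T → e ∉ es →
      x ≢ y → x ∈ₜ tri H e → y ∈ₜ tri H e → x ∈ vs → y ∈ vs → HasCycle H T
    chord⇒cycle {T} {es} {x = x} {y} {e} g es⊆ e∈T e∉ x≢y x∈e y∈e x∈ y∈
      with grown-path g x∈ y∈
    ... | ps , qs , wk , up , uq , p⊆ , q⊆ =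
      closedWalk⇒cycle (walk-∷ʳ wk y∈e x∈e) up (Unique-∷ʳ uq (e∉ ∘ q⊆)) (long wk) edges
      where
      long : ∀ {ps qs} → Walk x ps qs y → 2 ≤ length (qs ++ e ∷ [])
      long done = contradiction refl x≢y
      long (via _ _ done) = s≤s (s≤s z≤n)
      long (via _ _ (via _ _ _)) = s≤s (s≤s z≤n)
      edges : ∀ {e′} → e′ ∈ qs ++ e ∷ [] → e′ ∈ₛ T
      edges m with ∈-++⁻ qs m
      ... | inj₁ e∈ = es⊆ (q⊆ e∈)
      ... | inj₂ (here refl) = e∈T

    -- As long as a vertex is missing, connectedness yields a triple that leaves the reached set,
    -- and by acyclicity it meets this set only once, as it would be a chord otherwise. When all
    -- vertices are reached, every further triple would be a chord.
    spanningTree⇒grown : ∀ {T} → (∀ e → Distinct (tri H e)) → (∀ {e x} → x ∈ₜ tri H e → x ∈ V H) →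
      r ∈ V H → IsSpanningTree H T → Σ (List (Fin (#E H))) λ es → Σ (List ℕ) λ vs → Grown es vs ×
        (∀ {e} → e ∈ es → e ∈ₛ T) × (∀ {e} → e ∈ₛ T → e ∈ es) ×
        (∀ {x} → x ∈ vs → x ∈ V H) × (∀ {x} → x ∈ V H → x ∈ vs)
    spanningTree⇒grown {T} distinct inV r∈V st =
      go (length (V H)) (ℕ.m≤m+n _ _) root (λ ()) (λ { (here refl) → r∈V })
      where
      open IsSpanningTree st
      open import Data.List.Membership.DecPropositional (Fin._≟_ {#E H}) using () renaming (_∈?_ to _∈ₑ?_)
      exit : ∀ {vs u v} → Joined H T u v → u ∈ vs → v ∉ vs →
        ∃ λ e → e ∈ₛ T × ∃₂ λ x y → x ∈ₜ tri H e × y ∈ₜ tri H e × x ∈ vs × y ∉ vs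
      exit here u∈ v∉ = contradiction u∈ v∉
      exit {vs} {u} (step {w = w} e e∈ u∈e w∈e j) u∈ v∉ with w ∈? vs
      ... | yes w∈ = exit j w∈ v∉
      ... | no w∉ = e , e∈ , u , w , u∈e , w∈e , u∈ , w∉
      go : ∀ n {es vs} → length (V H) ≤ n + length vs → Grown es vs → (∀ {e} → e ∈ es → e ∈ₛ T) →
        (∀ {x} → x ∈ vs → x ∈ V H) → Σ (List (Fin (#E H))) λ es → Σ (List ℕ) λ vs → Grown es vs ×
          (∀ {e} → e ∈ es → e ∈ₛ T) × (∀ {e} → e ∈ₛ T → e ∈ es) ×
          (∀ {x} → x ∈ vs → x ∈ V H) × (∀ {x} → x ∈ V H → x ∈ vs)
      go n {es} {vs} bound g es⊆ vs⊆ with All.all? (_∈? vs) (V H)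
      ... | yes all = es , vs , g , es⊆ , ⊆es , vs⊆ , All.lookup all
        where
        ⊆es : ∀ {e} → e ∈ₛ T → e ∈ es
        ⊆es {e} e∈T with e ∈ₑ? es
        ... | yes e∈ = e∈
        ... | no e∉ = ⊥-elim (acyclic (chord⇒cycle g es⊆ e∈T e∉ (proj₁ (distinct e)) (inj₁ refl) (inj₂ (inj₁ refl))
                        (All.lookup all (inV {e} (inj₁ refl))) (All.lookup all (inV {e} (inj₂ (inj₁ refl))))))
      ... | no ¬all with find (All.¬All⇒Any¬ (_∈? vs) (V H) ¬all)
      ... | z , z∈V , z∉ with exit (connected r z r∈V z∈V) (root-∈ g) z∉
      ... | e , e∈T , x , y , x∈e , y∈e , x∈ , y∉ with Cyc-at (ω e) x∈e
      ... | v , w , c = extend n bound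
        where
        e∉ : e ∉ es
        e∉ e∈ = y∉ (grown-⊆ g e∈ y∈e)
        xvw : Distinct (x , v , w)
        xvw = Cyc-distinct⁻ c (distinct e)
        old⇒⊥ : ∀ {a} → x ≢ a → a ∈ₜ tri H e → a ∉ vs
        old⇒⊥ x≢a a∈e a∈ = acyclic (chord⇒cycle g es⊆ e∈T e∉ x≢a x∈e a∈e x∈ a∈)
        extend : ∀ n → length (V H) ≤ n + length vs → _
        -- The fuel bounds the number of missing vertices. At zero none is missing, but `z` is.
        extend zero b = contradiction (unique-⊆⇒length≤ (All≢ z∉ ∷ grown-unique g) (λ { (here refl) → z∈V ; (there m) → vs⊆ m })) (ℕ.≤⇒≯ b)
        extend (suc n) b = go n (ℕ.≤-trans b (ℕ.≤-trans (ℕ.≤-reflexive (sym (ℕ.+-suc n (length vs)))) (ℕ.+-monoʳ-≤ n (ℕ.n≤1+n _))))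
          (grow g c x∈ (old⇒⊥ (proj₁ xvw) (Cyc-snd c)) (old⇒⊥ (proj₁ (proj₂ xvw)) (Cyc-trd c)) (proj₂ (proj₂ xvw)))
          (λ { (here refl) → e∈T ; (there m) → es⊆ m })
          (λ { (here refl) → inV (Cyc-snd c) ; (there (here refl)) → inV (Cyc-trd c) ; (there (there m)) → vs⊆ m })

    -- If the cycle used the last triple, then the vertices at which it enters and leaves would both
    -- be shared with other triples of the cycle, hence both equal to `u`. So the cycle lies in the
    -- smaller tree. The length is written ℓ + 2, which makes the neighbours of a triple in the
    -- cycle differ from it.
    grown-acyclic : ∀ {es vs} → Grown es vs → ∀ ℓ → (a : Fin (suc (suc (suc ℓ))) → ℕ) →
      (t : Fin (suc (suc ℓ)) → Fin (#E H)) → a (fromℕ (suc (suc ℓ))) ≡ a zero →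
      (∀ i j → a (inject₁ i) ≡ a (inject₁ j) → i ≡ j) → (∀ i j → t i ≡ t j → i ≡ j) →
      (∀ i → t i ∈ es) → (∀ i → a (inject₁ i) ∈ₜ tri H (t i) × a (suc i) ∈ₜ tri H (t i)) → ⊥
    grown-acyclic root ℓ a t closed a-inj t-inj t∈ inc with () ← t∈ zero
    grown-acyclic (grow {e} {es} {vs} {u} {v} {w} g c u∈ v∉ w∉ v≢w) ℓ a t closed a-inj t-inj t∈ inc =
      grown-acyclic g ℓ a t closed a-inj t-inj t∈es inc
      where
      next : ∀ i → ∃ λ j → j ≢ i × a (suc i) ≡ a (inject₁ j)
      next i with view i
      ... | ‵fromℕ = zero , (λ ()) , closed
      ... | ‵inject₁ i′ = suc i′ , suc≢inject₁ i′ , refl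
        where
        suc≢inject₁ : ∀ {n} (i : Fin n) → suc i ≢ inject₁ i
        suc≢inject₁ (suc i) eq = suc≢inject₁ i (Fin.suc-injective eq)
      previous : ∀ i → ∃ λ j → j ≢ i × a (inject₁ i) ≡ a (suc j)
      previous zero = fromℕ (suc ℓ) , (λ ()) , sym closed
      previous (suc i) = inject₁ i , inject₁≢suc i , refl
        where
        inject₁≢suc : ∀ {n} (i : Fin n) → inject₁ i ≢ suc i
        inject₁≢suc (suc i) eq = inject₁≢suc i (Fin.suc-injective eq)
      shared : ∀ {i j x} → t i ≡ e → j ≢ i → x ∈ₜ tri H e → x ∈ₜ tri H (t j) → x ≡ u
      shared {i} {j} ti≡e j≢i x∈e x∈tj with t∈ j
      ... | here tj≡e = contradiction (t-inj j i (trans tj≡e (sym ti≡e))) j≢i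
      ... | there tj∈ with Cyc-∈ c x∈e
      ... | inj₁ x≡u = x≡u
      ... | inj₂ (inj₁ refl) = contradiction (grown-⊆ g tj∈ x∈tj) v∉
      ... | inj₂ (inj₂ refl) = contradiction (grown-⊆ g tj∈ x∈tj) w∉
      t≢e : ∀ i → t i ≢ e
      t≢e i ti≡e with next i | previous i
      ... | j , j≢i , eqj | l , l≢i , eql = j≢i (a-inj j i (trans (sym eqj) (trans q (sym p))))
        where
        p : a (inject₁ i) ≡ u
        p = shared ti≡e l≢i (subst (λ e → a (inject₁ i) ∈ₜ tri H e) ti≡e (proj₁ (inc i)))
              (subst (_∈ₜ tri H (t l)) (sym eql) (proj₂ (inc l)))
        q : a (suc i) ≡ u
        q = shared ti≡e j≢i (subst (λ e → a (suc i) ∈ₜ tri H e) ti≡e (proj₂ (inc i)))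
              (subst (_∈ₜ tri H (t j)) (sym eqj) (proj₁ (inc j)))
      t∈es : ∀ i → t i ∈ es
      t∈es i with t∈ i
      ... | here eq = contradiction eq (t≢e i)
      ... | there m = m

    grown-covers : ∀ {es vs x} → Grown es vs → 2 ≤ length vs → x ∈ vs → ∃ λ e → e ∈ es × x ∈ₜ tri H e
    grown-covers root (s≤s ()) _
    grown-covers (grow g c _ _ _ _) _ (here refl) = _ , here refl , Cyc-snd c
    grown-covers (grow g c _ _ _ _) _ (there (here refl)) = _ , here refl , Cyc-trd c
    -- The root itself is covered by the first triple, which has to be attached to it.
    grown-covers (grow root c (here refl) _ _ _) _ (there (there (here refl))) = _ , here refl , Cyc-fst c
    grown-covers (grow g@(grow _ _ _ _ _ _) c _ _ _ _) _ (there (there x∈)) =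
      let e , e∈ , x∈e = grown-covers g (s≤s (s≤s z≤n)) x∈ in e , there e∈ , x∈e

    grown⇒spanningTree : ∀ {T es vs} → Grown es vs → 2 ≤ length vs →
      (∀ {e} → e ∈ es → e ∈ₛ T) → (∀ {e} → e ∈ₛ T → e ∈ es) → (∀ {x} → x ∈ V H → x ∈ vs) →
      IsSpanningTree H T
    grown⇒spanningTree g 2≤ es⊆ ⊆es V⊆ = record
      { acyclic = λ { (suc (suc ℓ) , _ , a , t , closed , a-inj , t-inj , t∈ , inc) →
                        grown-acyclic g ℓ a t closed a-inj t-inj (⊆es ∘ t∈) inc
                    ; (suc zero , s≤s () , _) }
      ; covering = λ v v∈ → let e , e∈ , v∈e = grown-covers g 2≤ (V⊆ v∈) in e , es⊆ e∈ , v∈e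
      ; connected = λ u v u∈ v∈ → let _ , _ , wk , _ , _ , _ , q⊆ = grown-path g (V⊆ u∈) (V⊆ v∈)
                                  in walk-joined wk (es⊆ ∘ q⊆)
      }

-- Minors

module _ {m : ℕ} where
  open import Data.List.Membership.DecPropositional (Fin._≟_ {m}) using () renaming (_∈?_ to _∈ₑ?_)

  subset : List (Fin m) → Subset m
  subset es = tabulate λ e → does (e ∈ₑ? es)

  subset⁺ : ∀ {es e} → e ∈ es → e ∈ₛ subset es
  subset⁺ {es} {e} e∈ = lookup⇒[]= e (subset es) (trans (lookup∘tabulate _ e) (dec-true (e ∈ₑ? es) e∈))

  subset⁻ : ∀ {es e} → e ∈ₛ subset es → e ∈ es
  subset⁻ {es} {e} e∈ with e ∈ₑ? es in eq
  ... | yes m = m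
  ... | no _ with () ← trans (sym ([]=⇒lookup e∈)) (trans (lookup∘tabulate _ e) (cong does eq))

record WellFormed (H : Graph3) : Set where
  field
    vertices-unique : Unique (V H)
    distinct : ∀ e → Distinct (tri H e)
    incident : ∀ {e x} → x ∈ₜ tri H e → x ∈ V H

relabel : (ℕ → ℕ) → Triple → Triple
relabel ρ (x , y , z) = ρ x , ρ y , ρ z

Cyc-relabel⁻ : ∀ ρ {t b u v w} → Cyc (relabel ρ t) b u v w →
  ∃ λ u₀ → ∃₂ λ v₀ w₀ → Cyc t b u₀ v₀ w₀ × ρ u₀ ≡ u × ρ v₀ ≡ v × ρ w₀ ≡ w
Cyc-relabel⁻ ρ +₀ = _ , _ , _ , +₀ , refl , refl , refl
Cyc-relabel⁻ ρ +₁ = _ , _ , _ , +₁ , refl , refl , refl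
Cyc-relabel⁻ ρ +₂ = _ , _ , _ , +₂ , refl , refl , refl
Cyc-relabel⁻ ρ -₀ = _ , _ , _ , -₀ , refl , refl , refl
Cyc-relabel⁻ ρ -₁ = _ , _ , _ , -₁ , refl , refl , refl
Cyc-relabel⁻ ρ -₂ = _ , _ , _ , -₂ , refl , refl , refl

-- H′ arises from H by merging the vertices vs₀ into a (via ρ), where vs₀ is grown from a by
-- the triples es₀; deletion is the case es₀ = [].
record Minor (H H′ : Graph3) (ω : Orientation H) (a : ℕ) (es₀ : List (Fin (#E H))) (vs₀ : List ℕ) : Set where
  field
    wf : WellFormed H
    wf′ : WellFormed H′
    base : Growth.Grown H ω a es₀ vs₀
    ρ : ℕ → ℕ
    merged⁻ : ∀ {x} → ρ x ≡ a → x ∈ vs₀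
    merged⁺ : ∀ {x} → x ∈ vs₀ → ρ x ≡ a
    kept : ∀ {x} → ρ x ≢ a → ρ x ≡ x
    ι : Fin (#E H′) → Fin (#E H)
    ι-tri : ∀ e → tri H′ e ≡ relabel ρ (tri H (ι e))
    a∈V′ : a ∈ V H′
    V′⊆V : ∀ {x} → x ∈ V H′ → x ∈ V H
    V⊆V′ : ∀ {x} → x ∈ V H → x ∈ vs₀ ⊎ x ∈ V H′
    large : 2 ≤ length (V H)
    K : Sign
    -- The added pairs `ps` are the same in both graphs; only the end of the list changes, from `a`
    -- to the vertices merged into it.
    sign : ∀ ps → ps ++ a ∷ [] ↭ V H′ → Unique (ps ++ vs₀) → (∀ {x} → x ∈ ps ++ vs₀ → x ∈ V H) →
      Signs.sg (λ v → pos v (V H)) (ps ++ vs₀) ≡ K · Signs.sg (λ v → pos v (V H′)) (ps ++ a ∷ [])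

  ω′ : Orientation H′
  ω′ = ω ∘ ι

  open Growth using (Grown; root; grow)

  -- Growth from `a` is replayed on top of `base`. New vertices differ from `a`, so `ρ` has not
  -- changed them; an attaching vertex equal to `a` comes from some vertex of `vs₀`.
  lift : ∀ {es vs} → Grown H′ ω′ a es vs →
    ∃ λ ps → vs ≡ ps ++ a ∷ [] × Grown H ω a (map ι es ++ es₀) (ps ++ vs₀)
  lift root = [] , refl , base
  lift (grow {e} {u = u} {v} {w} g c u∈ v∉ w∉ v≢w) with lift g
  ... | ps , refl , g₀
    with Cyc-relabel⁻ ρ (subst (λ t → Cyc t _ u v w) (ι-tri e) c)
  ... | u₀ , v₀ , w₀ , c₀ , refl , refl , refl =
    v ∷ w ∷ ps , refl ,
    grow g₀ (subst₂ (Cyc _ _ u₀) (sym (same v∉)) (sym (same w∉)) c₀) (old u∈) (new v∉) (new w∉) v≢w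
    where
    ≢a : ∀ {x} → x ∉ ps ++ a ∷ [] → x ≢ a
    ≢a x∉ refl = x∉ (∈-++⁺ʳ ps (here refl))
    same : ∀ {x} → ρ x ∉ ps ++ a ∷ [] → ρ x ≡ x
    same x∉ = kept (≢a x∉)
    old : ∀ {x} → ρ x ∈ ps ++ a ∷ [] → x ∈ ps ++ vs₀
    old {x} x∈ with ρ x ≟ a
    ... | yes ρx≡a = ∈-++⁺ʳ ps (merged⁻ ρx≡a)
    ... | no ρx≢a with ∈-++⁻ ps x∈
    ... | inj₁ m = ∈-++⁺ˡ (subst (_∈ ps) (kept ρx≢a) m)
    ... | inj₂ (here ρx≡a) = contradiction ρx≡a ρx≢a
    new : ∀ {x} → ρ x ∉ ps ++ a ∷ [] → ρ x ∉ ps ++ vs₀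
    new {x} x∉ m with ∈-++⁻ ps m
    ... | inj₁ m′ = x∉ (∈-++⁺ˡ m′)
    ... | inj₂ m′ = ≢a x∉ (trans (cong ρ (sym (same x∉))) (merged⁺ m′))

  spanningTree-lift : ∀ {T′} → IsSpanningTree H′ T′ → ∃ λ T → IsSpanningTree H T ×
    (∀ {e} → e ∈ es₀ → e ∈ₛ T) × (∀ {e} → e ∈ₛ T → e ∈ es₀ ⊎ ∃ λ e′ → e ≡ ι e′) ×
    sgn H T ω ≡ K · sgn H′ T′ ω′
  spanningTree-lift {T′} st with Cycles.spanningTree⇒grown H′ ω′ a (WellFormed.distinct wf′) (λ {e} → WellFormed.incident wf′ {e}) a∈V′ st
  ... | es , vs , g , es⊆ , ⊆es , vs⊆ , ⊆vs with lift g
  ... | ps , refl , g₀ =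
    subset (map ι es ++ es₀) ,
    Cycles.grown⇒spanningTree H ω a g₀
      (ℕ.≤-trans large (unique-⊆⇒length≤ (WellFormed.vertices-unique wf) in-vs)) subset⁺ subset⁻ in-vs ,
    subset⁺ ∘ ∈-++⁺ʳ (map ι es) ,
    origin ,
    (begin
      sgn H (subset (map ι es ++ es₀)) ω
        ≡⟨ Growth.sgn-grown H ω a (WellFormed.vertices-unique wf) g₀ in-V in-vs subset⁺ subset⁻ ⟩
      Signs.sg (λ v → pos v (V H)) (ps ++ vs₀)
        ≡⟨ sign ps (unique-set⇒↭ (Growth.grown-unique H′ ω′ a g) (WellFormed.vertices-unique wf′) vs⊆ ⊆vs) (Growth.grown-unique H ω a g₀) in-V ⟩
      K · Signs.sg (λ v → pos v (V H′)) (ps ++ a ∷ [])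
        ≡⟨ cong (K ·_) (Growth.sgn-grown H′ ω′ a (WellFormed.vertices-unique wf′) g vs⊆ ⊆vs es⊆ ⊆es) ⟨
      K · sgn H′ T′ ω′ ∎)
    where
    open ≡-Reasoning
    in-vs : ∀ {x} → x ∈ V H → x ∈ ps ++ vs₀
    in-vs x∈ with V⊆V′ x∈
    ... | inj₁ m = ∈-++⁺ʳ ps m
    ... | inj₂ m with ∈-++⁻ ps (⊆vs m)
    ... | inj₁ m′ = ∈-++⁺ˡ m′
    ... | inj₂ (here refl) = ∈-++⁺ʳ ps (Growth.root-∈ H ω a base)
    vs₀⊆ : ∀ {es vs} → Grown H ω a es vs → ∀ {x} → x ∈ vs → x ∈ V H
    vs₀⊆ root (here refl) = V′⊆V a∈V′
    vs₀⊆ (grow g c _ _ _ _) (here refl) = WellFormed.incident wf (Cyc-snd c)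
    vs₀⊆ (grow g c _ _ _ _) (there (here refl)) = WellFormed.incident wf (Cyc-trd c)
    vs₀⊆ (grow g c _ _ _ _) (there (there m)) = vs₀⊆ g m
    in-V : ∀ {x} → x ∈ ps ++ vs₀ → x ∈ V H
    in-V = vs₀⊆ g₀
    origin : ∀ {e} → e ∈ₛ subset (map ι es ++ es₀) → e ∈ es₀ ⊎ ∃ λ e′ → e ≡ ι e′
    origin e∈ with ∈-++⁻ (map ι es) (subset⁻ e∈)
    ... | inj₁ m = let e′ , _ , eq = ∈-map⁻ ι m in inj₂ (e′ , eq)
    ... | inj₂ m = inj₁ m

  minor-pfaffian : (∀ T₁ T₂ → IsSpanningTree H T₁ → IsSpanningTree H T₂ →
      (∀ {e} → e ∈ es₀ → e ∈ₛ T₁ × e ∈ₛ T₂) →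
      (∀ {e} → e ∈ₛ T₁ ⊎ e ∈ₛ T₂ → e ∈ es₀ ⊎ ∃ λ e′ → e ≡ ι e′) → sgn H T₁ ω ≡ sgn H T₂ ω) →
    Is3Pfaffian H′
  minor-pfaffian const = ω′ , λ T₁′ T₂′ st₁ st₂ →
    let T₁ , t₁ , in₁ , or₁ , eq₁ = spanningTree-lift st₁
        T₂ , t₂ , in₂ , or₂ , eq₂ = spanningTree-lift st₂
    in *-cancelˡ-≡ K _ _ (trans (sym eq₁) (trans
         (const T₁ T₂ t₁ t₂ (λ e∈ → in₁ e∈ , in₂ e∈) (λ { (inj₁ m) → or₁ m ; (inj₂ m) → or₂ m })) eq₂))

-- Deletion of a triple

removeAt-embedding : ∀ {A : Set} (xs : List A) e → Σ (Fin (length (removeAt xs e)) → Fin (length xs)) λ ι →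
  ∀ i → ι i ≢ e × lookup (removeAt xs e) i ≡ lookup xs (ι i)
removeAt-embedding (x ∷ xs) zero = suc , λ i → (λ ()) , refl
removeAt-embedding (x ∷ xs) (suc e) with removeAt-embedding xs e
... | ι , h = ι′ , h′
  where
  ι′ : Fin (suc (length (removeAt xs e))) → Fin (suc (length xs))
  ι′ zero = zero
  ι′ (suc i) = suc (ι i)
  h′ : ∀ i → ι′ i ≢ suc e × lookup (x ∷ removeAt xs e) i ≡ lookup (x ∷ xs) (ι′ i)
  h′ zero = (λ ()) , refl
  h′ (suc i) = (λ eq → proj₁ (h i) (Fin.suc-injective eq)) , proj₂ (h i)

delete-pfaffian : ∀ {H} → WellFormed H → 2 ≤ length (V H) → ∀ e ω →
  (∀ T₁ T₂ → IsSpanningTree H T₁ → IsSpanningTree H T₂ → e ∉ₛ T₁ → e ∉ₛ T₂ → sgn H T₁ ω ≡ sgn H T₂ ω) →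
  Is3Pfaffian (delete H e)
delete-pfaffian {graph3 (r ∷ Vs) Es} wf large e ω const =
  Minor.minor-pfaffian minor λ T₁ T₂ t₁ t₂ _ origin →
    const T₁ T₂ t₁ t₂ (avoid ∘ origin ∘ inj₁) (avoid ∘ origin ∘ inj₂)
  where
  H = graph3 (r ∷ Vs) Es
  open WellFormed wf
  ι = proj₁ (removeAt-embedding Es e)
  avoid : e ∈ [] ⊎ (∃ λ e′ → e ≡ ι e′) → ⊥
  avoid (inj₂ (e′ , eq)) = proj₁ (proj₂ (removeAt-embedding Es e) e′) (sym eq)
  ι-tri : ∀ e′ → tri (delete H e) e′ ≡ tri H (ι e′)
  ι-tri e′ = proj₂ (proj₂ (removeAt-embedding Es e) e′)
  -- Nothing is merged, so any vertex can serve as the root; the first one is taken.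
  minor : Minor H (delete H e) ω r [] (r ∷ [])
  minor = record
    { wf = wf
    ; wf′ = record
      { vertices-unique = vertices-unique
      ; distinct = λ e′ → subst Distinct (sym (ι-tri e′)) (distinct (ι e′))
      ; incident = λ {e′} {x} x∈ → incident {ι e′} (subst (x ∈ₜ_) (ι-tri e′) x∈) }
    ; base = Growth.root
    ; ρ = id
    ; merged⁻ = here
    ; merged⁺ = λ { (here eq) → eq }
    ; kept = λ _ → refl
    ; ι = ι
    ; ι-tri = ι-tri
    ; a∈V′ = here refl
    ; V′⊆V = id
    ; V⊆V′ = inj₂
    ; large = large
    ; K = plus
    ; sign = λ _ _ _ _ → refl }

-- Contraction of a triple

pos-<ᵇ-filter : ∀ (P : ℕ → Bool) V {x y} → P x ≡ true → P y ≡ true →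
  (pos x V <ᵇ pos y V) ≡ (pos x (filterᵇ P V) <ᵇ pos y (filterᵇ P V))
pos-<ᵇ-filter P [] Px Py = refl
pos-<ᵇ-filter P (z ∷ V) {x} {y} Px Py with P z in Pz
... | false rewrite ≢⇒≡ᵇ≡false {x} {z} (λ { refl → contradiction (trans (sym Px) Pz) λ () })
                  | ≢⇒≡ᵇ≡false {y} {z} (λ { refl → contradiction (trans (sym Py) Pz) λ () }) = pos-<ᵇ-filter P V Px Py
... | true with x ≡ᵇ z | y ≡ᵇ z
... | true | true = refl
... | true | false = refl
... | false | true = refl
... | false | false = pos-<ᵇ-filter P V Px Py

≡ᵇ-true⇒≡ : ∀ {m n} → (m ≡ᵇ n) ≡ true → m ≡ n
≡ᵇ-true⇒≡ {m} {n} eq = ℕ.≡ᵇ⇒≡ m n (Equivalence.from T-≡ eq)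

≡⇒≡ᵇ-true : ∀ {m n} → m ≡ n → (m ≡ᵇ n) ≡ true
≡⇒≡ᵇ-true {m} refl = ≡ᵇ-refl m

∨-true⁻ : ∀ {p q} → p ∨ q ≡ true → p ≡ true ⊎ q ≡ true
∨-true⁻ {true} eq = inj₁ refl
∨-true⁻ {false} eq = inj₂ eq

∨-trueˡ : ∀ {p} q → p ≡ true → p ∨ q ≡ true
∨-trueˡ q refl = refl

∨-trueʳ : ∀ p {q} → q ≡ true → p ∨ q ≡ true
∨-trueʳ true refl = refl
∨-trueʳ false refl = refl

-- The contraction names the vertices in a fixed cyclic order, while the order in which the triple
-- adds the other two to `a` is decided by the orientation.
Cyc⇒arcs : ∀ {t b₀ a b c} → Cyc t b₀ a b c → ∀ b₁ →
  ∃₂ λ p q → Cyc t b₁ a p q × ((p ≡ b × q ≡ c) ⊎ (p ≡ c × q ≡ b))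
Cyc⇒arcs {b₀ = true} c true = _ , _ , c , inj₁ (refl , refl)
Cyc⇒arcs {b₀ = true} c false = _ , _ , Cyc-flip c , inj₂ (refl , refl)
Cyc⇒arcs {b₀ = false} c true = _ , _ , Cyc-flip c , inj₂ (refl , refl)
Cyc⇒arcs {b₀ = false} c false = _ , _ , c , inj₁ (refl , refl)

arcs⁺ : ∀ {a b c p q v : ℕ} → (p ≡ b × q ≡ c) ⊎ (p ≡ c × q ≡ b) →
  v ≡ b ⊎ v ≡ c → v ∈ p ∷ q ∷ a ∷ []
arcs⁺ (inj₁ (refl , refl)) (inj₁ refl) = here refl
arcs⁺ (inj₁ (refl , refl)) (inj₂ refl) = there (here refl)
arcs⁺ (inj₂ (refl , refl)) (inj₁ refl) = there (here refl)
arcs⁺ (inj₂ (refl , refl)) (inj₂ refl) = here refl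

arcs⁻ : ∀ {a b c p q v : ℕ} → (p ≡ b × q ≡ c) ⊎ (p ≡ c × q ≡ b) →
  v ∈ p ∷ q ∷ a ∷ [] → (v ≡ b ⊎ v ≡ c) ⊎ v ≡ a
arcs⁻ (inj₁ (refl , refl)) (here refl) = inj₁ (inj₁ refl)
arcs⁻ (inj₁ (refl , refl)) (there (here refl)) = inj₁ (inj₂ refl)
arcs⁻ (inj₂ (refl , refl)) (here refl) = inj₁ (inj₂ refl)
arcs⁻ (inj₂ (refl , refl)) (there (here refl)) = inj₁ (inj₁ refl)
arcs⁻ _ (there (there (here refl))) = inj₂ refl

atMostOne : ∀ {p q r} → T (b2n p + b2n q + b2n r <ᵇ 2) →
  (p ≡ true → q ≡ true → ⊥) × (p ≡ true → r ≡ true → ⊥) × (q ≡ true → r ≡ true → ⊥)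
atMostOne {false} {false} h = (λ ()) , (λ ()) , (λ ())
atMostOne {false} {true} {false} h = (λ ()) , (λ ()) , (λ _ ())
atMostOne {true} {false} {false} h = (λ _ ()) , (λ _ ()) , (λ ())

contract3-pfaffian : ∀ {H} → WellFormed H → 2 ≤ length (V H) → ∀ e ω {b₀ a b c} → Cyc (tri H e) b₀ a b c →
  (∀ T₁ T₂ → IsSpanningTree H T₁ → IsSpanningTree H T₂ → e ∈ₛ T₁ → e ∈ₛ T₂ → sgn H T₁ ω ≡ sgn H T₂ ω) →
  Is3Pfaffian (contract3 a b c H)
contract3-pfaffian {H} wf large e ω {b₀} {a} {b} {c} abc const with Cyc⇒arcs abc (ω e)
... | p , q , apq , pq = Minor.minor-pfaffian minor λ T₁ T₂ t₁ t₂ in-T _ →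
    const T₁ T₂ t₁ t₂ (proj₁ (in-T (here refl))) (proj₂ (in-T (here refl)))
  where
  open WellFormed wf
  H′ = contract3 a b c H
  bc : ℕ → Bool
  bc v = (v ≡ᵇ b) ∨ (v ≡ᵇ c)
  bc⁻ : ∀ {v} → bc v ≡ true → v ≡ b ⊎ v ≡ c
  bc⁻ eq with ∨-true⁻ eq
  ... | inj₁ e = inj₁ (≡ᵇ-true⇒≡ e)
  ... | inj₂ e = inj₂ (≡ᵇ-true⇒≡ e)
  bc⁺ : ∀ {v} → v ≡ b ⊎ v ≡ c → bc v ≡ true
  bc⁺ (inj₁ e) = ∨-trueˡ _ (≡⇒≡ᵇ-true e)
  bc⁺ {v} (inj₂ e) = ∨-trueʳ (v ≡ᵇ b) (≡⇒≡ᵇ-true e)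
  vs₀ : List ℕ
  vs₀ = p ∷ q ∷ a ∷ []
  bc⇒vs₀ : ∀ {v} → v ≡ b ⊎ v ≡ c → v ∈ vs₀
  bc⇒vs₀ = arcs⁺ pq
  vs₀⇒bc : ∀ {v} → v ∈ vs₀ → (v ≡ b ⊎ v ≡ c) ⊎ v ≡ a
  vs₀⇒bc = arcs⁻ pq
  a≢b,c : a ≢ b × a ≢ c
  a≢b,c = let a≢b , a≢c , _ = Cyc-distinct⁻ abc (distinct e) in a≢b , a≢c
  bc-a : bc a ≡ false
  bc-a with bc a in eq
  ... | false = refl
  ... | true with bc⁻ eq
  ... | inj₁ a≡b = contradiction a≡b (proj₁ a≢b,c)
  ... | inj₂ a≡c = contradiction a≡c (proj₂ a≢b,c)
  ρ : ℕ → ℕ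
  ρ v = if bc v then a else v
  merged⁻ : ∀ {x} → ρ x ≡ a → (x ≡ b ⊎ x ≡ c) ⊎ x ≡ a
  merged⁻ {x} eq with bc x in bcx
  ... | true = inj₁ (bc⁻ bcx)
  ... | false = inj₂ eq
  merged⁺ : ∀ {x} → (x ≡ b ⊎ x ≡ c) ⊎ x ≡ a → ρ x ≡ a
  merged⁺ (inj₁ x≡) rewrite bc⁺ x≡ = refl
  merged⁺ {x} (inj₂ refl) with bc x
  ... | true = refl
  ... | false = refl
  kept : ∀ {x} → ρ x ≢ a → ρ x ≡ x
  kept {x} ne with bc x
  ... | true = contradiction refl ne
  ... | false = refl
  keep : ℕ → Bool
  keep v = not (bc v)
  V′⁺ : ∀ {x} → x ∈ V H → bc x ≡ false → x ∈ V H′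
  V′⁺ x∈ eq = ∈-filter⁺ (T? ∘ keep) x∈ (Equivalence.from T-not-≡ eq)
  V′⁻ : ∀ {x} → x ∈ V H′ → x ∈ V H × bc x ≡ false
  V′⁻ x∈ = let x∈V , t = ∈-filter⁻ (T? ∘ keep) {xs = V H} x∈ in x∈V , Equivalence.to T-not-≡ t
  a∈V′ : a ∈ V H′
  a∈V′ = V′⁺ (incident (Cyc-fst abc)) bc-a
  -- A triple of the contraction may come from several triples of `H`. One of them is chosen, and
  -- the orientation of the contraction is read off from it.
  preimage : ∀ e′ → ∃ λ e₀ → tri H′ e′ ≡ relabel ρ (tri H e₀) × T (meetsAtMostOne a b c (tri H e₀))
  preimage e′ =
    let t , t∈ , eq = ∈-map⁻ _ (∈-deduplicate⁻ (T? ∘₂ sameTriple) _ (∈-lookup {xs = E H′} e′))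
        t∈E , m = ∈-filter⁻ (T? ∘ meetsAtMostOne a b c) {xs = E H} t∈
    in index t∈E , trans eq (cong (relabel ρ) (lookup-index t∈E)) , subst (T ∘ meetsAtMostOne a b c) (lookup-index t∈E) m
  ι : Fin (#E H′) → Fin (#E H)
  ι e′ = proj₁ (preimage e′)
  -- At most one vertex of such a triple is sent to `a`, so relabelling keeps its vertices apart.
  ρ-distinct : ∀ t → Distinct t → T (meetsAtMostOne a b c t) → Distinct (relabel ρ t)
  ρ-distinct (x , y , z) (x≢y , x≢z , y≢z) m =
    let xy , xz , yz = atMostOne {abc? x} {abc? y} {abc? z} m
    in separate x≢y xy , separate x≢z xz , separate y≢z yz
    where
    abc? : ℕ → Bool
    abc? v = (v ≡ᵇ a) ∨ (v ≡ᵇ b) ∨ (v ≡ᵇ c)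
    abc⁺ : ∀ {v} → (v ≡ b ⊎ v ≡ c) ⊎ v ≡ a → abc? v ≡ true
    abc⁺ {v} (inj₁ v≡) = ∨-trueʳ (v ≡ᵇ a) (bc⁺ v≡)
    abc⁺ (inj₂ v≡a) = ∨-trueˡ _ (≡⇒≡ᵇ-true v≡a)
    separate : ∀ {u v} → u ≢ v → (abc? u ≡ true → abc? v ≡ true → ⊥) → ρ u ≢ ρ v
    separate {u} {v} u≢v m eq with ρ u ≟ a
    ... | yes ρu≡a = m (abc⁺ {u} (merged⁻ ρu≡a)) (abc⁺ {v} (merged⁻ (trans (sym eq) ρu≡a)))
    ... | no ρu≢a = u≢v (trans (sym (kept ρu≢a)) (trans eq (kept (λ ρv≡a → ρu≢a (trans eq ρv≡a)))))
  ρ-∈ : ∀ {x t} → x ∈ₜ relabel ρ t → ∃ λ y → y ∈ₜ t × x ≡ ρ y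
  ρ-∈ (inj₁ eq) = _ , inj₁ refl , eq
  ρ-∈ (inj₂ (inj₁ eq)) = _ , inj₂ (inj₁ refl) , eq
  ρ-∈ (inj₂ (inj₂ eq)) = _ , inj₂ (inj₂ refl) , eq
  ρ-V′ : ∀ {x} → x ∈ V H → ρ x ∈ V H′
  ρ-V′ {x} x∈ with bc x in bcx
  ... | true = a∈V′
  ... | false = V′⁺ x∈ bcx
  V⊆V′ : ∀ {x} → x ∈ V H → x ∈ vs₀ ⊎ x ∈ V H′
  V⊆V′ {x} x∈ with bc x in bcx
  ... | true = inj₁ (bc⇒vs₀ (bc⁻ bcx))
  ... | false = inj₂ (V′⁺ x∈ bcx)
  apq-distinct : Distinct (a , p , q)
  apq-distinct = Cyc-distinct⁻ apq (distinct e)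
  f f′ : ℕ → ℕ
  f v = pos v (V H)
  f′ v = pos v (V H′)
  open Signs f
  -- As a pair, `p`, `q` moves to the front without a change of sign. There its inversions depend
  -- only on the set of the remaining vertices, so they make up a constant.
  sign : ∀ ps → ps ++ a ∷ [] ↭ V H′ → Unique (ps ++ vs₀) → (∀ {x} → x ∈ ps ++ vs₀ → x ∈ V H) →
    sg (ps ++ vs₀) ≡ (weight p (q ∷ V H′) · weight q (V H′)) · Signs.sg f′ (ps ++ a ∷ [])
  sign ps perm u ⊆V = begin
    sg (ps ++ p ∷ q ∷ a ∷ [])
      ≡⟨ sg-pair-shift p q ps (a ∷ []) (apart (here refl)) (apart (there (here refl))) ⟨
    sg (p ∷ q ∷ ps ++ a ∷ [])
      ≡⟨ trans (sg-∷ p (q ∷ ps ++ a ∷ [])) (cong (weight p (q ∷ ps ++ a ∷ []) ·_) (sg-∷ q (ps ++ a ∷ []))) ⟩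
    weight p (q ∷ ps ++ a ∷ []) · (weight q (ps ++ a ∷ []) · sg (ps ++ a ∷ []))
      ≡⟨ cong₂ (λ s t → s · (t · sg (ps ++ a ∷ []))) (weight-↭ p (prep q perm)) (weight-↭ q perm) ⟩
    weight p (q ∷ V H′) · (weight q (V H′) · sg (ps ++ a ∷ []))
      ≡⟨ *-assoc (weight p (q ∷ V H′)) _ _ ⟨
    (weight p (q ∷ V H′) · weight q (V H′)) · sg (ps ++ a ∷ [])
      ≡⟨ cong ((weight p (q ∷ V H′) · weight q (V H′)) ·_) (sg-cong f f′ (ps ++ a ∷ []) same-order) ⟩
    (weight p (q ∷ V H′) · weight q (V H′)) · Signs.sg f′ (ps ++ a ∷ []) ∎
    where
    open ≡-Reasoning
    disjoint : ∀ ps → Unique (ps ++ vs₀) → ∀ {x z} → x ∈ vs₀ → z ∈ ps → x ≢ z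
    disjoint (z ∷ ps) u x∈ (here refl) refl = Unique.Unique[x∷xs]⇒x∉xs u (∈-++⁺ʳ ps x∈)
    disjoint (_ ∷ ps) (_ ∷ u) x∈ (there z∈) eq = disjoint ps u x∈ z∈ eq
    apart : ∀ {x z} → x ∈ vs₀ → z ∈ ps → f x ≢ f z
    apart x∈ z∈ eq = disjoint ps u x∈ z∈
      (pos-injective (V H) (⊆V (∈-++⁺ʳ ps x∈)) (⊆V (∈-++⁺ˡ z∈)) eq)
    keep-true : ∀ {x} → x ∈ ps ++ a ∷ [] → keep x ≡ true
    keep-true x∈ = cong not (proj₂ (V′⁻ (∈-resp-↭ perm x∈)))
    same-order : ∀ {x y} → x ∈ ps ++ a ∷ [] → y ∈ ps ++ a ∷ [] → (f x <ᵇ f y) ≡ (f′ x <ᵇ f′ y)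
    same-order x∈ y∈ = pos-<ᵇ-filter keep (V H) (keep-true x∈) (keep-true y∈)
  minor : Minor H H′ ω a (e ∷ []) vs₀
  minor = record
    { wf = wf
    ; wf′ = record
      { vertices-unique = Unique.filter⁺ (T? ∘ keep) vertices-unique
      ; distinct = λ e′ → let e₀ , eq , m = preimage e′
                          in subst Distinct (sym eq) (ρ-distinct (tri H e₀) (distinct e₀) m)
      ; incident = λ {e′} {x} x∈ →
          let e₀ , eq , _ = preimage e′
              y , y∈ , x≡ρy = ρ-∈ (subst (x ∈ₜ_) eq x∈)
          in subst (_∈ V H′) (sym x≡ρy) (ρ-V′ (incident {e₀} y∈)) }
    ; base = Growth.grow Growth.root apq (here refl)
               (λ { (here p≡a) → proj₁ apq-distinct (sym p≡a) })
               (λ { (here q≡a) → proj₁ (proj₂ apq-distinct) (sym q≡a) })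
               (proj₂ (proj₂ apq-distinct))
    ; ρ = ρ
    ; merged⁻ = λ eq → [ bc⇒vs₀ , (λ { refl → there (there (here refl)) }) ]′ (merged⁻ eq)
    ; merged⁺ = merged⁺ ∘ vs₀⇒bc
    ; kept = kept
    ; ι = ι
    ; ι-tri = λ e′ → proj₁ (proj₂ (preimage e′))
    ; a∈V′ = a∈V′
    ; V′⊆V = proj₁ ∘ V′⁻
    ; V⊆V′ = V⊆V′
    ; large = large
    ; K = weight p (q ∷ V H′) · weight q (V H′)
    ; sign = sign }

contract-pfaffian : ∀ {H} → WellFormed H → 2 ≤ length (V H) → ∀ e ω →
  (∀ T₁ T₂ → IsSpanningTree H T₁ → IsSpanningTree H T₂ → e ∈ₛ T₁ → e ∈ₛ T₂ → sgn H T₁ ω ≡ sgn H T₂ ω) →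
  ∀ r → Is3Pfaffian (contract H e r)
contract-pfaffian {H} wf large e ω const r with tri H e in eq | r
... | x , y , z | zero = contract3-pfaffian wf large e ω (subst (λ t → Cyc t true x y z) (sym eq) +₀) const
... | x , y , z | suc zero = contract3-pfaffian wf large e ω (subst (λ t → Cyc t false y x z) (sym eq) -₀) const
... | x , y , z | suc (suc zero) = contract3-pfaffian wf large e ω (subst (λ t → Cyc t true z x y) (sym eq) +₂) const

-- Change of orientation

χ : Bool → Sign
χ true = plus
χ false = minus

∏ : List Sign → Sign
∏ = foldr _·_ plus

∏-↭ : ∀ {ss ts} → ss ↭ ts → ∏ ss ≡ ∏ ts
∏-↭ Perm.refl = refl
∏-↭ (prep s p) = cong (s ·_) (∏-↭ p)
∏-↭ {_ ∷ _ ∷ ss} (Perm.swap s t p) = trans (·-left-comm s t (∏ ss)) (cong (λ u → t · (s · u)) (∏-↭ p))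
∏-↭ (Perm.trans p q) = trans (∏-↭ p) (∏-↭ q)

module _ (H : Graph3) (r : ℕ) (f : ℕ → ℕ) where
  open Signs f
  open Growth H using (Grown; root; grow)

  -- Reversing a triple exchanges the two vertices that it adds and leaves the growth otherwise as
  -- it was, so each reversed triple costs one sign.
  reorient : ∀ {es vs} ω → Grown (λ _ → true) r es vs → (∀ {x y} → x ∈ vs → y ∈ vs → f x ≡ f y → x ≡ y) →
    ∃ λ vs′ → Grown ω r es vs′ × vs′ ↭ vs × sg vs′ ≡ ∏ (map (χ ∘ ω) es) · sg vs
  reorient ω root inj = r ∷ [] , root , ↭-refl , refl
  reorient ω (grow {e} {es} {vs} {u} {v} {w} g c u∈ v∉ w∉ v≢w) inj
    with reorient ω g (λ x∈ y∈ → inj (there (there x∈)) (there (there y∈))) | ω e in ωe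
  ... | vs′ , g′ , p , eq | true =
    v ∷ w ∷ vs′ , grow g′ (subst (λ b → Cyc _ b u v w) (sym ωe) c) (∈-resp-↭ (↭-sym p) u∈) (v∉ ∘ ∈-resp-↭ p) (w∉ ∘ ∈-resp-↭ p) v≢w ,
    prep v (prep w p) , sg-suffix (v ∷ w ∷ []) (∏ (map (χ ∘ ω) es)) p eq
  ... | vs′ , g′ , p , eq | false =
    w ∷ v ∷ vs′ , grow g′ (subst (λ b → Cyc _ b u w v) (sym ωe) (Cyc-flip c)) (∈-resp-↭ (↭-sym p) u∈) (w∉ ∘ ∈-resp-↭ p) (v∉ ∘ ∈-resp-↭ p) (v≢w ∘ sym) ,
    Perm.swap w v p , (begin
      sg (w ∷ v ∷ vs′)
        ≡⟨ sg-swap vs′ (λ fw≡fv → v≢w (sym (inj (there (here refl)) (here refl) fw≡fv))) ⟩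
      opposite (sg (v ∷ w ∷ vs′))
        ≡⟨ cong opposite (sg-suffix (v ∷ w ∷ []) (∏ (map (χ ∘ ω) es)) p eq) ⟩
      opposite (∏ (map (χ ∘ ω) es) · sg (v ∷ w ∷ vs))
        ≡⟨ *-assoc minus (∏ (map (χ ∘ ω) es)) (sg (v ∷ w ∷ vs)) ⟨
      (minus · ∏ (map (χ ∘ ω) es)) · sg (v ∷ w ∷ vs) ∎)
    where open ≡-Reasoning

-- The spanning trees of Hk

pairs : ℕ → List ℕ → List ℕ
pairs k is = concat (map (λ i → i ∷ k + i ∷ []) is)

range : ℕ → List ℕ
range k = map suc (upTo k)

_∈[1,_] : ℕ → ℕ → Set
i ∈[1, k ] = 1 ≤ i × i ≤ k

range⁻ : ∀ {k i} → i ∈ range k → i ∈[1, k ]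
range⁻ i∈ with ∈-map⁻ suc i∈
... | j , j∈ , refl = s≤s z≤n , ∈-upTo⁻ j∈

range⁺ : ∀ {k i} → i ∈[1, k ] → i ∈ range k
range⁺ (s≤s _ , i≤k) = ∈-map⁺ suc (∈-upTo⁺ i≤k)

range-unique : ∀ k → Unique (range k)
range-unique k = Unique.map⁺ ℕ.suc-injective (Unique.upTo⁺ k)

pairs-∈⁻ : ∀ {k x} is → x ∈ pairs k is → ∃ λ i → i ∈ is × (x ≡ i ⊎ x ≡ k + i)
pairs-∈⁻ (i ∷ is) (here refl) = i , here refl , inj₁ refl
pairs-∈⁻ (i ∷ is) (there (here refl)) = i , here refl , inj₂ refl
pairs-∈⁻ (i ∷ is) (there (there x∈)) = let j , j∈ , eq = pairs-∈⁻ is x∈ in j , there j∈ , eq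

pairs-∈⁺ : ∀ {k x i} is → i ∈ is → x ≡ i ⊎ x ≡ k + i → x ∈ pairs k is
pairs-∈⁺ (i ∷ is) (here refl) (inj₁ refl) = here refl
pairs-∈⁺ (i ∷ is) (here refl) (inj₂ refl) = there (here refl)
pairs-∈⁺ (i ∷ is) (there i∈) eq = there (there (pairs-∈⁺ is i∈ eq))

prev1-∈ : ∀ {k i} → 2 ≤ k → i ∈[1, k ] → prev1 k i ∈[1, k ]
prev1-∈ {i = suc zero} 2≤k _ = ℕ.≤-trans (s≤s z≤n) 2≤k , ℕ.≤-refl
prev1-∈ {i = suc (suc i)} 2≤k (_ , i≤k) = s≤s z≤n , ℕ.≤-trans (ℕ.n≤1+n _) i≤k

prev1-≢ : ∀ {k i} → 2 ≤ k → i ∈[1, k ] → prev1 k i ≢ i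
prev1-≢ {i = suc zero} 2≤k _ eq = ℕ.<⇒≢ 2≤k (sym eq)
prev1-≢ {i = suc (suc i)} 2≤k _ eq = ℕ.<⇒≢ (ℕ.n<1+n (suc i)) eq

prev2-prev1 : ∀ {k i} → 2 ≤ k → i ∈[1, k ] → prev2 k i ≡ prev1 k (prev1 k i)
prev2-prev1 {suc (suc k)} {suc zero} _ _ = refl
prev2-prev1 {suc zero} (s≤s ()) _
prev2-prev1 {i = suc (suc zero)} _ _ = refl
prev2-prev1 {i = suc (suc (suc i))} _ _ = refl

module Wheel (k : ℕ) (2≤k : 2 ≤ k) where

  H : Graph3
  H = Hk k

  A B : ℕ → Triple
  A i = 0 , i , k + i
  B i = prev2 k i , prev1 k i , k + i

  label< : ∀ {i j} → i ∈[1, k ] → j ∈[1, k ] → i < k + j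
  label< {i} {suc j} (_ , i≤k) _ = ℕ.≤-trans (s≤s i≤k) (ℕ.≤-trans (s≤s (ℕ.m≤m+n k j)) (ℕ.≤-reflexive (sym (ℕ.+-suc k j))))

  label≢ : ∀ {i j} → i ∈[1, k ] → j ∈[1, k ] → i ≢ k + j
  label≢ i∈ j∈ = ℕ.<⇒≢ (label< i∈ j∈)

  prev2-∈ : ∀ {i} → i ∈[1, k ] → prev2 k i ∈[1, k ]
  prev2-∈ i∈ = subst (_∈[1, k ]) (sym (prev2-prev1 2≤k i∈)) (prev1-∈ 2≤k (prev1-∈ 2≤k i∈))

  ∈[1,k]-≢0 : ∀ {i} → i ∈[1, k ] → i ≢ 0
  ∈[1,k]-≢0 (() , _) refl

  vertices : V H ≡ 0 ∷ pairs k (range k)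
  vertices = cong (λ l → 0 ∷ concat l) (map-∘ (upTo k))

  vertex⁺ : ∀ {x i} → i ∈[1, k ] → x ≡ i ⊎ x ≡ k + i → x ∈ V H
  vertex⁺ {x} i∈ eq = subst (x ∈_) (sym vertices) (there (pairs-∈⁺ (range k) (range⁺ i∈) eq))

  edge : ∀ e → ∃ λ i → i ∈[1, k ] × (tri H e ≡ A i ⊎ tri H e ≡ B i)
  edge e with ∈-++⁻ (map (A ∘ suc) (upTo k)) (∈-lookup {xs = E H} e)
  ... | inj₁ m = let j , j∈ , eq = ∈-map⁻ (A ∘ suc) m in suc j , (s≤s z≤n , ∈-upTo⁻ j∈) , inj₁ eq
  ... | inj₂ m = let j , j∈ , eq = ∈-map⁻ (B ∘ suc) m in suc j , (s≤s z≤n , ∈-upTo⁻ j∈) , inj₂ eq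

  edge-A : ∀ {i} → i ∈[1, k ] → ∃ λ e → tri H e ≡ A i
  edge-A {suc j} (_ , j<k) = index m , sym (lookup-index m)
    where
    m : A (suc j) ∈ E H
    m = ∈-++⁺ˡ (∈-map⁺ (A ∘ suc) (∈-upTo⁺ j<k))

  edge-B : ∀ {i} → i ∈[1, k ] → ∃ λ e → tri H e ≡ B i
  edge-B {suc j} (_ , j<k) = index m , sym (lookup-index m)
    where
    m : B (suc j) ∈ E H
    m = ∈-++⁺ʳ (map (A ∘ suc) (upTo k)) (∈-map⁺ (B ∘ suc) (∈-upTo⁺ j<k))

  A≢B : ∀ {i j} → j ∈[1, k ] → A i ≢ B j
  A≢B j∈ eq = ∈[1,k]-≢0 (prev2-∈ j∈) (sym (cong proj₁ eq))

  A-injective : ∀ {i j} → A i ≡ A j → i ≡ j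
  A-injective eq = cong (proj₁ ∘ proj₂) eq

  B-injective : ∀ {i j} → B i ≡ B j → i ≡ j
  B-injective eq = ℕ.+-cancelˡ-≡ k _ _ (cong (proj₂ ∘ proj₂) eq)

  tri-injective : ∀ {e e′} → tri H e ≡ tri H e′ → e ≡ e′
  tri-injective {e} {e′} = lookup-injective unique e e′
    where
    unique : Unique (E H)
    unique = Unique.++⁺ (Unique.map⁺ (ℕ.suc-injective ∘ A-injective) (Unique.upTo⁺ k))
      (Unique.map⁺ (ℕ.suc-injective ∘ B-injective) (Unique.upTo⁺ k))
      λ { (m₁ , m₂) → let _ , _ , eq₁ = ∈-map⁻ (A ∘ suc) m₁
                          _ , j∈ , eq₂ = ∈-map⁻ (B ∘ suc) m₂
                      in A≢B (s≤s z≤n , ∈-upTo⁻ j∈) (trans (sym eq₁) eq₂) }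

  wellFormed : WellFormed H
  wellFormed = record
    { vertices-unique = subst Unique (sym vertices) (All≢ 0∉ ∷ Unique.concat⁺
        (All.tabulate λ m → let i , i∈ , eq = ∈-map⁻ _ m
                            in subst Unique (sym eq) ((label≢ (range⁻ i∈) (range⁻ i∈) ∷ []) ∷ [] ∷ []))
        (AllPairs.map⁺ (AllPairs.map⁺ (AllPairs.applyUpTo⁺₁ id k λ i<j j<k →
          λ { (m₁ , m₂) → disjoint (s≤s z≤n , ℕ.<-trans i<j j<k) (s≤s z≤n , j<k) (λ eq → ℕ.<⇒≢ i<j (ℕ.suc-injective eq)) m₁ m₂ }))))
    ; distinct = distinct
    ; incident = incident }
    where
    0∉ : 0 ∉ pairs k (range k)
    0∉ m with pairs-∈⁻ (range k) m
    ... | i , i∈ , inj₁ refl = ∈[1,k]-≢0 (range⁻ i∈) refl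
    ... | suc i , i∈ , inj₂ eq = contradiction (trans eq (ℕ.+-suc k i)) λ ()
    ... | zero , i∈ , inj₂ eq = ∈[1,k]-≢0 (range⁻ i∈) refl
    disjoint : ∀ {i j x} → i ∈[1, k ] → j ∈[1, k ] → i ≢ j → x ∈ i ∷ k + i ∷ [] → x ∈ j ∷ k + j ∷ [] → ⊥
    disjoint i∈ j∈ i≢j (here refl) (here eq) = i≢j eq
    disjoint i∈ j∈ i≢j (here refl) (there (here eq)) = label≢ i∈ j∈ eq
    disjoint i∈ j∈ i≢j (there (here refl)) (here eq) = label≢ j∈ i∈ (sym eq)
    disjoint i∈ j∈ i≢j (there (here refl)) (there (here eq)) = i≢j (ℕ.+-cancelˡ-≡ k _ _ eq)
    distinct : ∀ e → Distinct (tri H e)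
    distinct e with edge e
    ... | i , i∈ , inj₁ eq rewrite eq =
      (λ 0≡i → ∈[1,k]-≢0 i∈ (sym 0≡i)) , (λ eq′ → ℕ.<⇒≢ (ℕ.≤-trans (s≤s z≤n) (label< i∈ i∈)) eq′) , label≢ i∈ i∈
    ... | i , i∈ , inj₂ eq rewrite eq =
      (λ eq′ → prev1-≢ 2≤k (prev1-∈ 2≤k i∈) (trans (sym (prev2-prev1 2≤k i∈)) eq′)) ,
      label≢ (prev2-∈ i∈) i∈ , label≢ (prev1-∈ 2≤k i∈) i∈
    incident : ∀ {e x} → x ∈ₜ tri H e → x ∈ V H
    incident {e} x∈ with edge e
    incident {e} {x} x∈ | i , i∈ , inj₁ eq with subst (x ∈ₜ_) eq x∈
    ... | inj₁ refl = here refl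
    ... | inj₂ x≡ = vertex⁺ i∈ x≡
    incident {e} {x} x∈ | i , i∈ , inj₂ eq with subst (x ∈ₜ_) eq x∈
    ... | inj₁ x≡ = vertex⁺ (prev2-∈ i∈) (inj₁ x≡)
    ... | inj₂ (inj₁ x≡) = vertex⁺ (prev1-∈ 2≤k i∈) (inj₁ x≡)
    ... | inj₂ (inj₂ x≡) = vertex⁺ i∈ (inj₂ x≡)

  large : 2 ≤ length (V H)
  large = subst (λ l → 2 ≤ length l) (sym vertices) (two (range⁺ {k} (ℕ.≤-refl , ℕ.≤-trans (s≤s z≤n) 2≤k)))
    where
    two : ∀ {is} → 1 ∈ is → 2 ≤ length (0 ∷ pairs k is)
    two {_ ∷ _} _ = s≤s (s≤s z≤n)

  pick : (ℕ → Bool) → ℕ → Triple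
  pick C i = if C i then A i else B i

  -- Among the triples of `H` only the `A i` begin with 0. The index is their second entry; for
  -- `B i` it is recovered from the primed vertex.
  selected : (ℕ → Bool) → Triple → Bool
  selected C (x , y , z) = if x ≡ᵇ 0 then C y else not (C (z ∸ k))

  treeOf : (ℕ → Bool) → Subset (#E H)
  treeOf C = tabulate (selected C ∘ tri H)

  selected-B : ∀ C {i} → i ∈[1, k ] → selected C (B i) ≡ not (C i)
  selected-B C {i} i∈ rewrite ≢⇒≡ᵇ≡false (∈[1,k]-≢0 (prev2-∈ i∈)) | ℕ.m+n∸m≡n k i = refl

  treeOf⁻ : ∀ {C e} → e ∈ₛ treeOf C → ∃ λ i → i ∈[1, k ] × tri H e ≡ pick C i
  treeOf⁻ {C} {e} e∈ with edge e
  ... | i , i∈ , inj₁ eq = i , i∈ , trans eq (cong (λ b → if b then A i else B i) (sym Ci))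
    where
    Ci : C i ≡ true
    Ci = trans (cong (selected C) (sym eq)) (trans (sym (lookup∘tabulate (selected C ∘ tri H) e)) ([]=⇒lookup e∈))
  ... | i , i∈ , inj₂ eq = i , i∈ , trans eq (cong (λ b → if b then A i else B i) (sym Ci))
    where
    Ci : C i ≡ false
    Ci = not-injective (trans (sym (selected-B C i∈)) (trans (cong (selected C) (sym eq))
           (trans (sym (lookup∘tabulate (selected C ∘ tri H) e)) ([]=⇒lookup e∈))))

  treeOf⁺ : ∀ {C e i} → i ∈[1, k ] → tri H e ≡ pick C i → e ∈ₛ treeOf C
  treeOf⁺ {C} {e} {i} i∈ eq = lookup⇒[]= e (treeOf C)
    (trans (lookup∘tabulate (selected C ∘ tri H) e) (trans (cong (selected C) eq) sel))
    where
    sel : selected C (pick C i) ≡ true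
    sel with C i in Ci
    ... | true = Ci
    ... | false = trans (selected-B C i∈) (cong not Ci)

-- Growing the tree of an index set and computing its sign

partition-↭ : ∀ {A : Set} (P : A → Bool) xs → filterᵇ (not ∘ P) xs ++ filterᵇ P xs ↭ xs
partition-↭ P [] = ↭-refl
partition-↭ P (x ∷ xs) with P x
... | true = ↭-trans (shift x (filterᵇ (not ∘ P) xs) (filterᵇ P xs)) (prep x (partition-↭ P xs))
... | false = prep x (partition-↭ P xs)

pairs-++ : ∀ k is js → pairs k (is ++ js) ≡ pairs k is ++ pairs k js
pairs-++ k [] js = refl
pairs-++ k (i ∷ is) js = cong (λ l → i ∷ k + i ∷ l) (pairs-++ k is js)

pairs-even : ∀ k is → parity (length (pairs k is)) ≡ plus
pairs-even k [] = refl
pairs-even k (i ∷ is) = pairs-even k is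

module WheelTrees (k : ℕ) (2≤k : 2 ≤ k) where
  open Wheel k 2≤k

  f : ℕ → ℕ
  f v = pos v (V H)
  open Signs f
  open Growth H (λ _ → true) 0

  pos-≢ : ∀ {x y} → x ∈ V H → y ∈ V H → x ≢ y → f x ≢ f y
  pos-≢ x∈ y∈ x≢y eq = x≢y (pos-injective (V H) x∈ y∈ eq)

  vert : ∀ {i} → i ∈[1, k ] → i ∈ V H
  vert i∈ = vertex⁺ i∈ (inj₁ refl)

  vert′ : ∀ {i} → i ∈[1, k ] → k + i ∈ V H
  vert′ i∈ = vertex⁺ i∈ (inj₂ refl)

  k+-≢ : ∀ {i j} → i ≢ j → k + i ≢ k + j
  k+-≢ i≢j eq = i≢j (ℕ.+-cancelˡ-≡ k _ _ eq)

  -- Exchanging two neighbouring indices moves one pair past another, which costs no sign.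
  pairs-sg : ∀ {is js m} → is ↭ js → (∀ {i} → i ∈ is → i ∈[1, k ]) →
    pairs k is ++ m ↭ pairs k js ++ m × sg (pairs k is ++ m) ≡ sg (pairs k js ++ m)
  pairs-sg Perm.refl h = ↭-refl , refl
  pairs-sg (prep i p) h =
    let q , eq = pairs-sg p (h ∘ there)
    in prep i (prep (k + i) q) , sg-prefix (i ∷ k + i ∷ []) q eq
  pairs-sg (Perm.trans p q) h =
    let p₁ , eq₁ = pairs-sg p h
        p₂ , eq₂ = pairs-sg q (h ∘ ∈-resp-↭ (↭-sym p))
    in ↭-trans p₁ p₂ , trans eq₁ eq₂
  pairs-sg {m = m} (Perm.swap {is} {js} i j p) h with i ≟ j
  ... | yes refl =
    let q , eq = pairs-sg p (h ∘ there ∘ there)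
        l = i ∷ k + i ∷ i ∷ k + i ∷ []
    in ++⁺ˡ l q , sg-prefix l q eq
  ... | no i≢j =
    ↭-trans (++⁺ˡ (i ∷ k + i ∷ j ∷ k + j ∷ []) q) (Perm.shifts (i ∷ k + i ∷ []) (j ∷ k + j ∷ [])) ,
    trans (sg-prefix (i ∷ k + i ∷ j ∷ k + j ∷ []) q eq)
          (sg-pair-shift i (k + i) (j ∷ k + j ∷ []) (pairs k js ++ m)
            (λ { (here refl) → pos-≢ (vert i∈) (vert j∈) i≢j
               ; (there (here refl)) → pos-≢ (vert i∈) (vert′ j∈) (label≢ i∈ j∈) })
            (λ { (here refl) → pos-≢ (vert′ i∈) (vert j∈) (label≢ j∈ i∈ ∘ sym)
               ; (there (here refl)) → pos-≢ (vert′ i∈) (vert′ j∈) (k+-≢ i≢j) }))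
    where
    i∈ = h (here refl)
    j∈ = h (there (here refl))
    q = proj₁ (pairs-sg {m = m} p (h ∘ there ∘ there))
    eq = proj₂ (pairs-sg {m = m} p (h ∘ there ∘ there))

  -- The sign of the tree of all `A i`, oriented as stored. All other signs are measured relative to
  -- it.
  reference : Sign
  reference = sg (pairs k (range k) ++ 0 ∷ [])

  -- Triples and vertices are prescribed only up to order, since the order of growth depends on `C`;
  -- `s` is the sign relative to `reference`.
  Spanned : (ℕ → Bool) → Sign → Set
  Spanned C s = ∃₂ λ es vs → Grown es vs × map (tri H) es ↭ map (pick C) (range k) ×
    vs ↭ pairs k (range k) ++ 0 ∷ [] × sg vs ≡ s · reference

  ∉-spokes : ∀ {cs x} → (∀ {c} → c ∈ cs → x ≢ c × x ≢ k + c) → x ≢ 0 → x ∉ pairs k cs ++ 0 ∷ []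
  ∉-spokes {cs} h x≢0 x∈ with ∈-++⁻ (pairs k cs) x∈
  ... | inj₂ (here x≡0) = x≢0 x≡0
  ... | inj₁ m with pairs-∈⁻ cs m
  ... | c , c∈ , inj₁ eq = proj₁ (h c∈) eq
  ... | c , c∈ , inj₂ eq = proj₂ (h c∈) eq

  k+≢0 : ∀ {i} → i ∈[1, k ] → k + i ≢ 0
  k+≢0 i∈ eq = ∈[1,k]-≢0 i∈ (ℕ.m+n≡0⇒n≡0 k eq)

  spokes : ∀ cs → Unique cs → (∀ {c} → c ∈ cs → c ∈[1, k ]) →
    ∃ λ es → Grown es (pairs k cs ++ 0 ∷ []) × map (tri H) es ≡ map A cs
  spokes [] _ h = [] , root , refl
  spokes (c ∷ cs) u@(_ ∷ ucs) h =
    let es , g , eq = spokes cs ucs (h ∘ there)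
        e , eq-e = edge-A (h (here refl))
    in e ∷ es ,
       grow g (subst (λ t → Cyc t true 0 c (k + c)) (sym eq-e) +₀) (∈-++⁺ʳ (pairs k cs) (here refl))
         (∉-spokes (λ c′∈ → c≢ c′∈ , label≢ (h (here refl)) (h (there c′∈))) (∈[1,k]-≢0 (h (here refl))))
         (∉-spokes (λ c′∈ → label≢ (h (there c′∈)) (h (here refl)) ∘ sym , k+-≢ (c≢ c′∈)) (k+≢0 (h (here refl))))
         (label≢ (h (here refl)) (h (here refl))) ,
       cong₂ _∷_ eq-e eq
    where
    c≢ : ∀ {c′} → c′ ∈ cs → c ≢ c′
    c≢ c′∈ refl = Unique.Unique[x∷xs]⇒x∉xs u c′∈

  map-pick-true : ∀ {C} is → (∀ {i} → i ∈ is → C i ≡ true) → map A is ≡ map (pick C) is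
  map-pick-true [] h = refl
  map-pick-true (i ∷ is) h rewrite h (here refl) = cong (A i ∷_) (map-pick-true is (h ∘ there))

  full-spanned : ∀ C → (∀ {i} → i ∈[1, k ] → C i ≡ true) → Spanned C plus
  full-spanned C all =
    let es , g , eq = spokes (range k) (range-unique k) range⁻
    in es , _ , g , ↭-reflexive (trans eq (map-pick-true (range k) (all ∘ range⁻))) , ↭-refl , refl

  Link : (ℕ → Bool) → ℕ → ℕ → Set
  Link C x y = prev1 k y ≡ x × C x ∧ C y ≡ false

  -- All A i with i ∈ C are added first.  The B j with j ∉ C are then added in cyclic order,
  -- starting after c₀ ∈ C.  Adding B j reaches j′ and the last index q ∉ C before j, which is
  -- still missing (initially q = s₀, the predecessor of c₀).
  module Traversal (C : ℕ → Bool) (c₀ : ℕ) (c₀∈ : c₀ ∈[1, k ]) (Cc₀ : C c₀ ≡ true) where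

    cs : List ℕ
    cs = filterᵇ C (range k)

    others : List ℕ → List ℕ
    others = filterᵇ (not ∘ C)

    s₀ : ℕ
    s₀ = prev1 k c₀

    vs₀ : List ℕ
    vs₀ = pairs k cs ++ 0 ∷ []

    cs⁻ : ∀ {c} → c ∈ cs → c ∈[1, k ] × C c ≡ true
    cs⁻ c∈ = let m , t = ∈-filter⁻ (T? ∘ C) {xs = range k} c∈ in range⁻ m , Equivalence.to T-≡ t

    cs⁺ : ∀ {c} → c ∈[1, k ] → C c ≡ true → c ∈ cs
    cs⁺ c∈ eq = ∈-filter⁺ (T? ∘ C) (range⁺ c∈) (Equivalence.from T-≡ eq)

    others⁺ : ∀ {x l} → x ∈ l → C x ≡ false → x ∈ others l
    others⁺ x∈ eq = ∈-filter⁺ (T? ∘ not ∘ C) x∈ (Equivalence.from T-not-≡ eq)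

    -- `ds` lists the j whose `B j` has been added, `rest` the indices still to be visited. With the
    -- pending `q` included, the vertices form complete pairs except for `s₀`, whose primed partner
    -- enters only with the last triple. The invariant compares the two lists, and `ε` collects the
    -- signs.
    record State (q : ℕ) (ε : Sign) (es : List (Fin (#E H))) (vs rest : List ℕ) : Set where
      field
        ds : List ℕ
        grown : Grown es vs
        edges : map (tri H) es ↭ map (pick C) (ds ++ cs)
        verts : q ∷ vs ↭ pairs k ds ++ s₀ ∷ vs₀
        sign : sg (q ∷ vs) ≡ ε · sg (pairs k ds ++ s₀ ∷ vs₀)
        pending : q ∉ vs
        reached : ∀ {x} → x ∈ vs₀ → x ∈ vs
        remaining : ∀ {x} → x ∈ rest → x ∈[1, k ]
        indices : ds ++ others rest ++ cs ↭ range k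

    module Step {q ε es vs j rest} (st : State q ε es vs (j ∷ rest)) (Cj : C j ≡ false) where
      open State st

      indices′ : ds ++ j ∷ others rest ++ cs ↭ range k
      indices′ = subst (λ l → ds ++ l ++ cs ↭ range k) (others-∷ Cj) indices
        where
        others-∷ : C j ≡ false → others (j ∷ rest) ≡ j ∷ others rest
        others-∷ eq rewrite eq = refl

      indices″ : j ∷ ds ++ others rest ++ cs ↭ range k
      indices″ = ↭-trans (↭-sym (shift j ds (others rest ++ cs))) indices′

      in-range : ∀ {i} → i ∈ j ∷ ds ++ others rest ++ cs → i ∈[1, k ]
      in-range i∈ = range⁻ (∈-resp-↭ indices″ i∈)

      j∈ : j ∈[1, k ]
      j∈ = in-range (here refl)

      ds∈ : ∀ {i} → i ∈ ds → i ∈[1, k ]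
      ds∈ i∈ = in-range (there (∈-++⁺ˡ i∈))

      j∉ : j ∉ ds ++ others rest ++ cs
      j∉ = Unique.Unique[x∷xs]⇒x∉xs (Unique-resp-↭ (↭-sym indices″) (range-unique k))

      s₀∈ : s₀ ∈[1, k ]
      s₀∈ = prev1-∈ 2≤k c₀∈

      known⁻ : ∀ {x} → x ∈ pairs k ds ++ s₀ ∷ vs₀ →
        (∃ λ i → i ∈ ds × (x ≡ i ⊎ x ≡ k + i)) ⊎ x ≡ s₀ ⊎ (∃ λ i → i ∈ cs × (x ≡ i ⊎ x ≡ k + i)) ⊎ x ≡ 0
      known⁻ x∈ with ∈-++⁻ (pairs k ds) x∈
      ... | inj₁ m = inj₁ (pairs-∈⁻ ds m)
      ... | inj₂ (here eq) = inj₂ (inj₁ eq)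
      ... | inj₂ (there m) with ∈-++⁻ (pairs k cs) m
      ... | inj₁ m′ = inj₂ (inj₂ (inj₁ (pairs-∈⁻ cs m′)))
      ... | inj₂ (here eq) = inj₂ (inj₂ (inj₂ eq))

      known-V : ∀ {x} → x ∈ pairs k ds ++ s₀ ∷ vs₀ → x ∈ V H
      known-V x∈ with known⁻ x∈
      ... | inj₁ (i , i∈ , eq) = vertex⁺ (ds∈ i∈) eq
      ... | inj₂ (inj₁ refl) = vert s₀∈
      ... | inj₂ (inj₂ (inj₁ (i , i∈ , eq))) = vertex⁺ (proj₁ (cs⁻ i∈)) eq
      ... | inj₂ (inj₂ (inj₂ refl)) = here refl

      j∉known : j ≢ s₀ → j ∉ pairs k ds ++ s₀ ∷ vs₀
      j∉known j≢s₀ m with known⁻ m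
      ... | inj₁ (i , i∈ , inj₁ refl) = j∉ (∈-++⁺ˡ i∈)
      ... | inj₁ (i , i∈ , inj₂ eq) = label≢ j∈ (ds∈ i∈) eq
      ... | inj₂ (inj₁ eq) = j≢s₀ eq
      ... | inj₂ (inj₂ (inj₁ (i , i∈ , inj₁ refl))) = j∉ (∈-++⁺ʳ ds (∈-++⁺ʳ (others rest) i∈))
      ... | inj₂ (inj₂ (inj₁ (i , i∈ , inj₂ eq))) = label≢ j∈ (proj₁ (cs⁻ i∈)) eq
      ... | inj₂ (inj₂ (inj₂ eq)) = ∈[1,k]-≢0 j∈ eq

      j′∉known : k + j ∉ pairs k ds ++ s₀ ∷ vs₀
      j′∉known m with known⁻ m
      ... | inj₁ (i , i∈ , inj₁ eq) = label≢ (ds∈ i∈) j∈ (sym eq)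
      ... | inj₁ (i , i∈ , inj₂ eq) = j∉ (∈-++⁺ˡ (subst (_∈ ds) (sym (ℕ.+-cancelˡ-≡ k _ _ eq)) i∈))
      ... | inj₂ (inj₁ eq) = label≢ s₀∈ j∈ (sym eq)
      ... | inj₂ (inj₂ (inj₁ (i , i∈ , inj₁ eq))) = label≢ (proj₁ (cs⁻ i∈)) j∈ (sym eq)
      ... | inj₂ (inj₂ (inj₁ (i , i∈ , inj₂ eq))) =
        j∉ (∈-++⁺ʳ ds (∈-++⁺ʳ (others rest) (subst (_∈ cs) (sym (ℕ.+-cancelˡ-≡ k _ _ eq)) i∈)))
      ... | inj₂ (inj₂ (inj₂ eq)) = k+≢0 j∈ eq

      j′∉ : k + j ∉ vs
      j′∉ m = j′∉known (∈-resp-↭ verts (there m))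

      q≢j′ : q ≢ k + j
      q≢j′ refl = j′∉known (∈-resp-↭ verts (here refl))

      e : Fin (#E H)
      e = proj₁ (edge-B j∈)

      tri-e : tri H e ≡ (prev2 k j , prev1 k j , k + j)
      tri-e = proj₂ (edge-B j∈)

      edges′ : map (tri H) (e ∷ es) ↭ map (pick C) (j ∷ ds ++ cs)
      edges′ = ↭-trans (↭-reflexive (cong (_∷ map (tri H) es) (trans tri-e (cong (λ b → if b then A j else B j) (sym Cj)))))
                 (prep (pick C j) edges)

      -- The new pending vertex `j` stands in front of its partner and completes a pair. `ε′`
      -- records in which order `q` and the partner of `j` were added.
      advance : ∀ {vs′ ε′} → Grown (e ∷ es) vs′ → vs′ ↭ k + j ∷ q ∷ vs → sg vs′ ≡ ε′ · sg (k + j ∷ q ∷ vs) →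
        j ≢ s₀ → State j (ε′ · ε) (e ∷ es) vs′ rest
      advance {vs′} {ε′} g p eq j≢s₀ = record
        { ds = j ∷ ds
        ; grown = g
        ; edges = edges′
        ; verts = ↭-trans (prep j p) (prep j (prep (k + j) verts))
        ; sign = begin
            sg (j ∷ vs′)
              ≡⟨ sg-suffix (j ∷ []) ε′ p eq ⟩
            ε′ · sg (j ∷ k + j ∷ q ∷ vs)
              ≡⟨ cong (ε′ ·_) (sg-suffix (j ∷ k + j ∷ []) ε verts sign) ⟩
            ε′ · (ε · sg (j ∷ k + j ∷ pairs k ds ++ s₀ ∷ vs₀))
              ≡⟨ *-assoc ε′ ε _ ⟨
            (ε′ · ε) · sg (j ∷ k + j ∷ pairs k ds ++ s₀ ∷ vs₀) ∎
        ; pending = λ m → fresh (∈-resp-↭ p m)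
        ; reached = λ m → ∈-resp-↭ (↭-sym p) (there (there (reached m)))
        ; remaining = remaining ∘ there
        ; indices = indices″ }
        where
        open ≡-Reasoning
        fresh : j ∉ k + j ∷ q ∷ vs
        fresh (here eq) = label≢ j∈ j∈ eq
        fresh (there m) = j∉known j≢s₀ (∈-resp-↭ verts m)

      -- The last triple adds the partner of `s₀`, which stands before `s₀` in the list. Exchanging
      -- the two costs the additional `opposite`.
      finish : ∀ {vs′ ε′} → Grown (e ∷ es) vs′ → vs′ ↭ k + j ∷ q ∷ vs → sg vs′ ≡ ε′ · sg (k + j ∷ q ∷ vs) →
        s₀ ≡ j → rest ≡ [] → Spanned C (opposite (ε′ · ε))
      finish {vs′} {ε′} g p eq refl refl =
        e ∷ es , vs′ , g ,
        ↭-trans edges′ (Perm.map⁺ (pick C) indices″) ,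
        ↭-trans p (↭-trans (prep (k + j) verts) (↭-trans (↭-sym (shift (k + j) (pairs k ds) (j ∷ vs₀)))
          (↭-trans (++⁺ˡ (pairs k ds) (Perm.swap (k + j) j ↭-refl)) (↭-trans (↭-reflexive regroup) (proj₁ reorder))))) ,
        (begin
          sg vs′
            ≡⟨ eq ⟩
          ε′ · sg (k + j ∷ q ∷ vs)
            ≡⟨ cong (ε′ ·_) (sg-suffix (k + j ∷ []) ε verts sign) ⟩
          ε′ · (ε · sg (k + j ∷ pairs k ds ++ j ∷ vs₀))
            ≡⟨ cong (λ s → ε′ · (ε · s)) (sg-shift (k + j) (pairs k ds) (j ∷ vs₀)
                 (λ {y} m → pos-≢ (vert′ j∈) (known-V (∈-++⁺ˡ m)) (λ { refl → j′∉known (∈-++⁺ˡ m) }))) ⟩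
          ε′ · (ε · (parity (length (pairs k ds)) · sg (pairs k ds ++ k + j ∷ j ∷ vs₀)))
            ≡⟨ cong (λ s → ε′ · (ε · (s · sg (pairs k ds ++ k + j ∷ j ∷ vs₀)))) (pairs-even k ds) ⟩
          ε′ · (ε · sg (pairs k ds ++ k + j ∷ j ∷ vs₀))
            ≡⟨ cong (λ s → ε′ · (ε · s)) (sg-suffix (pairs k ds) minus (Perm.swap (k + j) j ↭-refl)
                 (sg-swap vs₀ (pos-≢ (vert′ j∈) (vert j∈) (label≢ j∈ j∈ ∘ sym)))) ⟩
          ε′ · (ε · opposite (sg (pairs k ds ++ j ∷ k + j ∷ vs₀)))
            ≡⟨ cong (λ l → ε′ · (ε · opposite (sg l))) regroup ⟩
          ε′ · (ε · opposite (sg (pairs k (ds ++ j ∷ cs) ++ 0 ∷ [])))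
            ≡⟨ cong (λ s → ε′ · (ε · opposite s)) (proj₂ reorder) ⟩
          ε′ · (ε · opposite reference)
            ≡⟨ collect ε′ ε reference ⟩
          opposite (ε′ · ε) · reference ∎)
        where
        open ≡-Reasoning
        regroup : pairs k ds ++ j ∷ k + j ∷ vs₀ ≡ pairs k (ds ++ j ∷ cs) ++ 0 ∷ []
        regroup = trans (sym (++-assoc (pairs k ds) (pairs k (j ∷ cs)) (0 ∷ [])))
                    (cong (_++ 0 ∷ []) (sym (pairs-++ k ds (j ∷ cs))))
        reorder : pairs k (ds ++ j ∷ cs) ++ 0 ∷ [] ↭ pairs k (range k) ++ 0 ∷ [] ×
                  sg (pairs k (ds ++ j ∷ cs) ++ 0 ∷ []) ≡ reference
        reorder = pairs-sg indices′ (λ m → range⁻ (∈-resp-↭ indices′ m))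
        collect : ∀ s t u → s · (t · opposite u) ≡ opposite (s · t) · u
        collect plus plus u = refl
        collect plus minus u = opposite-involutive u
        collect minus plus u = opposite-involutive u
        collect minus minus u = cong opposite (opposite-involutive u)

      -- Here j - 1 is a reached element of `C` and `q` is j - 2. Read from j - 1, the stored
      -- 3-cycle continues with the primed vertex and then `q`.
      step-after-C : ∀ {p₁} → p₁ ∈ vs → prev1 k j ≡ p₁ → prev1 k p₁ ≡ q → Grown (e ∷ es) (k + j ∷ q ∷ vs)
      step-after-C {p₁} p₁∈ refl refl =
        grow grown (subst (λ t → Cyc t true p₁ (k + j) q) (sym (trans tri-e (cong (_, p₁ , k + j) (prev2-prev1 2≤k j∈)))) +₁)
          p₁∈ j′∉ pending (q≢j′ ∘ sym)

      -- Here `q` is j - 1 and j - 2 has been reached. Read from j - 2, the 3-cycle has `q` before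
      -- the primed vertex, the opposite of the order wanted.
      step-after-S : ∀ {p₂} → p₂ ∈ vs → prev1 k j ≡ q → prev1 k q ≡ p₂ → Grown (e ∷ es) (q ∷ k + j ∷ vs)
      step-after-S {p₂} p₂∈ refl refl =
        grow grown (subst (λ t → Cyc t true p₂ q (k + j)) (sym (trans tri-e (cong (_, q , k + j) (prev2-prev1 2≤k j∈)))) +₀)
          p₂∈ pending j′∉ q≢j′

      sg-after-S : sg (q ∷ k + j ∷ vs) ≡ minus · sg (k + j ∷ q ∷ vs)
      sg-after-S = sg-swap vs (pos-≢ (known-V (∈-resp-↭ verts (here refl))) (vert′ j∈) q≢j′)

      j≢s₀ : s₀ ∈ rest → C s₀ ≡ false → j ≢ s₀
      j≢s₀ m Cs₀ refl = j∉ (∈-++⁺ʳ ds (∈-++⁺ˡ (others⁺ m Cs₀)))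

    -- The traversal ends at the predecessor of `c₀`. Hence the triple with index `s₀` is the last
    -- one added, and no earlier `j` is `s₀`.
    last-link : ∀ {x y l} → Chain (Link C) x (y ∷ l) c₀ → s₀ ∈ y ∷ l × C s₀ ≡ false
    last-link {y = y} (_ ∷ [ prev , h ]) = here prev , subst (λ s → C s ≡ false) (sym prev) (∧≡false⇒ˡ h Cc₀)
    last-link (_ ∷ ch@(_ ∷ _)) = let m , eq = last-link ch in there m , eq

    skip : ∀ {q ε es vs j rest} → C j ≡ true → State q ε es vs (j ∷ rest) → State q ε es vs rest
    skip {j = j} {rest} Cj st = record
      { ds = ds ; grown = grown ; edges = edges ; verts = verts ; sign = sign ; pending = pending ; reached = reached
      ; remaining = remaining ∘ there ; indices = subst (λ l → ds ++ l ++ cs ↭ range k) others-∷ indices }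
      where
      open State st
      others-∷ : others (j ∷ rest) ≡ others rest
      others-∷ rewrite Cj = refl

    -- The exponents count signs modulo 2. A step after an element of `C` costs none, so `after-S`
    -- starts one higher; passing over an index in `C` lowers the exponent by two.
    after-C : ∀ {p₁ q ε es vs j rest} → State q ε es vs (j ∷ rest) → C p₁ ≡ true → p₁ ∈ vs →
      prev1 k p₁ ≡ q → Chain (Link C) p₁ (j ∷ rest) c₀ → Spanned C (ε · parity (length (j ∷ rest)))
    after-S : ∀ {p₂ q ε es vs j rest} → State q ε es vs (j ∷ rest) → C q ≡ false → p₂ ∈ vs →
      prev1 k q ≡ p₂ → Chain (Link C) q (j ∷ rest) c₀ → Spanned C (ε · parity (suc (length (j ∷ rest))))

    after-C {q = q} {ε} st Cp₁ p₁∈ pq ((pj , h) ∷ [ pc , _ ]) =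
      subst (Spanned C) (*-comm minus ε) (finish {ε′ = plus} (step-after-C p₁∈ pj pq) ↭-refl refl pc refl)
      where open Step st (∧≡false⇒ʳ h Cp₁)
    after-C {p₁} {q = q} {ε} st Cp₁ p₁∈ pq ((pj , h) ∷ ch@(_ ∷ _)) =
      let m , Cs₀ = last-link ((pj , h) ∷ ch) in
      after-S (advance {ε′ = plus} (step-after-C p₁∈ pj pq) ↭-refl refl (j≢s₀ (proj₁ (last-link ch)) Cs₀))
        (∧≡false⇒ʳ h Cp₁) (there (there p₁∈)) pj ch
      where open Step st (∧≡false⇒ʳ h Cp₁)

    after-S {q = q} {ε} {j = j} st Cq p₂∈ pq ((pj , h) ∷ ch) with C j in Cj
    after-S {q = q} {ε} {j = j} st Cq p₂∈ pq ((pj , h) ∷ [ pc , h′ ]) | true =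
      contradiction (trans (sym Cj) (∧≡false⇒ˡ h′ Cc₀)) λ ()
    -- An index in `C` adds no triple here. Its predecessor `q` stays pending and lies two places
    -- before the next index, as `after-C` requires.
    after-S {q = q} {ε} {j = j} st Cq p₂∈ pq ((pj , h) ∷ ch@(_ ∷ _)) | true =
      after-C (skip Cj st) Cj (State.reached st (∈-++⁺ˡ (pairs-∈⁺ cs (cs⁺ (State.remaining st (here refl)) Cj) (inj₁ refl)))) pj ch
    after-S {q = q} {ε} st Cq p₂∈ pq ((pj , h) ∷ [ pc , _ ]) | false =
      subst (Spanned C) (opp ε) (finish {ε′ = minus} (step-after-S p₂∈ pj pq) (Perm.swap _ _ ↭-refl) sg-after-S pc refl)
      where
      open Step st Cj
      opp : ∀ s → opposite (minus · s) ≡ s · plus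
      opp plus = refl
      opp minus = refl
    after-S {q = q} {ε} {rest = rest} st Cq p₂∈ pq ((pj , h) ∷ ch@(_ ∷ _)) | false =
      subst (Spanned C) (shuffle ε (length rest))
        (after-S (advance {ε′ = minus} (step-after-S p₂∈ pj pq) (Perm.swap _ _ ↭-refl) sg-after-S
                   (j≢s₀ (proj₁ (last-link ch)) (proj₂ (last-link ch))))
          Cj (here refl) pj ch)
      where
      open Step st Cj
      shuffle : ∀ s n → opposite s · parity (suc n) ≡ s · parity n
      shuffle s n = trans (cong (opposite s ·_) (parity-suc n)) (lem s (parity n))
        where
        lem : ∀ s t → opposite s · opposite t ≡ s · t
        lem plus t = opposite-involutive t
        lem minus t = refl

    traverse : ∀ {l} → Chain (Link C) c₀ l c₀ → c₀ ∷ l ↭ range k → Spanned C (parity (length l))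
    traverse [ pc , _ ] _ = contradiction pc (prev1-≢ 2≤k c₀∈)
    traverse {l} ch@(_ ∷ _) p =
      after-C initial Cc₀ (∈-++⁺ˡ (pairs-∈⁺ cs (cs⁺ c₀∈ Cc₀) (inj₁ refl))) refl ch
      where
      Cs₀ : C s₀ ≡ false
      Cs₀ = proj₂ (last-link ch)
      spoke = spokes cs (Unique.filter⁺ (T? ∘ C) (range-unique k)) (proj₁ ∘ cs⁻)
      others-∷ : others (c₀ ∷ l) ≡ others l
      others-∷ rewrite Cc₀ = refl
      s₀∈ : s₀ ∈[1, k ]
      s₀∈ = prev1-∈ 2≤k c₀∈
      initial : State s₀ plus (proj₁ spoke) vs₀ l
      initial = record
        { ds = []
        ; grown = proj₁ (proj₂ spoke)
        ; edges = ↭-reflexive (trans (proj₂ (proj₂ spoke)) (map-pick-true cs (proj₂ ∘ cs⁻)))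
        ; verts = ↭-refl
        ; sign = refl
        ; pending = ∉-spokes {cs} (λ c∈ → (λ { refl → contradiction (trans (sym Cs₀) (proj₂ (cs⁻ c∈))) λ () }) ,
                                     label≢ s₀∈ (proj₁ (cs⁻ c∈))) (∈[1,k]-≢0 s₀∈)
        ; reached = id
        ; remaining = λ m → range⁻ (∈-resp-↭ p (there m))
        ; indices = ↭-trans (++⁺ʳ cs (↭-trans (↭-reflexive (sym others-∷)) (filter-↭ (T? ∘ not ∘ C) p)))
                      (partition-↭ C (range k)) }

  -- The traversal has to start at an element of `C`, so the cycle of indices is rotated to `c₀`;
  -- the k - 1 other indices give the exponent.
  cyclic-spanned : ∀ C {x l c₀} → range k ≡ x ∷ l → Chain (Link C) x l x → c₀ ∈[1, k ] → C c₀ ≡ true →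
    Spanned C (opposite (parity k))
  cyclic-spanned C {x} {l} {c₀} eq ch c₀∈ Cc₀ with rotate-to (subst (c₀ ∈_) eq (range⁺ c₀∈)) ch _
    where open Rotation {R = Link C} (λ _ _ → ⊤) (λ _ _ _ _ → tt)
  ... | l′ , ch′ , _ , p = subst (Spanned C) sgn-k (Traversal.traverse C c₀ c₀∈ Cc₀ ch′ p′)
    where
    p′ : c₀ ∷ l′ ↭ range k
    p′ = ↭-trans (↭-sym p) (↭-reflexive (sym eq))
    sgn-k : parity (length l′) ≡ opposite (parity k)
    sgn-k = trans (sym (trans (cong opposite (parity-suc (length l′))) (opposite-involutive _)))
      (cong (opposite ∘ parity) (trans (↭-length p′) (trans (length-map {A = ℕ} {B = ℕ} suc (upTo k)) (length-upTo k))))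

-- Index sets of spanning trees

_≟ₜ_ : DecidableEquality Triple
_≟ₜ_ = ≡-dec _≟_ (≡-dec _≟_ _≟_)

open import Data.List.Membership.DecPropositional _≟ₜ_ using () renaming (_∈?_ to _∈ₜₛ?_)

unique-⊆⇒⊇ : {xs ys : List Triple} → Unique xs → (∀ {x} → x ∈ xs → x ∈ ys) →
  length ys ≤ length xs → ∀ {y} → y ∈ ys → y ∈ xs
unique-⊆⇒⊇ {xs} u sub len {y} y∈ with y ∈ₜₛ? xs
... | yes m = m
... | no y∉ = contradiction
  (unique-⊆⇒length≤ (All≢ y∉ ∷ u) λ { (here refl) → y∈ ; (there m) → sub m }) (ℕ.≤⇒≯ len)

Chain-upTo : {A : Set} {R : A → A → Set} (g : ℕ → A) → ∀ n {z} →
  (∀ {j} → j < n → R (g j) (g (suc j))) → R (g n) z → Chain R (g 0) (applyUpTo (g ∘ suc) n) z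
Chain-upTo g zero h r = [ r ]
Chain-upTo g (suc n) h r = h (s≤s z≤n) ∷ Chain-upTo (g ∘ suc) n (h ∘ s≤s) r

module WheelSigns (k : ℕ) (2≤k : 2 ≤ k) where
  open Wheel k 2≤k
  open WheelTrees k 2≤k
  open Signs f
  open Growth H using (Grown)

  tail : List ℕ
  tail = applyUpTo (λ j → suc (suc j)) (k ∸ 1)

  range-∷ : range k ≡ 1 ∷ tail
  range-∷ = trans (map-upTo suc k) (lem k 2≤k)
    where
    lem : ∀ k → 2 ≤ k → applyUpTo suc k ≡ 1 ∷ applyUpTo (λ j → suc (suc j)) (k ∸ 1)
    lem (suc k) _ = refl

  range-chain : {R : ℕ → ℕ → Set} → (∀ {i} → i ∈[1, k ] → R (prev1 k i) i) → Chain R 1 tail 1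
  range-chain {R} h = Chain-upTo suc (k ∸ 1) (λ {j} j< → h (s≤s z≤n , ℕ.<-≤-trans (s≤s j<) (ℕ.≤-reflexive k≡)))
    (subst (λ i → R i 1) (sym k≡) (h (s≤s z≤n , ℕ.≤-trans (s≤s z≤n) 2≤k)))
    where
    k≡ : suc (k ∸ 1) ≡ k
    k≡ = ℕ.m+[n∸m]≡n (ℕ.≤-trans (s≤s z≤n) 2≤k)

  -- The index is the sign of the tree of C relative to the tree of {1, …, k}.
  data Valid (C : ℕ → Bool) : Sign → Set where
    full : (∀ {i} → i ∈[1, k ] → C i ≡ true) → Valid C plus
    cyclic : ∀ {c₀} → Chain (Link C) 1 tail 1 → c₀ ∈[1, k ] → C c₀ ≡ true → Valid C (opposite (parity k))

  valid⇒spanned : ∀ {C s} → Valid C s → Spanned C s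
  valid⇒spanned (full all) = full-spanned _ all
  valid⇒spanned (cyclic ch c₀∈ Cc₀) = cyclic-spanned _ range-∷ ch c₀∈ Cc₀

  ∏ω : (ℕ → Bool) → (Triple → Bool) → Sign
  ∏ω C Ω = ∏ (map (χ ∘ Ω ∘ pick C) (range k))

  module _ {C : ℕ → Bool} {s : Sign} (sp : Spanned C s) where
    private
      es = proj₁ sp
      vs = proj₁ (proj₂ sp)
      g = proj₁ (proj₂ (proj₂ sp))
      es↭ = proj₁ (proj₂ (proj₂ (proj₂ sp)))
      vs↭ = proj₁ (proj₂ (proj₂ (proj₂ (proj₂ sp))))
      sg-vs = proj₂ (proj₂ (proj₂ (proj₂ (proj₂ sp))))

      es⊆ : ∀ {e} → e ∈ es → e ∈ₛ treeOf C
      es⊆ e∈ with ∈-map⁻ (pick C) (∈-resp-↭ es↭ (∈-map⁺ (tri H) e∈))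
      ... | i , i∈ , eq = treeOf⁺ (range⁻ i∈) eq

      ⊆es : ∀ {e} → e ∈ₛ treeOf C → e ∈ es
      ⊆es e∈ with treeOf⁻ e∈
      ... | i , i∈ , eq with ∈-map⁻ (tri H) (∈-resp-↭ (↭-sym es↭) (∈-map⁺ (pick C) (range⁺ i∈)))
      ... | e′ , e′∈ , eq′ = subst (_∈ es) (tri-injective (trans (sym eq′) (sym eq))) e′∈

      V↭ : V H ↭ vs
      V↭ = ↭-trans (↭-reflexive vertices) (↭-trans (++-comm (0 ∷ []) (pairs k (range k))) (↭-sym vs↭))

    spanned⇒tree : IsSpanningTree H (treeOf C)
    spanned⇒tree = Cycles.grown⇒spanningTree H (λ _ → true) 0 g
      (ℕ.≤-trans large (ℕ.≤-reflexive (↭-length V↭))) es⊆ ⊆es (∈-resp-↭ V↭)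

    -- The sign splits into a factor for the orientation, a product over indices, and a factor for
    -- the shape of the tree in the stored orientation.
    spanned⇒sgn : ∀ {ω} Ω → (∀ e → ω e ≡ Ω (tri H e)) → sgn H (treeOf C) ω ≡ ∏ω C Ω · (s · reference)
    spanned⇒sgn {ω} Ω ω≡Ω with reorient H 0 f ω g (λ x∈ y∈ → pos-injective (V H) (in-V x∈) (in-V y∈))
      where
      in-V : ∀ {x} → x ∈ vs → x ∈ V H
      in-V = ∈-resp-↭ (↭-sym V↭)
    ... | vs′ , g′ , p , eq = begin
      sgn H (treeOf C) ω
        ≡⟨ Growth.sgn-grown H ω 0 (WellFormed.vertices-unique wellFormed) g′
             (∈-resp-↭ (↭-trans p (↭-sym V↭))) (∈-resp-↭ (↭-trans V↭ (↭-sym p))) es⊆ ⊆es ⟩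
      sg vs′
        ≡⟨ eq ⟩
      ∏ (map (χ ∘ ω) es) · sg vs
        ≡⟨ cong₂ _·_ weights sg-vs ⟩
      ∏ω C Ω · (s · reference) ∎
      where
      open ≡-Reasoning
      weights : ∏ (map (χ ∘ ω) es) ≡ ∏ω C Ω
      weights = begin
        ∏ (map (χ ∘ ω) es)                      ≡⟨ cong ∏ (map-cong (λ e → cong χ (ω≡Ω e)) es) ⟩
        ∏ (map (χ ∘ Ω ∘ tri H) es)              ≡⟨ cong ∏ (map-∘ es) ⟩
        ∏ (map (χ ∘ Ω) (map (tri H) es))        ≡⟨ ∏-↭ (Perm.map⁺ (χ ∘ Ω) es↭) ⟩
        ∏ (map (χ ∘ Ω) (map (pick C) (range k))) ≡⟨ cong ∏ (map-∘ (range k)) ⟨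
        ∏ω C Ω                                  ∎

  -- An orientation is given on positions in the list of triples. As a function on triples it can be
  -- evaluated along `pick C`; the triples being distinct, nothing is lost.
  onTriples : Orientation H → Triple → Bool
  onTriples ω t = does (any? λ e → (tri H e ≟ₜ t) ×-dec (ω e ≟ᵇ true))

  onTriples-tri : ∀ ω e → ω e ≡ onTriples ω (tri H e)
  onTriples-tri ω e with any? (λ e′ → (tri H e′ ≟ₜ tri H e) ×-dec (ω e′ ≟ᵇ true))
  ... | yes (e′ , eq , ωe′) = trans (cong ω (sym (tri-injective eq))) ωe′
  ... | no none with ω e in ωe
  ... | true = contradiction (e , refl , ωe) none
  ... | false = refl

  module Classify {T : Subset (#E H)} (st : IsSpanningTree H T) where
    open IsSpanningTree st

    C-dec : ∀ i → Dec (∃ λ e → e ∈ₛ T × tri H e ≡ A i)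
    C-dec i = any? λ e → (e ∈ₛ? T) ×-dec (tri H e ≟ₜ A i)

    C : ℕ → Bool
    C i = does (C-dec i)

    C⁻ : ∀ {i} → C i ≡ true → ∃ λ e → e ∈ₛ T × tri H e ≡ A i
    C⁻ {i} eq with C-dec i
    ... | yes p = p

    C⁺ : ∀ {i e} → e ∈ₛ T → tri H e ≡ A i → C i ≡ true
    C⁺ {i} e∈ eq = dec-true (C-dec i) (_ , e∈ , eq)

    primed : ∀ {i j} → (k + i) ∈ₜ A j ⊎ (k + i) ∈ₜ B j → i ∈[1, k ] → j ∈[1, k ] → i ≡ j
    primed (inj₁ (inj₁ eq)) i∈ j∈ = contradiction eq (k+≢0 i∈)
    primed (inj₁ (inj₂ (inj₁ eq))) i∈ j∈ = contradiction (sym eq) (label≢ j∈ i∈)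
    primed (inj₁ (inj₂ (inj₂ eq))) i∈ j∈ = ℕ.+-cancelˡ-≡ k _ _ eq
    primed (inj₂ (inj₁ eq)) i∈ j∈ = contradiction (sym eq) (label≢ (prev2-∈ j∈) i∈)
    primed (inj₂ (inj₂ (inj₁ eq))) i∈ j∈ = contradiction (sym eq) (label≢ (prev1-∈ 2≤k j∈) i∈)
    primed (inj₂ (inj₂ (inj₂ eq))) i∈ j∈ = ℕ.+-cancelˡ-≡ k _ _ eq

    picked : ∀ {i} → i ∈[1, k ] → ∃ λ e → e ∈ₛ T × tri H e ≡ pick C i
    picked {i} i∈ with C i in Ci
    ... | true = C⁻ Ci
    ... | false with covering (k + i) (vert′ i∈)
    ... | e , e∈ , m with edge e
    ... | j , j∈ , inj₁ eq with refl ← primed (inj₁ (subst ((k + i) ∈ₜ_) eq m)) i∈ j∈ =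
      contradiction (trans (sym Ci) (C⁺ e∈ eq)) λ ()
    ... | j , j∈ , inj₂ eq with refl ← primed (inj₂ (subst ((k + i) ∈ₜ_) eq m)) i∈ j∈ = e , e∈ , eq

    treeOf⊆ : ∀ {e} → e ∈ₛ treeOf C → e ∈ₛ T
    treeOf⊆ e∈ with treeOf⁻ e∈
    ... | i , i∈ , eq with picked i∈
    ... | e′ , e′∈ , eq′ = subst (_∈ₛ T) (tri-injective (trans eq′ (sym eq))) e′∈

    -- Growth over 2k + 1 vertices takes k triples, and the k distinct picked triples are among
    -- them, so there are no others.
    ⊆treeOf : ∀ {e} → e ∈ₛ T → e ∈ₛ treeOf C
    ⊆treeOf {e} e∈ with Cycles.spanningTree⇒grown H (λ _ → true) 0 (WellFormed.distinct wellFormed)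
                          (λ {e} → WellFormed.incident wellFormed {e}) (here refl) st
    ... | es , vs , g , es⊆ , ⊆es , vs⊆ , ⊆vs
      with ∈-map⁻ (pick C) (unique-⊆⇒⊇ ts-unique ts⊆ len (∈-map⁺ (tri H) (⊆es e∈)))
      where
      ts : List Triple
      ts = map (pick C) (range k)
      pick-prime : ∀ i → proj₂ (proj₂ (pick C i)) ≡ k + i
      pick-prime i with C i
      ... | true = refl
      ... | false = refl
      ts-unique : Unique ts
      ts-unique = Unique.map⁺ (λ {i} {j} eq → ℕ.+-cancelˡ-≡ k _ _
        (trans (sym (pick-prime i)) (trans (cong (proj₂ ∘ proj₂) eq) (pick-prime j)))) (range-unique k)
      ts⊆ : ∀ {t} → t ∈ ts → t ∈ map (tri H) es
      ts⊆ t∈ with ∈-map⁻ (pick C) t∈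
      ... | i , i∈ , refl with picked (range⁻ i∈)
      ... | e , e∈T , eq = subst (_∈ map (tri H) es) eq (∈-map⁺ (tri H) (⊆es e∈T))
      pairs-length : ∀ is → length (pairs k is) ≡ length is + length is
      pairs-length [] = refl
      pairs-length (i ∷ is) = cong suc (trans (cong suc (pairs-length is)) (sym (ℕ.+-suc (length is) (length is))))
      double-injective : ∀ m n → m + m ≡ n + n → m ≡ n
      double-injective zero zero _ = refl
      double-injective (suc m) (suc n) eq = cong suc (double-injective m n (ℕ.suc-injective
        (trans (sym (ℕ.+-suc m m)) (trans (ℕ.suc-injective eq) (ℕ.+-suc n n)))))
      es-length : length es ≡ length (range k)
      es-length = double-injective _ _ (ℕ.suc-injective (trans (sym (Growth.grown-length H (λ _ → true) 0 g))
        (trans (↭-length (unique-set⇒↭ (Growth.grown-unique H (λ _ → true) 0 g) (WellFormed.vertices-unique wellFormed) vs⊆ ⊆vs))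
          (trans (cong length vertices) (cong suc (pairs-length (range k)))))))
      len : length (map (tri H) es) ≤ length ts
      len = ℕ.≤-reflexive (trans (length-map (tri H) es) (trans es-length (sym (length-map (pick C) (range k)))))
    ... | i , i∈ , eq = treeOf⁺ (range⁻ i∈) eq

    tree≡ : T ≡ treeOf C
    tree≡ = ⊆-antisym ⊆treeOf treeOf⊆

    nonempty : ∃ λ i → i ∈[1, k ] × C i ≡ true
    nonempty with covering 0 (here refl)
    ... | e , e∈ , m with edge e
    ... | i , i∈ , inj₁ eq = i , i∈ , C⁺ e∈ eq
    ... | i , i∈ , inj₂ eq with subst (0 ∈ₜ_) eq m
    ... | inj₁ 0≡ = contradiction (sym 0≡) (∈[1,k]-≢0 (prev2-∈ i∈))
    ... | inj₂ (inj₁ 0≡) = contradiction (sym 0≡) (∈[1,k]-≢0 (prev1-∈ 2≤k i∈))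
    ... | inj₂ (inj₂ 0≡) = contradiction (sym 0≡) (k+≢0 i∈)

    -- Otherwise A x, B z, A y form a cycle through 0, x, y, where x, y, z are consecutive.
    next-true : ∀ {z} → z ∈[1, k ] → C (prev1 k z) ≡ true → C (prev1 k (prev1 k z)) ≡ true → C z ≡ true
    next-true {z} z∈ Cy Cx = ¬-not λ Cz → acyclic (cycle Cz)
      where
      y x : ℕ
      y = prev1 k z
      x = prev1 k y
      y∈ : y ∈[1, k ]
      y∈ = prev1-∈ 2≤k z∈
      x∈ : x ∈[1, k ]
      x∈ = prev1-∈ 2≤k y∈
      cycle : C z ≡ false → HasCycle H T
      cycle Cz with C⁻ Cx | C⁻ Cy | picked z∈
      ... | ex , ex∈ , eqx | ey , ey∈ , eqy | ez , ez∈ , eqz =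
        Cycles.closedWalk⇒cycle H
          (via (subst (0 ∈ₜ_) (sym eqx) (inj₁ refl)) (subst (x ∈ₜ_) (sym eqx) (inj₂ (inj₁ refl)))
          (via (subst (x ∈ₜ_) (sym eqz′) (inj₁ (sym (prev2-prev1 2≤k z∈)))) (subst (y ∈ₜ_) (sym eqz′) (inj₂ (inj₁ refl)))
          (via (subst (y ∈ₜ_) (sym eqy) (inj₂ (inj₁ refl))) (subst (0 ∈ₜ_) (sym eqy) (inj₁ refl)) done)))
          (((λ eq → ∈[1,k]-≢0 x∈ (sym eq)) ∷ (λ eq → ∈[1,k]-≢0 y∈ (sym eq)) ∷ []) ∷ (x≢y ∷ []) ∷ [] ∷ [])
          (((λ { refl → A≢B z∈ (trans (sym eqx) eqz′) }) ∷ (λ { refl → x≢y (A-injective (trans (sym eqx) eqy)) }) ∷ []) ∷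
           ((λ { refl → A≢B z∈ (trans (sym eqy) eqz′) }) ∷ []) ∷ [] ∷ [])
          (s≤s (s≤s z≤n))
          (λ { (here refl) → ex∈ ; (there (here refl)) → ez∈ ; (there (there (here refl))) → ey∈ })
        where
        open Cycles H using (via; done)
        eqz′ : tri H ez ≡ B z
        eqz′ = trans eqz (cong (λ b → if b then A z else B z) Cz)
        x≢y : x ≢ y
        x≢y = prev1-≢ 2≤k y∈

    Prev : ℕ → ℕ → Set
    Prev x y = prev1 k y ≡ x

    -- From two consecutive elements of `C`, membership spreads around the whole cycle by
    -- `next-true`.
    propagate : ∀ {y l z} → Chain Prev y l z → (∀ {x} → x ∈ l → x ∈[1, k ]) → C y ≡ true → C (prev1 k y) ≡ true →
      ∀ {x} → x ∈ l → C x ≡ true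
    propagate (_∷_ {z = z} refl ch) h Cy Cx x∈ = go x∈
      where
      Cz : C z ≡ true
      Cz = next-true (h (here refl)) Cy Cx
      go : ∀ {x} → x ∈ _ → C x ≡ true
      go (here refl) = Cz
      go (there m) = propagate ch (h ∘ there) Cz Cy m

    valid : ∃ (Valid C)
    valid with All.all? (λ i → (C (prev1 k i) ∧ C i) ≟ᵇ false) (range k)
    ... | yes all = _ , cyclic (range-chain λ i∈ → refl , All.lookup all (range⁺ i∈)) (proj₁ (proj₂ nonempty)) (proj₂ (proj₂ nonempty))
    ... | no ¬all with find (All.¬All⇒Any¬ (λ i → (C (prev1 k i) ∧ C i) ≟ᵇ false) (range k) ¬all)
    ... | i , i∈ , adjacent with rotate-to (subst (i ∈_) range-∷ i∈) (range-chain {Prev} λ _ → refl) _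
      where open Rotation {R = Prev} (λ _ _ → ⊤) (λ _ _ _ _ → tt)
    ... | l , ch , _ , p = plus , full all
      where
      both : C (prev1 k i) ≡ true × C i ≡ true
      both with C (prev1 k i) | C i
      ... | true | true = refl , refl
      ... | true | false = contradiction refl adjacent
      ... | false | _ = contradiction refl adjacent
      p′ : i ∷ l ↭ range k
      p′ = ↭-trans (↭-sym p) (↭-reflexive (sym range-∷))
      all : ∀ {x} → x ∈[1, k ] → C x ≡ true
      all x∈ with ∈-resp-↭ (↭-sym p′) (range⁺ x∈)
      ... | here refl = proj₂ both
      ... | there m = propagate ch (λ m → range⁻ (∈-resp-↭ p′ (there m))) (proj₂ both) (proj₁ both) m

  classify : ∀ {T} → IsSpanningTree H T → ∃₂ λ C s → T ≡ treeOf C × Valid C s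
  classify st = Classify.C st , proj₁ (Classify.valid st) , Classify.tree≡ st , proj₂ (Classify.valid st)

  sgn-treeOf : ∀ {C s ω} → Valid C s → ∀ Ω → (∀ e → ω e ≡ Ω (tri H e)) → sgn H (treeOf C) ω ≡ ∏ω C Ω · (s · reference)
  sgn-treeOf {C} {s} v = spanned⇒sgn {C} {s} (valid⇒spanned v)

-- Counting the spanning trees

NotBoth : Bool → Bool → Set
NotBoth x y = x ∧ y ≡ false

-- Words w of length n such that a w b has no two adjacent letters true; unless seen is true,
-- w must contain the letter true.
words : (seen a b : Bool) → ℕ → List (List Bool)
words seen a b zero = if seen ∧ not (a ∧ b) then [] ∷ [] else []
words seen a b (suc n) =
  map (false ∷_) (words seen false b n) ++ (if a then [] else map (true ∷_) (words true true b n))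

words⁻ : ∀ {seen a b} n {w} → w ∈ words seen a b n →
  length w ≡ n × Chain NotBoth a w b × (seen ≡ true ⊎ true ∈ w)
words⁻ {true} {true} {false} zero (here refl) = refl , [ refl ] , inj₁ refl
words⁻ {true} {false} zero (here refl) = refl , [ refl ] , inj₁ refl
words⁻ {seen} {a} {b} (suc n) w∈ with ∈-++⁻ (map (false ∷_) (words seen false b n)) w∈
... | inj₁ m with ∈-map⁻ (false ∷_) m
... | w , w∈ , refl with words⁻ n w∈
... | len , ch , inj₁ eq = cong suc len , ∧-zeroʳ a ∷ ch , inj₁ eq
... | len , ch , inj₂ t∈ = cong suc len , ∧-zeroʳ a ∷ ch , inj₂ (there t∈)
words⁻ {seen} {false} {b} (suc n) w∈ | inj₂ m with ∈-map⁻ (true ∷_) m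
... | w , w∈ , refl with words⁻ n w∈
... | len , ch , _ = cong suc len , refl ∷ ch , inj₂ (here refl)

words⁺ : ∀ {seen a b w} → Chain NotBoth a w b → seen ≡ true ⊎ true ∈ w → w ∈ words seen a b (length w)
words⁺ {a = true} [ refl ] (inj₁ refl) = here refl
words⁺ {a = false} [ refl ] (inj₁ refl) = here refl
words⁺ {seen} {a} {b} {false ∷ w} (r ∷ ch) h = ∈-++⁺ˡ (∈-map⁺ (false ∷_) (words⁺ ch (later h)))
  where
  later : seen ≡ true ⊎ true ∈ false ∷ w → seen ≡ true ⊎ true ∈ w
  later (inj₁ eq) = inj₁ eq
  later (inj₂ (there m)) = inj₂ m
words⁺ {seen} {false} {b} {true ∷ w} (r ∷ ch) h =
  ∈-++⁺ʳ (map (false ∷_) (words seen false b (length w))) (∈-map⁺ (true ∷_) (words⁺ ch (inj₁ refl)))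

false∷-true∷-unique : ∀ {vs ws} → Unique vs → Unique ws → Unique (map (false ∷_) vs ++ map (true ∷_) ws)
false∷-true∷-unique uv uw = Unique.++⁺ (Unique.map⁺ ∷-injectiveʳ uv) (Unique.map⁺ ∷-injectiveʳ uw) disjoint
  where
  disjoint : ∀ {w} → ¬ (w ∈ map (false ∷_) _ × w ∈ map (true ∷_) _)
  disjoint (m₁ , m₂) with ∈-map⁻ (false ∷_) m₁ | ∈-map⁻ (true ∷_) m₂
  ... | _ , _ , refl | _ , _ , ()

words-unique : ∀ seen a b n → Unique (words seen a b n)
words-unique seen a b zero with seen ∧ not (a ∧ b)
... | true = [] ∷ []
... | false = []
words-unique seen true b (suc n) = false∷-true∷-unique {ws = []} (words-unique seen false b n) []
words-unique seen false b (suc n) = false∷-true∷-unique (words-unique seen false b n) (words-unique true true b n)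

-- In a cyclic word the first letter is the neighbour of the remaining word on both sides, which
-- fixes `a` and `b`. If it is true, nothing remains to be seen.
treeWords : ℕ → List (List Bool)
treeWords zero = []
treeWords (suc n) =
  replicate (suc n) true ∷ map (false ∷_) (words false false false n) ++ map (true ∷_) (words true true true n)

data TreeWord : List Bool → Set where
  full : ∀ n → TreeWord (replicate n true)
  cyclic : ∀ {x w} → Chain NotBoth x w x → true ∈ x ∷ w → TreeWord (x ∷ w)

treeWords⁻ : ∀ k {w} → w ∈ treeWords k → length w ≡ k × TreeWord w
treeWords⁻ (suc n) (here refl) = length-replicate (suc n) , full (suc n)
treeWords⁻ (suc n) (there m) with ∈-++⁻ (map (false ∷_) (words false false false n)) m
... | inj₁ m′ with ∈-map⁻ (false ∷_) m′
... | w , w∈ , refl with words⁻ n w∈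
... | len , ch , inj₂ t∈ = cong suc len , cyclic ch (there t∈)
treeWords⁻ (suc n) (there m) | inj₂ m′ with ∈-map⁻ (true ∷_) m′
... | w , w∈ , refl with words⁻ n w∈
... | len , ch , _ = cong suc len , cyclic ch (here refl)

treeWords⁺ : ∀ {w} → 1 ≤ length w → TreeWord w → w ∈ treeWords (length w)
treeWords⁺ _ (full (suc n)) = here (cong (λ m → replicate (suc m) true) (sym (length-replicate n)))
treeWords⁺ _ (cyclic {false} ch (there t∈)) = there (∈-++⁺ˡ (∈-map⁺ (false ∷_) (words⁺ ch (inj₂ t∈))))
treeWords⁺ _ (cyclic {true} {w} ch _) =
  there (∈-++⁺ʳ (map (false ∷_) (words false false false (length w))) (∈-map⁺ (true ∷_) (words⁺ ch (inj₁ refl))))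

treeWords-unique : ∀ {k} → 2 ≤ k → Unique (treeWords k)
treeWords-unique {suc (suc n)} _ =
  All≢ all-true∉ ∷ false∷-true∷-unique (words-unique false false false (suc n)) (words-unique true true true (suc n))
  where
  all-true∉ : replicate (suc (suc n)) true ∉ map (false ∷_) (words false false false (suc n)) ++ map (true ∷_) (words true true true (suc n))
  all-true∉ m with ∈-++⁻ (map (false ∷_) (words false false false (suc n))) m
  ... | inj₁ m′ with () ← proj₂ (proj₂ (∈-map⁻ (false ∷_) m′))
  ... | inj₂ m′ with ∈-map⁻ (true ∷_) m′
  ... | _ , w∈ , refl with words⁻ {true} {true} {true} (suc n) w∈
  ... | _ , () ∷ _ , _
treeWords-unique {suc zero} (s≤s ())

-- Leaving out the all-false word puts an additional 1 into the recursion for `F₁` and `F₀`, and the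
-- all-true word absorbs it. The total is the number of all subsets of a cycle without adjacent
-- elements, the empty one included.
treeWords-length : ∀ n → length (treeWords (suc n)) ≡ L (suc n)
treeWords-length n = trans (cong suc (trans (length-++ (map (false ∷_) (words false false false n)))
    (cong₂ _+_ (length-map (false ∷_) (words false false false n)) (length-map (true ∷_) (words true true true n))))) (go n)
  where
  # : Bool → Bool → Bool → ℕ → ℕ
  # seen a b n = length (words seen a b n)
  #-true : ∀ seen b n → # seen true b (suc n) ≡ # seen false b n
  #-true seen b n = trans (length-++ (map (false ∷_) (words seen false b n)))
    (trans (ℕ.+-identityʳ _) (length-map (false ∷_) (words seen false b n)))
  #-false : ∀ seen b n → # seen false b (suc n) ≡ # seen false b n + # true true b n
  #-false seen b n = trans (length-++ (map (false ∷_) (words seen false b n)))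
    (cong₂ _+_ (length-map (false ∷_) (words seen false b n)) (length-map (true ∷_) (words true true b n)))
  #-seen : ∀ n → # true false false n ≡ suc (# false false false n)
  #-seen zero = refl
  #-seen (suc n) = trans (#-false true false n) (trans (cong (_+ # true true false n) (#-seen n)) (cong suc (sym (#-false false false n))))
  go : ∀ n → suc (# false false false n + # true true true n) ≡ L (suc n)
  go zero = refl
  go (suc zero) = refl
  go (suc (suc n)) = begin
    suc (# false false false (suc (suc n)) + # true true true (suc (suc n)))
      ≡⟨ cong suc (cong₂ _+_ (trans (#-false false false (suc n)) (cong (F₁ +_) (trans (#-true true false n) (#-seen n))))
                             (trans (#-true true true (suc n)) (#-false true true n))) ⟩
    suc ((F₁ + suc F₀) + (# true false true n + H₀))
      ≡⟨ cong (λ h → suc ((F₁ + suc F₀) + (h + H₀))) (#-true true true n) ⟨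
    suc ((F₁ + suc F₀) + (H₁ + H₀))
      ≡⟨ solve 4 (λ a b c d → con 1 :+ ((a :+ (con 1 :+ b)) :+ (c :+ d)) := (con 1 :+ (a :+ c)) :+ (con 1 :+ (b :+ d))) refl F₁ F₀ H₁ H₀ ⟩
    suc (F₁ + H₁) + suc (F₀ + H₀)
      ≡⟨ cong₂ _+_ (go (suc n)) (go n) ⟩
    L (suc (suc (suc n))) ∎
    where
    open ≡-Reasoning
    open +-*-Solver
    F₀ = # false false false n
    F₁ = # false false false (suc n)
    H₀ = # true true true n
    H₁ = # true true true (suc n)

-- From words to spanning trees

Unique-map-∈ : ∀ {A B : Set} {f : A → B} {xs} → (∀ {x y} → x ∈ xs → y ∈ xs → f x ≡ f y → x ≡ y) →
  Unique xs → Unique (map f xs)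
Unique-map-∈ inj [] = []
Unique-map-∈ {f = f} inj (x∉ ∷ u) =
  All≢ (λ m → let y , y∈ , eq = ∈-map⁻ f m in All.lookup x∉ y∈ (inj (here refl) (there y∈) eq)) ∷
  Unique-map-∈ (λ x∈ y∈ → inj (there x∈) (there y∈)) u

Chain-map : ∀ {A B : Set} {R : A → A → Set} {S : B → B → Set} {f : A → B} → (∀ {x y} → R x y → S (f x) (f y)) →
  ∀ {x l y} → Chain R x l y → Chain S (f x) (map f l) (f y)
Chain-map h [ r ] = [ h r ]
Chain-map h (r ∷ ch) = h r ∷ Chain-map h ch

Chain-zip : ∀ {A B : Set} {R : A → A → Set} {S : B → B → Set} {f : A → B} {x l y} →
  Chain R x l y → Chain S (f x) (map f l) (f y) → Chain (λ a b → R a b × S (f a) (f b)) x l y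
Chain-zip [ r ] [ s ] = [ r , s ]
Chain-zip (r ∷ c) (s ∷ d) = (r , s) ∷ Chain-zip c d

letter : List Bool → ℕ → Bool
letter [] n = false
letter (x ∷ w) zero = x
letter (x ∷ w) (suc n) = letter w n

applyUpTo-letter : ∀ w → applyUpTo (letter w) (length w) ≡ w
applyUpTo-letter [] = refl
applyUpTo-letter (x ∷ w) = cong (x ∷_) (applyUpTo-letter w)

map-≡⇒pointwise : ∀ {A B : Set} {f g : A → B} {xs x} → map f xs ≡ map g xs → x ∈ xs → f x ≡ g x
map-≡⇒pointwise eq (here refl) = ∷-injectiveˡ eq
map-≡⇒pointwise {xs = _ ∷ _} eq (there m) = map-≡⇒pointwise (∷-injectiveʳ eq) m

pointwise⇒map-≡ : ∀ {A B : Set} {f g : A → B} xs → (∀ {x} → x ∈ xs → f x ≡ g x) → map f xs ≡ map g xs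
pointwise⇒map-≡ [] h = refl
pointwise⇒map-≡ (x ∷ xs) h = cong₂ _∷_ (h (here refl)) (pointwise⇒map-≡ xs (h ∘ there))

map-replicate : ∀ {A : Set} {f : A → Bool} xs {n} → map f xs ≡ replicate n true → ∀ {x} → x ∈ xs → f x ≡ true
map-replicate (x ∷ xs) {suc n} eq (here refl) = ∷-injectiveˡ eq
map-replicate (x ∷ xs) {suc n} eq (there m) = map-replicate xs (∷-injectiveʳ eq) m

module WheelCount (k : ℕ) (2≤k : 2 ≤ k) where
  open Wheel k 2≤k
  open WheelTrees k 2≤k
  open WheelSigns k 2≤k

  word : (ℕ → Bool) → List Bool
  word C = map C (range k)

  word-length : ∀ C → length (word C) ≡ k
  word-length C = trans (length-map C (range k)) (trans (length-map {A = ℕ} {B = ℕ} suc (upTo k)) (length-upTo k))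

  -- Indices start at 1, letters at 0.
  member : List Bool → ℕ → Bool
  member w i = letter w (i ∸ 1)

  word-member : ∀ {w} → length w ≡ k → word (member w) ≡ w
  word-member {w} refl = trans (sym (map-∘ (upTo k))) (trans (map-upTo (letter w) k) (applyUpTo-letter w))

  word-≡⇒treeOf-≡ : ∀ {C D} → word C ≡ word D → treeOf C ≡ treeOf D
  word-≡⇒treeOf-≡ eq = ⊆-antisym (sub eq) (sub (sym eq))
    where
    sub : ∀ {C D} → word C ≡ word D → ∀ {e} → e ∈ₛ treeOf C → e ∈ₛ treeOf D
    sub eq e∈ with treeOf⁻ e∈
    ... | i , i∈ , tri≡ = treeOf⁺ i∈ (trans tri≡ (cong (λ b → if b then A i else B i) (map-≡⇒pointwise eq (range⁺ i∈))))

  -- The tree remembers the index set: i belongs to it exactly if `A i` is a triple of the tree.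
  treeOf-≡⇒word-≡ : ∀ {C D} → treeOf C ≡ treeOf D → word C ≡ word D
  treeOf-≡⇒word-≡ {C} {D} eq = pointwise⇒map-≡ (range k) λ i∈ →
    let e , tri≡ = edge-A (range⁻ i∈) in trans (sym (at C e tri≡)) (trans (cong (λ T → Vec.lookup T e) eq) (at D e tri≡))
    where
    at : ∀ C e {i} → tri H e ≡ A i → Vec.lookup (treeOf C) e ≡ C i
    at C e tri≡ = trans (lookup∘tabulate (selected C ∘ tri H) e) (cong (selected C) tri≡)

  valid⇒treeWord : ∀ {C s} → Valid C s → TreeWord (word C)
  valid⇒treeWord {C} (full all) = subst TreeWord (sym (all-true (range k) (all ∘ range⁻))) (full _)
    where
    all-true : ∀ is → (∀ {i} → i ∈ is → C i ≡ true) → map C is ≡ replicate (length is) true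
    all-true [] h = refl
    all-true (i ∷ is) h = cong₂ _∷_ (h (here refl)) (all-true is (h ∘ there))
  valid⇒treeWord {C} (cyclic {c₀} ch c₀∈ Cc₀) = subst (TreeWord ∘ map C) (sym range-∷)
    (cyclic (Chain-map proj₂ ch) (subst₂ (λ x l → x ∈ map C l) Cc₀ range-∷ (∈-map⁺ C (range⁺ c₀∈))))

  treeWord⇒valid : ∀ {C} → TreeWord (word C) → ∃ (Valid C)
  treeWord⇒valid {C} tw = go tw refl
    where
    go : ∀ {w} → TreeWord w → w ≡ word C → ∃ (Valid C)
    go (full n) eq = _ , full (λ i∈ → map-replicate (range k) {n} (sym eq) (range⁺ i∈))
    go (cyclic {x} {w} ch t∈) eq with ∷-injective (trans eq (cong (map C) range-∷)) | ∈-map⁻ C (subst (true ∈_) eq t∈)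
    ... | refl , refl | c₀ , c₀∈ , Cc₀ =
      _ , cyclic (Chain-zip (range-chain λ _ → refl) ch) (range⁻ c₀∈) (sym Cc₀)

  trees : List (Subset (#E H))
  trees = map (λ w → treeOf (member w)) (treeWords k)

  trees-unique : Unique trees
  trees-unique = Unique-map-∈ injective (treeWords-unique 2≤k)
    where
    injective : ∀ {v w} → v ∈ treeWords k → w ∈ treeWords k → treeOf (member v) ≡ treeOf (member w) → v ≡ w
    injective {v} {w} v∈ w∈ eq = trans (sym (word-member (proj₁ (treeWords⁻ k v∈))))
      (trans (treeOf-≡⇒word-≡ {member v} {member w} eq) (word-member (proj₁ (treeWords⁻ k w∈))))

  trees⁻ : ∀ {T} → T ∈ trees → IsSpanningTree H T
  trees⁻ T∈ with ∈-map⁻ (λ w → treeOf (member w)) T∈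
  ... | w , w∈ , refl with treeWords⁻ k w∈
  ... | len , tw with treeWord⇒valid {member w} (subst TreeWord (sym (word-member len)) tw)
  ... | s , v = spanned⇒tree {member w} {s} (valid⇒spanned v)

  valid⇒∈trees : ∀ {C s} → Valid C s → treeOf C ∈ trees
  valid⇒∈trees {C} v = subst (_∈ trees) same (∈-map⁺ (λ w → treeOf (member w)) word∈)
    where
    same : treeOf (member (word C)) ≡ treeOf C
    same = word-≡⇒treeOf-≡ {member (word C)} {C} (word-member {word C} (word-length C))
    nonempty : 1 ≤ length (word C)
    nonempty = subst (1 ≤_) (sym (word-length C)) (ℕ.≤-trans (s≤s z≤n) 2≤k)
    word∈ : word C ∈ treeWords k
    word∈ = subst (λ n → word C ∈ treeWords n) (word-length C) (treeWords⁺ nonempty (valid⇒treeWord v))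

  trees⁺ : ∀ {T} → IsSpanningTree H T → T ∈ trees
  trees⁺ st = let C , s , T≡ , v = classify st in subst (_∈ trees) (sym T≡) (valid⇒∈trees {C} {s} v)

  trees-length : length trees ≡ L k
  trees-length = trans (length-map (λ w → treeOf (member w)) (treeWords k)) (count k 2≤k)
    where
    count : ∀ k → 2 ≤ k → length (treeWords k) ≡ L k
    count (suc n) _ = treeWords-length n

  numSpanningTrees : NumSpanningTrees H (L k)
  numSpanningTrees = trees , trees-unique , (λ T → mk⇔ (trees⁻ {T}) (trees⁺ {T})) , trees-length

-- Pfaffian orientations

parity-double : ∀ q → parity (q * 2) ≡ plus
parity-double zero = refl
parity-double (suc q) = parity-double q

even⇒parity : ∀ {k} → 2 ∣ k → parity k ≡ plus
even⇒parity (divides q refl) = parity-double q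

parity⇒even : ∀ k → parity k ≡ plus → 2 ∣ k
parity⇒even zero _ = 2 ∣0
parity⇒even (suc (suc k)) eq = ∣m∣n⇒∣m+n (∣-refl {2}) (parity⇒even k eq)

odd⇒parity : ∀ {k} → ¬ 2 ∣ k → parity k ≡ minus
odd⇒parity {k} ¬even with parity k in eq
... | plus = contradiction (parity⇒even k eq) ¬even
... | minus = refl

Chain-link : ∀ {A : Set} {R : A → A → Set} {x l y z} → Chain R x l y → z ∈ y ∷ l → ∃ λ w → R w z
Chain-link [ r ] (here refl) = _ , r
Chain-link (r ∷ ch) (here refl) = Chain-link ch (here refl)
Chain-link (r ∷ ch) (there (here refl)) = _ , r
Chain-link (r ∷ ch) (there (there m)) = Chain-link ch (there m)

∏-plus : ∀ {A : Set} {h : A → Sign} xs → (∀ {x} → x ∈ xs → h x ≡ plus) → ∏ (map h xs) ≡ plus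
∏-plus [] _ = refl
∏-plus (x ∷ xs) eq rewrite eq (here refl) = ∏-plus xs (eq ∘ there)

∏-single-minus : ∀ {A : Set} {h : A → Sign} {y} xs → Unique xs → y ∈ xs → h y ≡ minus →
  (∀ {x} → x ∈ xs → x ≢ y → h x ≡ plus) → ∏ (map h xs) ≡ minus
∏-single-minus (x ∷ xs) (x∉ ∷ u) (here refl) hy hx rewrite hy =
  cong opposite (∏-plus xs λ z∈ → hx (there z∈) λ { refl → All.lookup x∉ z∈ refl })
∏-single-minus (x ∷ xs) (x∉ ∷ u) (there y∈) hy hx rewrite hx (here refl) (λ { refl → All.lookup x∉ y∈ refl }) =
  ∏-single-minus xs u y∈ hy (hx ∘ there)

∏-· : ∀ {A : Set} (g h : A → Sign) xs → ∏ (map g xs) · ∏ (map h xs) ≡ ∏ (map (λ x → g x · h x) xs)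
∏-· g h [] = refl
∏-· g h (x ∷ xs) = begin
  (g x · G) · (h x · ∏ (map h xs))   ≡⟨ *-assoc (g x) G _ ⟩
  g x · (G · (h x · ∏ (map h xs)))   ≡⟨ cong (g x ·_) (·-left-comm G (h x) _) ⟩
  g x · (h x · (G · ∏ (map h xs)))   ≡⟨ *-assoc (g x) (h x) _ ⟨
  (g x · h x) · (G · ∏ (map h xs))   ≡⟨ cong ((g x · h x) ·_) (∏-· g h xs) ⟩
  ∏ (map (λ x → g x · h x) (x ∷ xs)) ∎
  where
  open ≡-Reasoning
  G = ∏ (map g xs)

isOdd : ℕ → Bool
isOdd zero = false
isOdd (suc n) = not (isOdd n)

isOdd-even : ∀ k → parity k ≡ plus → isOdd k ≡ false
isOdd-even zero _ = refl
isOdd-even (suc (suc k)) eq rewrite isOdd-even k eq = refl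

module WheelPfaffian (k : ℕ) (2≤k : 2 ≤ k) where
  open Wheel k 2≤k
  open WheelTrees k 2≤k
  open WheelSigns k 2≤k

  standard : Orientation H
  standard _ = true

  sgn-standard : ∀ {C s} → Valid C s → sgn H (treeOf C) standard ≡ s · reference
  sgn-standard {C} {s} v = trans (sgn-treeOf v (λ _ → true) (λ _ → refl))
    (cong (_· (s · reference)) (∏-plus (range k) λ _ → refl))

  by-index-set : (P : Subset (#E H) → Set) → (∀ {C s} → Valid C s → P (treeOf C)) → ∀ {T} → IsSpanningTree H T → P T
  by-index-set P h st = let C , s , T≡ , v = classify st in subst P (sym T≡) (h {C} {s} v)

  odd-pfaffian : ¬ 2 ∣ k → Is3Pfaffian H
  odd-pfaffian ¬even = standard , λ T T′ st st′ → trans (const st) (sym (const st′))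
    where
    plus-sign : ∀ {C s} → Valid C s → s ≡ plus
    plus-sign (full _) = refl
    plus-sign (cyclic _ _ _) = cong opposite (odd⇒parity ¬even)
    const : ∀ {T} → IsSpanningTree H T → sgn H T standard ≡ reference
    const = by-index-set (λ T → sgn H T standard ≡ reference)
      λ {C} {s} v → trans (sgn-standard {C} {s} v) (cong (_· reference) (plus-sign v))

  module Even (even : parity k ≡ plus) where

    isNot-full : ∀ {C s i} → Valid C s → i ∈[1, k ] → C i ≡ false → s ≡ minus
    isNot-full (full all) i∈ Ci = contradiction (trans (sym (all i∈)) Ci) λ ()
    isNot-full (cyclic _ _ _) _ _ = cong opposite even

    const-without : ∀ {C s i} → Valid C s → i ∈[1, k ] → C i ≡ false → sgn H (treeOf C) standard ≡ opposite reference
    const-without v i∈ Ci = trans (sgn-standard v) (cong (_· reference) (isNot-full v i∈ Ci))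

    next : ∀ {i} → i ∈[1, k ] → ∃ λ n → n ∈[1, k ] × prev1 k n ≡ i
    next {i} i∈ with i ≟ k
    ... | yes refl = 1 , (s≤s z≤n , ℕ.≤-trans (s≤s z≤n) 2≤k) , refl
    next {suc j} (_ , i≤k) | no i≢k = suc (suc j) , (s≤s z≤n , ℕ.≤∧≢⇒< i≤k i≢k) , refl

    -- Among the trees with A i, exactly the full one contains the flipped triple A (i + 1).
    module Flip {i : ℕ} (i∈ : i ∈[1, k ]) where

      n : ℕ
      n = proj₁ (next i∈)

      n∈ : n ∈[1, k ]
      n∈ = proj₁ (proj₂ (next i∈))

      Ω : Triple → Bool
      Ω t = not (does (t ≟ₜ A n))

      flipped : Orientation H
      flipped e = Ω (tri H e)

      Ω-A : Ω (A n) ≡ false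
      Ω-A = cong not (dec-true (A n ≟ₜ A n) refl)

      Ω-≢ : ∀ {t} → t ≢ A n → Ω t ≡ true
      Ω-≢ {t} t≢ = cong not (dec-false (t ≟ₜ A n) t≢)

      const-with : ∀ {C s} → Valid C s → C i ≡ true → sgn H (treeOf C) flipped ≡ opposite reference
      const-with {C} {s} v Ci = trans (sgn-treeOf v Ω (λ _ → refl)) (go v)
        where
        pick-≢ : ∀ {j} → j ∈[1, k ] → (C j ≡ true → j ≢ n) → pick C j ≢ A n
        pick-≢ {j} j∈ h eq with C j in Cj
        ... | true = h refl (A-injective eq)
        ... | false = A≢B j∈ (sym eq)
        go : ∀ {s} → Valid C s → ∏ω C Ω · (s · reference) ≡ opposite reference
        go (full all) = cong (_· reference) (∏-single-minus (range k) (range-unique k) (range⁺ n∈)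
          (cong χ (trans (cong (λ b → Ω (if b then A n else B n)) (all n∈)) Ω-A))
          (λ x∈ x≢n → cong χ (Ω-≢ (pick-≢ (range⁻ x∈) λ _ → x≢n))))
        go (cyclic ch _ _) = trans (cong (_· (opposite (parity k) · reference)) all-plus)
          (cong (λ s → opposite s · reference) even)
          where
          Cn : C n ≡ false
          Cn with Chain-link ch (subst (n ∈_) range-∷ (range⁺ n∈))
          ... | _ , refl , h = ∧≡false⇒ʳ (trans (cong (λ m → C m ∧ C n) (sym (proj₂ (proj₂ (next i∈))))) h) Ci
          all-plus : ∏ω C Ω ≡ plus
          all-plus = ∏-plus (range k) λ x∈ → cong χ (Ω-≢ (pick-≢ (range⁻ x∈)
            λ { Cx refl → contradiction (trans (sym Cx) Cn) λ () }))

    constant : ∀ {i} → i ∈[1, k ] → ∀ b → ∃ λ ω → ∀ {C s} → Valid C s → C i ≡ b → sgn H (treeOf C) ω ≡ opposite reference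
    constant i∈ false = standard , λ {C} {s} v → const-without {C} {s} v i∈
    constant i∈ true = Flip.flipped i∈ , λ {C} {s} v → Flip.const-with i∈ {C} {s} v

    -- In the applications `P` says that the tree contains, or avoids, a fixed triple with index
    -- `i`, and this decides whether `i` lies in `C`.
    constant-on : (P : Subset (#E H) → Set) → ∀ {i} → i ∈[1, k ] → ∀ b → (∀ C → P (treeOf C) → C i ≡ b) →
      ∃ λ ω → ∀ T T′ → IsSpanningTree H T → IsSpanningTree H T′ → P T → P T′ → sgn H T ω ≡ sgn H T′ ω
    constant-on P i∈ b h = ω , λ T T′ st st′ p p′ → trans (const st p) (sym (const st′ p′))
      where
      ω = proj₁ (constant i∈ b)
      const : ∀ {T} → IsSpanningTree H T → P T → sgn H T ω ≡ opposite reference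
      const = by-index-set (λ T → P T → sgn H T ω ≡ opposite reference)
        λ {C} {s} v p → proj₂ (constant i∈ b) {C} {s} v (h C p)

    pick-true : ∀ {C i} → C i ≡ true → pick C i ≡ A i
    pick-true eq = cong (λ b → if b then A _ else B _) eq

    pick-false : ∀ {C i} → C i ≡ false → pick C i ≡ B i
    pick-false eq = cong (λ b → if b then A _ else B _) eq

    A-∈ : ∀ {C e i} → i ∈[1, k ] → tri H e ≡ A i → C i ≡ true → e ∈ₛ treeOf C
    A-∈ {C} i∈ eq Ci = treeOf⁺ {C} i∈ (trans eq (sym (pick-true {C} Ci)))

    B-∈ : ∀ {C e i} → i ∈[1, k ] → tri H e ≡ B i → C i ≡ false → e ∈ₛ treeOf C
    B-∈ {C} i∈ eq Ci = treeOf⁺ {C} i∈ (trans eq (sym (pick-false {C} Ci)))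

    A-∈⁻ : ∀ {C e i} → i ∈[1, k ] → tri H e ≡ A i → e ∈ₛ treeOf C → C i ≡ true
    A-∈⁻ {C} i∈ eq e∈ with treeOf⁻ {C} e∈
    ... | j , j∈ , eq′ with C j in Cj
    ... | true = subst (λ j → C j ≡ true) (sym (A-injective (trans (sym eq) eq′))) Cj
    ... | false = contradiction (trans (sym eq) eq′) (A≢B j∈)

    B-∈⁻ : ∀ {C e i} → i ∈[1, k ] → tri H e ≡ B i → e ∈ₛ treeOf C → C i ≡ false
    B-∈⁻ {C} i∈ eq e∈ with treeOf⁻ {C} e∈
    ... | j , j∈ , eq′ with C j in Cj
    ... | true = contradiction (trans (sym eq′) eq) (A≢B i∈)
    ... | false = subst (λ j → C j ≡ false) (sym (B-injective (trans (sym eq) eq′))) Cj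

    deletions : ∀ e → Is3Pfaffian (delete H e)
    deletions e with edge e
    ... | i , i∈ , inj₁ eq =
      let ω , const = constant-on (e ∉ₛ_) i∈ false (λ C e∉ → ¬-not (λ Ci → e∉ (A-∈ {C} i∈ eq Ci)))
      in delete-pfaffian wellFormed large e ω const
    ... | i , i∈ , inj₂ eq =
      let ω , const = constant-on (e ∉ₛ_) i∈ true (λ C e∉ → ¬-not (λ Ci → e∉ (B-∈ {C} i∈ eq Ci)))
      in delete-pfaffian wellFormed large e ω const

    contractions : ∀ e r → Is3Pfaffian (contract H e r)
    contractions e with edge e
    ... | i , i∈ , inj₁ eq =
      let ω , const = constant-on (e ∈ₛ_) i∈ true (λ C → A-∈⁻ {C} i∈ eq)
      in contract-pfaffian wellFormed large e ω const
    ... | i , i∈ , inj₂ eq =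
      let ω , const = constant-on (e ∈ₛ_) i∈ false (λ C → B-∈⁻ {C} i∈ eq)
      in contract-pfaffian wellFormed large e ω const

    -- The trees for all indices, the odd ones, the even ones except k, and k alone contain
    -- each triple an even number of times, but only the first has sign plus.
    module FourTrees (4≤k : 4 ≤ k) where

      everything odds evens last : ℕ → Bool
      everything _ = true
      odds = isOdd
      evens i = not (isOdd i) ∧ not (i ≡ᵇ k)
      last i = i ≡ᵇ k

      link : ∀ C → C k ∧ C 1 ≡ false → (∀ {j} → suc (suc j) ≤ k → C (suc j) ∧ C (suc (suc j)) ≡ false) →
        Chain (Link C) 1 tail 1
      link C h₁ h = range-chain both
        where
        both : ∀ {i} → i ∈[1, k ] → Link C (prev1 k i) i
        both {suc zero} _ = refl , h₁
        both {suc (suc j)} (_ , i≤k) = refl , h i≤k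

      k-even : isOdd k ≡ false
      k-even = isOdd-even k even

      k∈ : k ∈[1, k ]
      k∈ = ℕ.≤-trans (s≤s z≤n) 2≤k , ℕ.≤-refl

      1∈ : 1 ∈[1, k ]
      1∈ = s≤s z≤n , ℕ.≤-trans (s≤s z≤n) 2≤k

      everything-valid : Valid everything plus
      everything-valid = full λ _ → refl

      -- Around the end, 1 and `k` are adjacent; they are not both odd because `k` is even.
      odds-valid : Valid odds (opposite (parity k))
      odds-valid = cyclic (link odds (cong (_∧ true) k-even) (λ {j} _ → ∧-inverseʳ (isOdd (suc j)))) 1∈ refl

      evens-valid : Valid evens (opposite (parity k))
      evens-valid = cyclic (link evens (∧-zeroʳ (evens k)) (λ {j} _ → alternate (isOdd (suc j)) _ _)) (s≤s z≤n , 2≤k)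
        -- The set is nonempty: it contains 2, which differs from `k` because `4 ≤ k`.
        (cong not (≢⇒≡ᵇ≡false (ℕ.<⇒≢ (ℕ.≤-trans (s≤s (s≤s (s≤s z≤n))) 4≤k))))
        where
        alternate : ∀ a b c → (not a ∧ b) ∧ (not (not a) ∧ c) ≡ false
        alternate true b c = refl
        alternate false b c = ∧-zeroʳ b

      last-valid : Valid last (opposite (parity k))
      last-valid = cyclic (link last (trans (cong (last k ∧_) (≢⇒≡ᵇ≡false (ℕ.<⇒≢ 2≤k))) (∧-zeroʳ (last k)))
        (λ {j} le → cong (_∧ last (suc (suc j))) (≢⇒≡ᵇ≡false (ℕ.<⇒≢ le)))) k∈ (≡ᵇ-refl k)

      module _ (ω : Orientation H) where

        Ω : Triple → Bool
        Ω = onTriples ω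

        h : (ℕ → Bool) → ℕ → Sign
        h C = χ ∘ Ω ∘ pick C

        sgn-ω : ∀ {C s} → Valid C s → sgn H (treeOf C) ω ≡ ∏ω C Ω · (s · reference)
        sgn-ω v = sgn-treeOf v Ω (onTriples-tri ω)

        twice : ∀ i → i ∈ range k → h everything i · (h odds i · (h evens i · h last i)) ≡ plus
        twice i i∈ with isOdd i in oddi | i ≡ᵇ k in i≡k
        ... | true | true = contradiction (trans (sym oddi) (trans (cong isOdd (≡ᵇ-true⇒≡ {i} {k} i≡k)) k-even)) λ ()
        ... | true | false = aabb (χ (Ω (A i))) (χ (Ω (B i)))
          where
          aabb : ∀ a b → a · (a · (b · b)) ≡ plus
          aabb plus plus = refl
          aabb plus minus = refl
          aabb minus plus = refl
          aabb minus minus = refl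
        ... | false | true = abba (χ (Ω (A i))) (χ (Ω (B i)))
          where
          abba : ∀ a b → a · (b · (b · a)) ≡ plus
          abba plus plus = refl
          abba plus minus = refl
          abba minus plus = refl
          abba minus minus = refl
        ... | false | false = abab (χ (Ω (A i))) (χ (Ω (B i)))
          where
          abab : ∀ a b → a · (b · (a · b)) ≡ plus
          abab plus plus = refl
          abab plus minus = refl
          abab minus plus = refl
          abab minus minus = refl

        product : ∏ω everything Ω · (∏ω odds Ω · (∏ω evens Ω · ∏ω last Ω)) ≡ plus
        product = begin
          ∏ω everything Ω · (∏ω odds Ω · (∏ω evens Ω · ∏ω last Ω))
            ≡⟨ cong (λ s → ∏ω everything Ω · (∏ω odds Ω · s)) (∏-· (h evens) (h last) (range k)) ⟩
          ∏ω everything Ω · (∏ω odds Ω · ∏ (map (λ i → h evens i · h last i) (range k)))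
            ≡⟨ cong (∏ω everything Ω ·_) (∏-· (h odds) (λ i → h evens i · h last i) (range k)) ⟩
          ∏ω everything Ω · ∏ (map (λ i → h odds i · (h evens i · h last i)) (range k))
            ≡⟨ ∏-· (h everything) (λ i → h odds i · (h evens i · h last i)) (range k) ⟩
          ∏ (map (λ i → h everything i · (h odds i · (h evens i · h last i))) (range k))
            ≡⟨ ∏-plus (range k) (λ {i} → twice i) ⟩
          plus ∎
          where open ≡-Reasoning

        sign-clash : ∀ {p q r s} → s ≡ minus → p · (plus · r) ≡ q · (s · r) → q ≡ opposite p
        sign-clash {plus} {minus} refl _ = refl
        sign-clash {minus} {plus} refl _ = refl
        sign-clash {plus} {plus} {plus} refl ()
        sign-clash {plus} {plus} {minus} refl ()
        sign-clash {minus} {minus} {plus} refl ()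
        sign-clash {minus} {minus} {minus} refl ()

        -- The product is the fourth power of `p` with three changes of sign.
        four-opposite : ∀ {p q r s} → q ≡ opposite p → r ≡ opposite p → s ≡ opposite p → p · (q · (r · s)) ≢ plus
        four-opposite {plus} refl refl refl ()
        four-opposite {minus} refl refl refl ()

        not-constant : ¬ (∀ T T′ → IsSpanningTree H T → IsSpanningTree H T′ → sgn H T ω ≡ sgn H T′ ω)
        not-constant const = four-opposite (against odds-valid) (against evens-valid) (against last-valid) product
          where
          tree : ∀ {C s} → Valid C s → IsSpanningTree H (treeOf C)
          tree {C} {s} v = spanned⇒tree {C} {s} (valid⇒spanned v)
          against : ∀ {C} → Valid C (opposite (parity k)) → ∏ω C Ω ≡ opposite (∏ω everything Ω)
          against {C} v = sign-clash {∏ω everything Ω} {∏ω C Ω} {reference} (cong opposite even)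
            (trans (sym (sgn-ω everything-valid)) (trans (const _ _ (tree everything-valid) (tree v)) (sgn-ω v)))

      not-pfaffian : ¬ Is3Pfaffian H
      not-pfaffian (ω , const) = not-constant ω const

theorem6p4 : (∀ k → 2 ≤ k → NumSpanningTrees (Hk k) (L k))
    × (∀ k → 2 ≤ k → ¬ (2 ∣ k) → Is3Pfaffian (Hk k))
    × (∀ k → 4 ≤ k → 2 ∣ k → ¬ Is3Pfaffian (Hk k))
    × (∀ k → 4 ≤ k → 2 ∣ k → MinimalNon3Pfaffian (Hk k))
theorem6p4 =
  (λ k 2≤k → WheelCount.numSpanningTrees k 2≤k) ,
  (λ k 2≤k → WheelPfaffian.odd-pfaffian k 2≤k) ,
  non-pfaffian ,
  (λ k 4≤k even → non-pfaffian k 4≤k even ,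
    WheelPfaffian.Even.deletions k (2≤ 4≤k) (even⇒parity even) ,
    WheelPfaffian.Even.contractions k (2≤ 4≤k) (even⇒parity even))
  where
  2≤ : ∀ {k} → 4 ≤ k → 2 ≤ k
  2≤ = ℕ.≤-trans (s≤s (s≤s z≤n))
  non-pfaffian : ∀ k → 4 ≤ k → 2 ∣ k → ¬ Is3Pfaffian (Hk k)
  non-pfaffian k 4≤k even = WheelPfaffian.Even.FourTrees.not-pfaffian k (2≤ 4≤k) (even⇒parity even) 4≤k
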